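{- For all integers $2 \le \ell < k \le t$, $\pi_{\ell}(K_t^k) \ge \pi_{1}(K_{t-\ell+1}^{k-\ell+1})$. In particular, for all integers $3\le k\le t$, $\pi_{k-1}(K_t^k) \ge (t-k)/(t-k+1)$, and $\pi_{k-1}(K_{k+1}^k) \ge 1/2$.
   Context: For an integer $r\ge 2$, an $r$-graph $H$ is a pair $(V(H),E(H))$ where $V(H)$ is a finite set and $E(H)$ is a set of $r$-subsets of $V(H)$. $K_t^r$ denotes the complete $r$-graph on $t$ vertices (all $r$-subsets are edges). For $0\le j<r$ and a $j$-subset $T$ of $V(H)$, $\deg^H(T)$ is the number of $(r-j)$-subsets $S$ of $V(H)$ with $S\cup T\in E(H)$, and $\delta_j(H)=\min\{\deg^H(T): T\subseteq V(H), |T|=j\}$. For an $r$-graph $F$, let $\mathrm{ex}_j(n,F)$ be the maximum of $\delta_j(H)$ over all $r$-graphs $H$ on $n$ vertices containing no copy of $F$ as a (not necessarily induced) subgraph, and let $\pi_j(F)=\limsup_{n\to\infty}\mathrm{ex}_j(n,F)/\binom{n}{r-j}$. -}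

module Defs where

import Data.Bool.Properties as Bool
open import Data.Fin using (Fin)
import Data.Fin.Properties as Fin
open import Data.Fin.Subset using (Subset; inside; outside; ∣_∣; _∪_; ⋃; ⁅_⁆)
import Data.Fin.Subset.Properties as Subset
open import Data.Integer using (+_)
open import Data.List using (List; []; _∷_; _++_; map; filter; foldr; length; allFin)
open import Data.List.Relation.Unary.All using (All; all?)
open import Data.List.Relation.Unary.All.Properties using (all-filter)
import Data.List.Membership.DecPropositional as DecMembership
open import Data.Nat using (ℕ; zero; suc; _∸_; _⊔_; _⊓_; _≟_)
import Data.Nat as ℕ
open import Data.Nat.Combinatorics using (_C_)
open import Data.Product using (∃; _×_; _,_; proj₁)
open import Data.Rational using (ℚ; 0ℚ; _/_; _<_)
open import Data.Rational.Properties using (<-trans; <-dense)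
open import Data.Vec using (Vec; []; _∷_; lookup)
import Data.Vec.Properties as Vec
open import Relation.Binary.PropositionalEquality using (_≡_)
open import Relation.Nullary using (Dec; ¬?)
open import Relation.Nullary.Decidable using (map′; _×-dec_; _→-dec_)
open import Relation.Unary using (Decidable)

------------------------------------------------------------------------
-- Extended reals

-- The extended real x is represented by its open lower cut
-- { q ∈ ℚ : q < x }; the empty cut is -∞ and the full cut is +∞.
record ℝ∞ : Set₁ where
  field
    _∋_     : ℚ → Set
    lower   : ∀ {p q} → p < q → _∋_ q → _∋_ p
    rounded : ∀ {p} → _∋_ p → ∃ λ q → p < q × _∋_ q

open ℝ∞ public using (_∋_)

infix 4 _≥ᴿ_

_≥ᴿ_ : ℝ∞ → ℝ∞ → Set
x ≥ᴿ y = ∀ q → y ∋ q → x ∋ q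

fromℚ : ℚ → ℝ∞
fromℚ x = record
  { _∋_     = λ q → q < x
  ; lower   = <-trans
  ; rounded = <-dense
  }

sup : {I : Set} → (I → ℝ∞) → ℝ∞
sup x = record
  { _∋_     = λ q → ∃ λ i → x i ∋ q
  ; lower   = λ { p<q (i , q<x) → i , ℝ∞.lower (x i) p<q q<x }
  ; rounded = λ { (i , p<x) → let q , p<q , q<x = ℝ∞.rounded (x i) p<x
                              in q , p<q , i , q<x }
  }

-- An intersection of open cuts need not be open, so the infimum takes
-- its interior: q < inf x iff some q′ > q is below every x i.
inf : {I : Set} → (I → ℝ∞) → ℝ∞
inf x = record
  { _∋_     = λ q → ∃ λ q′ → q < q′ × (∀ i → x i ∋ q′)
  ; lower   = λ { p<q (q′ , q<q′ , q′<x) → q′ , <-trans p<q q<q′ , q′<x }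
  ; rounded = λ { (q′ , p<q′ , q′<x) → let q , p<q , q<q′ = <-dense p<q′
                                       in q , p<q , q′ , q<q′ , q′<x }
  }

limsup : (ℕ → ℚ) → ℝ∞
limsup a = inf {ℕ} λ N → sup {∃ λ n → N ℕ.≤ n} λ i → fromℚ (a (proj₁ i))

------------------------------------------------------------------------
-- Finite enumerations

powerset : ∀ {A : Set} → List A → List (List A)
powerset []       = [] ∷ []
powerset (x ∷ xs) = powerset xs ++ map (x ∷_) (powerset xs)

allSubsets : ∀ n → List (Subset n)
allSubsets zero    = [] ∷ []
allSubsets (suc n) = map (inside ∷_) (allSubsets n) ++ map (outside ∷_) (allSubsets n)

subsetsOfSize : ∀ n → ℕ → List (Subset n)
subsetsOfSize n r = filter (λ S → ∣ S ∣ ≟ r) (allSubsets n)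

-- The minimum and maximum of the empty list are 0 by convention.
minimum : List ℕ → ℕ
minimum []       = 0
minimum (x ∷ xs) = foldr _⊓_ x xs

maximum : List ℕ → ℕ
maximum = foldr _⊔_ 0

------------------------------------------------------------------------
-- r-graphs

module _ {n : ℕ} where
  open DecMembership (Vec.≡-dec {n = n} Bool._≟_) public using (_∈_; _∈?_)

-- r-graphs with vertex set Fin n.  The list of edges represents a finite
-- set: only membership in it is ever used.
record Graph (r n : ℕ) : Set where
  constructor mkGraph
  field
    edges   : List (Subset n)
    uniform : All (λ e → ∣ e ∣ ≡ r) edges

open Graph public

fromList : ∀ {r n} → List (Subset n) → Graph r n
fromList {r} es = mkGraph (filter (λ e → ∣ e ∣ ≟ r) es) (all-filter (λ e → ∣ e ∣ ≟ r) es)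

-- Every r-graph on Fin n, up to the order and repetition of its edges.
allGraphs : ∀ r n → List (Graph r n)
allGraphs r n = map fromList (powerset (subsetsOfSize n r))

-- The complete r-graph on t vertices; the uniformity comes second, as in
-- the notation K_t^r.
K : ∀ t r → Graph r t
K t r = fromList (allSubsets t)

deg : ∀ {r n} → Graph r n → Subset n → ℕ
deg {r} {n} H T = length (filter (λ S → (S ∪ T) ∈? edges H) (subsetsOfSize n (r ∸ ∣ T ∣)))

δ : ∀ {r n} → ℕ → Graph r n → ℕ
δ {n = n} j H = minimum (map (deg H) (subsetsOfSize n j))

-- Maps Fin m → Fin n are stored as vectors of values, so that they can
-- be searched exhaustively.
image : ∀ {m n} → Vec (Fin n) m → Subset m → Subset n
image {m} φ e = ⋃ (map (λ i → ⁅ lookup φ i ⁆) (filter (Subset._∈? e) (allFin m)))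

IsCopy : ∀ {r m n} → Graph r n → Graph r m → Vec (Fin n) m → Set
IsCopy H F φ = (∀ i j → lookup φ i ≡ lookup φ j → i ≡ j)
             × All (λ e → image φ e ∈ edges H) (edges F)

Contains : ∀ {r m n} → Graph r n → Graph r m → Set
Contains H F = ∃ λ φ → IsCopy H F φ

anyVec? : ∀ {m n} {P : Vec (Fin n) m → Set} → Decidable P → Dec (∃ P)
anyVec? {zero}  P? = map′ (λ p → [] , p) (λ { ([] , p) → p }) (P? [])
anyVec? {suc m} P? = map′ (λ { (x , xs , p) → x ∷ xs , p }) (λ { (x ∷ xs , p) → x , xs , p })
                          (Fin.any? λ x → anyVec? λ xs → P? (x ∷ xs))

isCopy? : ∀ {r m n} (H : Graph r n) (F : Graph r m) → Decidable (IsCopy H F)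
isCopy? H F φ =
  (Fin.all? λ i → Fin.all? λ j → (lookup φ i Fin.≟ lookup φ j) →-dec (i Fin.≟ j))
  ×-dec all? (λ e → image φ e ∈? edges H) (edges F)

contains? : ∀ {r m n} (H : Graph r n) (F : Graph r m) → Dec (Contains H F)
contains? H F = anyVec? (isCopy? H F)

ex : ∀ {r m} → ℕ → ℕ → Graph r m → ℕ
ex {r} j n F = maximum (map (δ j) (filter (λ H → ¬? (contains? H F)) (allGraphs r n)))

-- A zero denominator is sent to 0.  It arises below only for n < r ∸ j,
-- which does not affect the limsup.
ratio : ℕ → ℕ → ℚ
ratio a zero    = 0ℚ
ratio a (suc d) = + a / suc d

-- Meaningful for j < r.
π : ∀ {r m} → ℕ → Graph r m → ℝ∞
π {r} j F = limsup λ n → ratio (ex j n F) (n C (r ∸ j))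

{-# OPTIONS --safe #-}
module Submission where

-- Let G be a K_{t-ℓ+1}^{k-ℓ+1}-free graph on the colours [m].  Colour the ℓ-sets of an ordered
-- vertex set by [m] and let a k-set be an edge if, A being its first ℓ - 1 vertices, the colours of
-- A ∪ {x} for its other vertices x form an edge of G.  In a clique all edges on the first ℓ - 1
-- vertices share A, so a K_t^k would give a K_{t-ℓ+1}^{k-ℓ+1} in G.  For a random colouring, an
-- ℓ-set T lies in about the proportion δ_1(G) / C(m, k-ℓ) of the k-sets: T has a vertex outside A,
-- and given its colour the other colours behave as independent uniform ones.
--
-- The colouring used here is explicit up to a Gilbert–Varshamov code.  A vertex carries a codeword
-- and a key, a key being a position α and a function h from letters to colours; the keys of A are
-- added up to (α , h), and A ∪ {x} is coloured by h applied to letter α of x.  Distinct codewords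
-- rarely share a letter, so a random key colours T independently; and there are far fewer keys than
-- vertices, so the keys are equidistributed over the vertices of short intervals.
--
-- For k = ℓ + 1 one may take for G the complete graph on t - k + 1 vertices.

open import Defs
import Data.Bool.Properties as Bool
open import Data.Empty using (⊥)
open import Data.Fin using (Fin; zero; suc; toℕ; fromℕ<; combine; remQuot; quotient; remainder; _↑ˡ_; _↑ʳ_)
import Data.Fin as Fin
import Data.Fin.Properties as Fin
open import Data.Fin.Subset using (Subset; inside; outside; ∣_∣; ⁅_⁆; _∪_; ⋃)
import Data.Fin.Subset as Subset
import Data.Fin.Subset.Properties as Subset
import Data.Integer as ℤ
import Data.Integer.Properties as ℤ
open import Data.List using (List; []; _∷_; _++_; map; concatMap; filter; foldr; length; allFin; replicate; take; drop)
import Data.List.Properties as List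
open import Data.List.Membership.Propositional using (find; lose) renaming (_∈_ to _∈ˡ_)
open import Data.List.Membership.Propositional.Properties
  using (∈-allFin; ∈-map⁺; ∈-map⁻; ∈-concatMap⁺; ∈-concatMap⁻; ∈-filter⁺; ∈-filter⁻; ∈-++⁺ˡ; ∈-++⁺ʳ; ∈-++⁻; ∈-AllPairs₂)
open import Data.List.Membership.Propositional.Properties.WithK using (unique∧set⇒bag)
open import Data.List.Relation.Binary.BagAndSetEquality using (∼bag⇒↭)
open import Data.List.Relation.Binary.Permutation.Propositional as Perm using (_↭_)
import Data.List.Relation.Binary.Permutation.Propositional.Properties as Perm
open import Data.List.Relation.Unary.All as All using (All; []; _∷_)
import Data.List.Relation.Unary.All.Properties as All
open import Data.List.Relation.Unary.AllPairs as AllPairs using (AllPairs; []; _∷_)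
import Data.List.Relation.Unary.AllPairs.Properties as AllPairs
open import Data.List.Relation.Unary.Any using (here; there)
import Data.List.Relation.Unary.Unique.DecPropositional as DecUnique
open import Data.List.Relation.Unary.Unique.Propositional using (Unique)
import Data.List.Relation.Unary.Unique.Propositional.Properties as Unique
open import Data.Nat using (ℕ; zero; suc; _+_; _*_; _∸_; _^_; _!; _≤_; _<_; _⊓_; z≤n; s≤s; _≤?_; NonZero)
import Data.Nat as ℕ
import Data.Nat.Properties as ℕ
open import Data.Nat.Combinatorics using (_C_; nCk+nC[k+1]≡[n+1]C[k+1]; k>n⇒nCk≡0; nC1≡n)
open import Data.Nat.Coprimality using (Coprime)
open import Data.Nat.DivMod using (_%_; _mod_; %-distribˡ-+; m<n⇒m%n≡m; m%n<n; m%n%n≡m%n; [m+n]%n≡m%n)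
open import Data.Nat.Tactic.RingSolver using (solve-∀)
open import Data.Product using (∃; _×_; _,_; proj₁; proj₂)
open import Data.Rational using (ℚ; mkℚ; _/_; ½)
import Data.Rational as ℚ
import Data.Rational.Properties as ℚ
import Data.Rational.Unnormalised as ℚᵘ
import Data.Rational.Unnormalised.Properties as ℚᵘ
open import Data.Sum using (inj₁; inj₂)
open import Data.Vec using (Vec; []; _∷_; here; there; lookup; toList; _[_]≔_)
import Data.Vec as Vec
import Data.Vec.Properties as Vec
open import Function using (_∘_; id; mk⇔)
open import Relation.Binary.PropositionalEquality
  using (_≡_; _≢_; refl; sym; trans; cong; cong₂; subst; subst₂; module ≡-Reasoning)
open import Relation.Nullary using (Dec; yes; no; ¬_; ¬?; contradiction)
open import Relation.Nullary.Decidable using (decidable-stable; _×-dec_)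

-- A random colouring would need a concentration bound and then a union bound over all ℓ-sets T.
-- With an explicit colouring the degree of T is a plain count: T is fixed, and the only randomness
-- is the choice of the other k - ℓ vertices. Keys are added because a sum is uniform as soon as one
-- summand is. If some vertex of A lies outside T, the key is therefore uniform, and the code makes
-- the colours of the fixed vertices nearly independent. If A lies inside T, the key is a constant,
-- but then only one coloured vertex is fixed, and its degree in G suffices provided that every
-- single key colours the free vertices uniformly. Which vertices form A depends on the order; once
-- the free vertices lie in distinct intervals that avoid T, the intervals alone decide it, and the
-- places inside them remain free to randomise keys and colours. Colours may repeat, so the density
-- of G is measured among all m ^ (k - ℓ) tuples of colours.

∑ : ∀ {A : Set} → List A → (A → ℕ) → ℕ
∑ []       f = 0
∑ (x ∷ xs) f = f x + ∑ xs f

𝟙 : ∀ {P : Set} → Dec P → ℕ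
𝟙 (yes _) = 1
𝟙 (no  _) = 0

𝟙-mono : ∀ {P Q : Set} (p : Dec P) (q : Dec Q) → (P → Q) → 𝟙 p ≤ 𝟙 q
𝟙-mono (no _)  q       f = z≤n
𝟙-mono (yes x) (yes _) f = ℕ.≤-refl
𝟙-mono (yes x) (no ¬q) f = contradiction (f x) ¬q

𝟙-cong : ∀ {P Q : Set} (p : Dec P) (q : Dec Q) → (P → Q) → (Q → P) → 𝟙 p ≡ 𝟙 q
𝟙-cong p q f g = ℕ.≤-antisym (𝟙-mono p q f) (𝟙-mono q p g)

𝟙-yes : ∀ {P : Set} (p : Dec P) → P → 𝟙 p ≡ 1
𝟙-yes (yes _) x = refl
𝟙-yes (no ¬x) x = contradiction x ¬x

𝟙-no : ∀ {P : Set} (p : Dec P) → ¬ P → 𝟙 p ≡ 0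
𝟙-no (yes x) ¬x = contradiction x ¬x
𝟙-no (no _)  ¬x = refl

𝟙≤1 : ∀ {P : Set} (p : Dec P) → 𝟙 p ≤ 1
𝟙≤1 (yes _) = ℕ.≤-refl
𝟙≤1 (no _)  = z≤n

-- Finite sums over lists and index sets.

module _ {A : Set} where

  ∑-mono-∈ : ∀ (xs : List A) {f g : A → ℕ} → (∀ {x} → x ∈ˡ xs → f x ≤ g x) → ∑ xs f ≤ ∑ xs g
  ∑-mono-∈ []       f≤g = z≤n
  ∑-mono-∈ (x ∷ xs) f≤g = ℕ.+-mono-≤ (f≤g (here refl)) (∑-mono-∈ xs (f≤g ∘ there))

  ∑-mono : ∀ (xs : List A) {f g : A → ℕ} → (∀ x → f x ≤ g x) → ∑ xs f ≤ ∑ xs g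
  ∑-mono xs f≤g = ∑-mono-∈ xs λ {x} _ → f≤g x

  ∑-cong-∈ : ∀ (xs : List A) {f g : A → ℕ} → (∀ {x} → x ∈ˡ xs → f x ≡ g x) → ∑ xs f ≡ ∑ xs g
  ∑-cong-∈ []       f≡g = refl
  ∑-cong-∈ (x ∷ xs) f≡g = cong₂ _+_ (f≡g (here refl)) (∑-cong-∈ xs (f≡g ∘ there))

  ∑-cong : ∀ (xs : List A) {f g : A → ℕ} → (∀ x → f x ≡ g x) → ∑ xs f ≡ ∑ xs g
  ∑-cong xs f≡g = ∑-cong-∈ xs λ {x} _ → f≡g x

  ∑-++ : ∀ (xs ys : List A) (f : A → ℕ) → ∑ (xs ++ ys) f ≡ ∑ xs f + ∑ ys f
  ∑-++ []       ys f = refl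
  ∑-++ (x ∷ xs) ys f = trans (cong (f x +_) (∑-++ xs ys f)) (sym (ℕ.+-assoc (f x) _ _))

  ∑-const : ∀ (xs : List A) c → ∑ xs (λ _ → c) ≡ length xs * c
  ∑-const []       c = refl
  ∑-const (x ∷ xs) c = cong (c +_) (∑-const xs c)

  ∑-+ : ∀ (xs : List A) (f g : A → ℕ) → ∑ xs (λ x → f x + g x) ≡ ∑ xs f + ∑ xs g
  ∑-+ []       f g = refl
  ∑-+ (x ∷ xs) f g = trans (cong (f x + g x +_) (∑-+ xs f g)) (interchange (f x) (g x) (∑ xs f) (∑ xs g))
    where
    interchange : ∀ a b c d → a + b + (c + d) ≡ a + c + (b + d)
    interchange = solve-∀

  ∑-*ˡ : ∀ c (xs : List A) (f : A → ℕ) → c * ∑ xs f ≡ ∑ xs (λ x → c * f x)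
  ∑-*ˡ c []       f = ℕ.*-zeroʳ c
  ∑-*ˡ c (x ∷ xs) f = trans (ℕ.*-distribˡ-+ c (f x) _) (cong (c * f x +_) (∑-*ˡ c xs f))

  ∑-↭ : ∀ {xs ys : List A} (f : A → ℕ) → xs ↭ ys → ∑ xs f ≡ ∑ ys f
  ∑-↭ f Perm.refl        = refl
  ∑-↭ f (Perm.prep x p)  = cong (f x +_) (∑-↭ f p)
  ∑-↭ f (Perm.swap {xs} {ys} x y p) = trans (cong (λ s → f x + (f y + s)) (∑-↭ f p)) (left-comm (f x) (f y) (∑ ys f))
    where
    left-comm : ∀ a b c → a + (b + c) ≡ b + (a + c)
    left-comm = solve-∀
  ∑-↭ f (Perm.trans p q) = trans (∑-↭ f p) (∑-↭ f q)

  ∑-∈ : ∀ {xs : List A} {x} (f : A → ℕ) → x ∈ˡ xs → f x ≤ ∑ xs f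
  ∑-∈ f (here refl)           = ℕ.m≤m+n _ _
  ∑-∈ {y ∷ xs} f (there x∈xs) = ℕ.≤-trans (∑-∈ f x∈xs) (ℕ.m≤n+m _ (f y))

  length-filter : ∀ {P : A → Set} (P? : ∀ x → Dec (P x)) xs → length (filter P? xs) ≡ ∑ xs (λ x → 𝟙 (P? x))
  length-filter P? []       = refl
  length-filter P? (x ∷ xs) with P? x
  ... | yes _ = cong suc (length-filter P? xs)
  ... | no  _ = length-filter P? xs

  ∑-𝟙≤1 : ∀ {P : A → Set} (P? : ∀ x → Dec (P x)) {xs} → Unique xs →
          (∀ {x y} → P x → P y → x ≡ y) → ∑ xs (λ x → 𝟙 (P? x)) ≤ 1
  ∑-𝟙≤1 P? []           P! = z≤n
  ∑-𝟙≤1 P? {x ∷ xs} (x∉xs ∷ xs!) P! with P? x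
  ... | no  _  = ∑-𝟙≤1 P? xs! P!
  ... | yes px = s≤s (ℕ.≤-reflexive (trans
                   (∑-cong-∈ xs λ {y} y∈xs → 𝟙-no (P? y) λ py → All.lookup x∉xs y∈xs (P! px py))
                   (trans (∑-const xs 0) (ℕ.*-zeroʳ (length xs)))))

module _ {A B : Set} where

  ∑-map : ∀ (g : A → B) xs (f : B → ℕ) → ∑ (map g xs) f ≡ ∑ xs (f ∘ g)
  ∑-map g []       f = refl
  ∑-map g (x ∷ xs) f = cong (f (g x) +_) (∑-map g xs f)

  ∑-concatMap : ∀ (g : A → List B) xs (f : B → ℕ) → ∑ (concatMap g xs) f ≡ ∑ xs (λ x → ∑ (g x) f)
  ∑-concatMap g []       f = refl
  ∑-concatMap g (x ∷ xs) f = trans (∑-++ (g x) (concatMap g xs) f) (cong (∑ (g x) f +_) (∑-concatMap g xs f))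

  ∑-comm : ∀ (xs : List A) (ys : List B) (F : A → B → ℕ) →
           ∑ xs (λ x → ∑ ys (λ y → F x y)) ≡ ∑ ys (λ y → ∑ xs (λ x → F x y))
  ∑-comm []       ys F = sym (trans (∑-const ys 0) (ℕ.*-zeroʳ (length ys)))
  ∑-comm (x ∷ xs) ys F = trans (cong (∑ ys (F x) +_) (∑-comm xs ys F)) (sym (∑-+ ys (F x) _))

length-allFin : ∀ n → length (allFin n) ≡ n
length-allFin n = List.length-tabulate id

∑-const-Fin : ∀ n c → ∑ (allFin n) (λ _ → c) ≡ n * c
∑-const-Fin n c = trans (∑-const (allFin n) c) (cong (_* c) (length-allFin n))

∑-suc : ∀ n (f : Fin (suc n) → ℕ) → ∑ (allFin (suc n)) f ≡ f zero + ∑ (allFin n) (f ∘ suc)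
∑-suc n f = cong (f zero +_) (trans (cong (λ xs → ∑ xs f) (sym (List.map-tabulate id suc)))
                                    (∑-map suc (allFin n) f))

∑-+-Fin : ∀ a b (f : Fin (a + b) → ℕ) →
          ∑ (allFin (a + b)) f ≡ ∑ (allFin a) (λ i → f (i ↑ˡ b)) + ∑ (allFin b) (λ j → f (a ↑ʳ j))
∑-+-Fin zero    b f = refl
∑-+-Fin (suc a) b f = begin
  ∑ (allFin (suc a + b)) f                                                  ≡⟨ ∑-suc (a + b) f ⟩
  f zero + ∑ (allFin (a + b)) (f ∘ suc)                                     ≡⟨ cong (f zero +_) (∑-+-Fin a b (f ∘ suc)) ⟩
  f zero + (∑ (allFin a) (λ i → f (suc (i ↑ˡ b))) + ∑ (allFin b) (λ j → f (suc (a ↑ʳ j))))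
                                                                            ≡⟨ ℕ.+-assoc (f zero) _ _ ⟨
  f zero + ∑ (allFin a) (λ i → f (suc (i ↑ˡ b))) + ∑ (allFin b) (λ j → f (suc (a ↑ʳ j)))
                                                                            ≡⟨ cong (_+ ∑ (allFin b) (λ j → f (suc (a ↑ʳ j)))) (∑-suc a (λ i → f (i ↑ˡ b))) ⟨
  ∑ (allFin (suc a)) (λ i → f (i ↑ˡ b)) + ∑ (allFin b) (λ j → f (suc a ↑ʳ j)) ∎
  where open ≡-Reasoning

∑-combine : ∀ a b (f : Fin (a * b) → ℕ) →
            ∑ (allFin (a * b)) f ≡ ∑ (allFin a) (λ i → ∑ (allFin b) (λ j → f (combine i j)))
∑-combine zero    b f = refl
∑-combine (suc a) b f = begin
  ∑ (allFin (b + a * b)) f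
    ≡⟨ ∑-+-Fin b (a * b) f ⟩
  ∑ (allFin b) (λ j → f (j ↑ˡ (a * b))) + ∑ (allFin (a * b)) (λ k → f (b ↑ʳ k))
    ≡⟨ cong (∑ (allFin b) (λ j → f (j ↑ˡ (a * b))) +_) (∑-combine a b (λ k → f (b ↑ʳ k))) ⟩
  ∑ (allFin b) (λ j → f (combine {suc a} zero j)) + ∑ (allFin a) (λ i → ∑ (allFin b) (λ j → f (combine (suc i) j)))
    ≡⟨ ∑-suc a (λ i → ∑ (allFin b) (λ j → f (combine i j))) ⟨
  ∑ (allFin (suc a)) (λ i → ∑ (allFin b) (λ j → f (combine i j))) ∎
  where open ≡-Reasoning

-- The cyclic group on `Fin n`.

infixl 6 _⊕_

_⊕_ : ∀ {n} → Fin n → Fin n → Fin n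
_⊕_ {suc n} i j = (toℕ i + toℕ j) mod suc n

⊕-comm : ∀ {n} (i j : Fin n) → i ⊕ j ≡ j ⊕ i
⊕-comm {suc n} i j = cong (_mod suc n) (ℕ.+-comm (toℕ i) (toℕ j))

⊖_ : ∀ {n} → Fin n → Fin n
⊖_ {suc n} j = (suc n ∸ toℕ j) mod suc n

toℕ-mod : ∀ a n → toℕ (a mod suc n) ≡ a % suc n
toℕ-mod a n = Fin.toℕ-fromℕ< (m%n<n a (suc n))

-- Residues of two numbers that sum to the modulus are inverse to each other. Leaving `a` and `b`
-- unreduced lets one computation serve both orders of `⊕` and `⊖`, including `j = 0`, where `⊖ j`
-- reduces the modulus itself.
mod-add : ∀ {n} (i : Fin (suc n)) a b → a + b ≡ suc n →
          (toℕ ((toℕ i + toℕ (a mod suc n)) mod suc n) + toℕ (b mod suc n)) mod suc n ≡ i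
mod-add {n} i a b a+b≡n = Fin.toℕ-injective (begin
  toℕ ((toℕ ((toℕ i + toℕ (a mod suc n)) mod suc n) + toℕ (b mod suc n)) mod suc n)
    ≡⟨ toℕ-mod (toℕ ((toℕ i + toℕ (a mod suc n)) mod suc n) + toℕ (b mod suc n)) n ⟩
  (toℕ ((toℕ i + toℕ (a mod suc n)) mod suc n) + toℕ (b mod suc n)) % suc n
    ≡⟨ cong (_% suc n) (cong₂ _+_ (toℕ-mod (toℕ i + toℕ (a mod suc n)) n) (toℕ-mod b n)) ⟩
  ((toℕ i + toℕ (a mod suc n)) % suc n + b % suc n) % suc n
    ≡⟨ %-distribˡ-+ (toℕ i + toℕ (a mod suc n)) b (suc n) ⟨
  (toℕ i + toℕ (a mod suc n) + b) % suc n
    ≡⟨ cong (λ z → (toℕ i + z + b) % suc n) (toℕ-mod a n) ⟩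
  (toℕ i + a % suc n + b) % suc n
    ≡⟨ cong (_% suc n) (ℕ.+-assoc (toℕ i) (a % suc n) b) ⟩
  (toℕ i + (a % suc n + b)) % suc n
    ≡⟨ %-distribˡ-+ (toℕ i) (a % suc n + b) (suc n) ⟩
  (toℕ i % suc n + (a % suc n + b) % suc n) % suc n
    ≡⟨ cong (λ z → (toℕ i % suc n + z) % suc n) (%-distribˡ-+ (a % suc n) b (suc n)) ⟩
  (toℕ i % suc n + (a % suc n % suc n + b % suc n) % suc n) % suc n
    ≡⟨ cong (λ z → (toℕ i % suc n + (z + b % suc n) % suc n) % suc n) (m%n%n≡m%n a (suc n)) ⟩
  (toℕ i % suc n + (a % suc n + b % suc n) % suc n) % suc n
    ≡⟨ cong (λ z → (toℕ i % suc n + z) % suc n) (%-distribˡ-+ a b (suc n)) ⟨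
  (toℕ i % suc n + (a + b) % suc n) % suc n
    ≡⟨ %-distribˡ-+ (toℕ i) (a + b) (suc n) ⟨
  (toℕ i + (a + b)) % suc n
    ≡⟨ cong (λ z → (toℕ i + z) % suc n) a+b≡n ⟩
  (toℕ i + suc n) % suc n
    ≡⟨ [m+n]%n≡m%n (toℕ i) (suc n) ⟩
  toℕ i % suc n
    ≡⟨ m<n⇒m%n≡m (Fin.toℕ<n i) ⟩
  toℕ i ∎)
  where open ≡-Reasoning

mod-toℕ : ∀ {n} (j : Fin (suc n)) → toℕ j mod suc n ≡ j
mod-toℕ {n} j = Fin.toℕ-injective (trans (toℕ-mod (toℕ j) n) (m<n⇒m%n≡m (Fin.toℕ<n j)))

⊕-⊖ : ∀ {n} (i j : Fin n) → i ⊕ j ⊕ ⊖ j ≡ i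
⊕-⊖ {suc n} i j = trans (cong (λ z → i ⊕ z ⊕ ⊖ j) (sym (mod-toℕ j)))
  (mod-add i (toℕ j) (suc n ∸ toℕ j) (ℕ.m+[n∸m]≡n (ℕ.<⇒≤ (Fin.toℕ<n j))))

⊖-⊕ : ∀ {n} (i j : Fin n) → i ⊕ ⊖ j ⊕ j ≡ i
⊖-⊕ {suc n} i j = trans (cong (λ z → i ⊕ ⊖ j ⊕ z) (sym (mod-toℕ j)))
  (mod-add i (suc n ∸ toℕ j) (toℕ j) (ℕ.m∸n+n≡m (ℕ.<⇒≤ (Fin.toℕ<n j))))

⊕-cancelʳ : ∀ {n} {i i′ : Fin n} j → i ⊕ j ≡ i′ ⊕ j → i ≡ i′
⊕-cancelʳ {_} {i} {i′} j eq = trans (sym (⊕-⊖ i j)) (trans (cong (_⊕ ⊖ j) eq) (⊕-⊖ i′ j))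

⊕-cancelˡ : ∀ {n} {i i′ : Fin n} j → j ⊕ i ≡ j ⊕ i′ → i ≡ i′
⊕-cancelˡ {_} {i} {i′} j eq = ⊕-cancelʳ j (trans (⊕-comm i j) (trans eq (⊕-comm j i′)))

∑-⊕ʳ : ∀ {n} (j : Fin n) (f : Fin n → ℕ) → ∑ (allFin n) (λ i → f (i ⊕ j)) ≡ ∑ (allFin n) f
∑-⊕ʳ {n} j f = trans (sym (∑-map (_⊕ j) (allFin n) f)) (∑-↭ f (∼bag⇒↭ (unique∧set⇒bag
  (Unique.map⁺ (⊕-cancelʳ j) (Unique.allFin⁺ n)) (Unique.allFin⁺ n)
  (λ {i} → mk⇔ (λ _ → ∈-allFin i) λ _ → subst (_∈ˡ map (_⊕ j) (allFin n)) (⊖-⊕ i j) (∈-map⁺ (_⊕ j) (∈-allFin (i ⊕ ⊖ j)))))))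

∑-⊕ˡ : ∀ {n} (j : Fin n) (f : Fin n → ℕ) → ∑ (allFin n) (λ i → f (j ⊕ i)) ≡ ∑ (allFin n) f
∑-⊕ˡ {n} j f = trans (∑-cong (allFin n) λ i → cong f (⊕-comm j i)) (∑-⊕ʳ j f)

-- Averages over all tables from letters to colours.

decode : ∀ {m} q → Fin (m ^ q) → Vec (Fin m) q
decode         zero    o = []
decode {m} (suc q) o = proj₁ (remQuot {m} (m ^ q) o) ∷ decode q (proj₂ (remQuot {m} (m ^ q) o))

∑-decode : ∀ {m} q (Φ : Vec (Fin m) (suc q) → ℕ) →
           ∑ (allFin (m ^ suc q)) (Φ ∘ decode (suc q)) ≡
           ∑ (allFin m) (λ x → ∑ (allFin (m ^ q)) (λ o → Φ (x ∷ decode q o)))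
∑-decode {m} q Φ = trans (∑-combine m (m ^ q) (Φ ∘ decode (suc q)))
  (∑-cong (allFin m) λ x → ∑-cong (allFin (m ^ q)) λ o →
    cong (λ (x , o) → Φ (x ∷ decode q o)) (Fin.remQuot-combine {m} x o))

-- Redrawing one entry of a uniform table leaves it uniform. This is how independence enters:
-- entries at distinct letters can be redrawn one at a time.
∑-resample : ∀ {m} q (z : Fin q) (Φ : Vec (Fin m) q → ℕ) →
             m * ∑ (allFin (m ^ q)) (Φ ∘ decode q) ≡
             ∑ (allFin (m ^ q)) (λ o → ∑ (allFin m) (λ c → Φ (decode q o [ z ]≔ c)))
∑-resample {m} (suc q) zero Φ = sym (begin
  ∑ (allFin (m ^ suc q)) (λ o → ∑ (allFin m) (λ c → Φ (decode (suc q) o [ zero ]≔ c)))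
    ≡⟨ ∑-decode q (λ h → ∑ (allFin m) (λ c → Φ (h [ zero ]≔ c))) ⟩
  ∑ (allFin m) (λ x → ∑ (allFin (m ^ q)) (λ o → ∑ (allFin m) (λ c → Φ (c ∷ decode q o))))
    ≡⟨ ∑-const-Fin m _ ⟩
  m * ∑ (allFin (m ^ q)) (λ o → ∑ (allFin m) (λ c → Φ (c ∷ decode q o)))
    ≡⟨ cong (m *_) (∑-comm (allFin (m ^ q)) (allFin m) (λ o c → Φ (c ∷ decode q o))) ⟩
  m * ∑ (allFin m) (λ c → ∑ (allFin (m ^ q)) (λ o → Φ (c ∷ decode q o)))
    ≡⟨ cong (m *_) (∑-decode q Φ) ⟨
  m * ∑ (allFin (m ^ suc q)) (Φ ∘ decode (suc q)) ∎)
  where open ≡-Reasoning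
∑-resample {m} (suc q) (suc z) Φ = begin
  m * ∑ (allFin (m ^ suc q)) (Φ ∘ decode (suc q))
    ≡⟨ cong (m *_) (∑-decode q Φ) ⟩
  m * ∑ (allFin m) (λ x → ∑ (allFin (m ^ q)) (λ o → Φ (x ∷ decode q o)))
    ≡⟨ ∑-*ˡ m (allFin m) _ ⟩
  ∑ (allFin m) (λ x → m * ∑ (allFin (m ^ q)) (λ o → Φ (x ∷ decode q o)))
    ≡⟨ ∑-cong (allFin m) (λ x → ∑-resample q z (λ h → Φ (x ∷ h))) ⟩
  ∑ (allFin m) (λ x → ∑ (allFin (m ^ q)) (λ o → ∑ (allFin m) (λ c → Φ (x ∷ (decode q o [ z ]≔ c)))))
    ≡⟨ ∑-decode q (λ h → ∑ (allFin m) (λ c → Φ (h [ suc z ]≔ c))) ⟨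
  ∑ (allFin (m ^ suc q)) (λ o → ∑ (allFin m) (λ c → Φ (decode (suc q) o [ suc z ]≔ c))) ∎
  where open ≡-Reasoning

-- Codes whose words agree rarely, even after shifts.

module _ {q : ℕ} where

  agreement : ∀ {L} → Fin q → Fin q → Vec (Fin q) L → Vec (Fin q) L → ℕ
  agreement ρ ρ′ []      []      = 0
  agreement ρ ρ′ (x ∷ u) (y ∷ v) = 𝟙 (x ⊕ ρ Fin.≟ y ⊕ ρ′) + agreement ρ ρ′ u v

  agreement-sym : ∀ {L} ρ ρ′ (u v : Vec (Fin q) L) → agreement ρ ρ′ u v ≡ agreement ρ′ ρ v u
  agreement-sym ρ ρ′ []      []      = refl
  agreement-sym ρ ρ′ (x ∷ u) (y ∷ v) =
    cong₂ _+_ (𝟙-cong (x ⊕ ρ Fin.≟ y ⊕ ρ′) (y ⊕ ρ′ Fin.≟ x ⊕ ρ) sym sym) (agreement-sym ρ ρ′ u v)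

  agreement-∑ : ∀ {L} ρ ρ′ (u v : Vec (Fin q) L) →
                agreement ρ ρ′ u v ≡ ∑ (allFin L) (λ α → 𝟙 (lookup u α ⊕ ρ Fin.≟ lookup v α ⊕ ρ′))
  agreement-∑ ρ ρ′ []      []      = refl
  agreement-∑ {suc L} ρ ρ′ (x ∷ u) (y ∷ v) =
    trans (cong (𝟙 (x ⊕ ρ Fin.≟ y ⊕ ρ′) +_) (agreement-∑ ρ ρ′ u v))
          (sym (∑-suc L (λ α → 𝟙 (lookup (x ∷ u) α ⊕ ρ Fin.≟ lookup (y ∷ v) α ⊕ ρ′))))

  ball : ∀ L → ℕ → Fin q → Fin q → Vec (Fin q) L → ℕ
  ball L s ρ ρ′ v = ∑ (allFin (q ^ L)) λ o → 𝟙 (s ≤? agreement ρ ρ′ (decode L o) v)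

  𝟙-split : ∀ {P : Set} (p : Dec P) s a → 𝟙 (suc s ≤? 𝟙 p + a) ≤ 𝟙 p * 𝟙 (s ≤? a) + 𝟙 (suc s ≤? a)
  𝟙-split (yes _) s a = ℕ.≤-trans (𝟙-mono (suc s ≤? suc a) (s ≤? a) ℕ.s≤s⁻¹)
    (ℕ.≤-trans (ℕ.≤-reflexive (sym (ℕ.*-identityˡ _))) (ℕ.m≤m+n _ _))
  𝟙-split (no _)  s a = ℕ.≤-refl

  ball-suc : ∀ L s ρ ρ′ y v → ball (suc L) (suc s) ρ ρ′ (y ∷ v) ≤ ball L s ρ ρ′ v + q * ball L (suc s) ρ ρ′ v
  ball-suc L s ρ ρ′ y v = begin
    ball (suc L) (suc s) ρ ρ′ (y ∷ v)
      ≡⟨ ∑-decode L (λ u → 𝟙 (suc s ≤? agreement ρ ρ′ u (y ∷ v))) ⟩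
    ∑ (allFin q) (λ x → ∑ (allFin (q ^ L)) λ o → 𝟙 (suc s ≤? hit x + agree o))
      ≤⟨ ∑-mono (allFin q) (λ x → ∑-mono (allFin (q ^ L)) λ o → 𝟙-split (x ⊕ ρ Fin.≟ y ⊕ ρ′) s (agree o)) ⟩
    ∑ (allFin q) (λ x → ∑ (allFin (q ^ L)) λ o → hit x * 𝟙 (s ≤? agree o) + 𝟙 (suc s ≤? agree o))
      ≡⟨ ∑-cong (allFin q) (λ x → trans (∑-+ (allFin (q ^ L)) (λ o → hit x * 𝟙 (s ≤? agree o)) _)
           (cong (_+ B′) (trans (sym (∑-*ˡ (hit x) (allFin (q ^ L)) _)) (ℕ.*-comm (hit x) B)))) ⟩
    ∑ (allFin q) (λ x → B * hit x + B′)
      ≡⟨ trans (∑-+ (allFin q) (λ x → B * hit x) (λ _ → B′)) (cong₂ _+_ (sym (∑-*ˡ B (allFin q) hit)) (∑-const-Fin q B′)) ⟩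
    B * ∑ (allFin q) hit + q * B′
      ≤⟨ ℕ.+-monoˡ-≤ (q * B′) (ℕ.≤-trans (ℕ.*-monoʳ-≤ B (∑-𝟙≤1 (λ x → x ⊕ ρ Fin.≟ y ⊕ ρ′) (Unique.allFin⁺ q)
           λ p p′ → ⊕-cancelʳ ρ (trans p (sym p′)))) (ℕ.≤-reflexive (ℕ.*-identityʳ B))) ⟩
    B + q * B′ ∎
    where
    open ℕ.≤-Reasoning
    hit : Fin q → ℕ
    hit x = 𝟙 (x ⊕ ρ Fin.≟ y ⊕ ρ′)
    agree : Fin (q ^ L) → ℕ
    agree o = agreement ρ ρ′ (decode L o) v
    B B′ : ℕ
    B  = ball L s ρ ρ′ v
    B′ = ball L (suc s) ρ ρ′ v

  -- A union bound over the at most 2 ^ L sets of agreeing positions: prescribing s agreements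
  -- leaves q ^ (L - s) words. In the induction the two terms of `ball-suc`, for a first letter that
  -- agrees and for one that may not, give the factor 2.
  ball-bound : ∀ L s ρ ρ′ v → ball L s ρ ρ′ v * q ^ s ≤ 2 ^ L * q ^ L
  ball-bound L zero ρ ρ′ v = begin
    ball L 0 ρ ρ′ v * 1
      ≡⟨ ℕ.*-identityʳ _ ⟩
    ball L 0 ρ ρ′ v
      ≡⟨ ∑-cong (allFin (q ^ L)) (λ o → 𝟙-yes (0 ≤? agreement ρ ρ′ (decode L o) v) z≤n) ⟩
    ∑ (allFin (q ^ L)) (λ _ → 1)
      ≡⟨ trans (∑-const-Fin (q ^ L) 1) (ℕ.*-identityʳ _) ⟩
    q ^ L
      ≤⟨ ℕ.m≤n*m (q ^ L) (2 ^ L) {{ℕ.m^n≢0 2 L}} ⟩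
    2 ^ L * q ^ L ∎
    where open ℕ.≤-Reasoning
  ball-bound zero (suc s) ρ ρ′ [] = z≤n
  ball-bound (suc L) (suc s) ρ ρ′ (y ∷ v) = begin
    ball (suc L) (suc s) ρ ρ′ (y ∷ v) * q ^ suc s
      ≤⟨ ℕ.*-monoˡ-≤ (q ^ suc s) (ball-suc L s ρ ρ′ y v) ⟩
    (B + q * B′) * (q * q ^ s)
      ≡⟨ regroup B B′ q (q ^ s) ⟩
    q * (B * q ^ s) + q * (B′ * (q * q ^ s))
      ≤⟨ ℕ.+-mono-≤ (ℕ.*-monoʳ-≤ q (ball-bound L s ρ ρ′ v)) (ℕ.*-monoʳ-≤ q (ball-bound L (suc s) ρ ρ′ v)) ⟩
    q * (2 ^ L * q ^ L) + q * (2 ^ L * q ^ L)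
      ≡⟨ double q (2 ^ L) (q ^ L) ⟩
    2 ^ suc L * q ^ suc L ∎
    where
    open ℕ.≤-Reasoning
    B B′ : ℕ
    B  = ball L s ρ ρ′ v
    B′ = ball L (suc s) ρ ρ′ v
    regroup : ∀ b b′ q t → (b + q * b′) * (q * t) ≡ q * (b * t) + q * (b′ * (q * t))
    regroup = solve-∀
    double : ∀ q a b → q * (a * b) + q * (a * b) ≡ 2 * a * (q * b)
    double = solve-∀

  -- All pairs of shifts are quantified over because every vertex adds a shift of its own to its
  -- codeword. They cost the factor q * q in `far-word`.
  Far : ∀ {L} → ℕ → Vec (Fin q) L → Vec (Fin q) L → Set
  Far s u v = ∀ ρ ρ′ → agreement ρ ρ′ u v < s

  far? : ∀ {L} s (u v : Vec (Fin q) L) → Dec (Far s u v)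
  far? s u v = Fin.all? λ ρ → Fin.all? λ ρ′ → agreement ρ ρ′ u v ℕ.<? s

  far-sym : ∀ {L s} (u v : Vec (Fin q) L) → Far s u v → Far s v u
  far-sym u v far ρ ρ′ = subst (_< _) (agreement-sym ρ′ ρ u v) (far ρ′ ρ)

  -- Gilbert–Varshamov: the balls around fewer than q ^ L / |ball| words do not cover.
  far-word : ∀ {L s K} {{_ : NonZero q}} (𝒞 : Fin K → Vec (Fin q) L) → K * (q * (q * 2 ^ L)) < q ^ s →
             ∃ λ w → ∀ i → Far s w (𝒞 i)
  far-word {L} {s} {K} 𝒞 small with Fin.any? (λ o → Fin.all? λ i → far? s (decode L o) (𝒞 i))
  ... | yes (o , far) = decode L o , far
  ... | no  ¬far      = contradiction small (ℕ.≤⇒≯ (ℕ.*-cancelʳ-≤ _ _ (q ^ L) {{ℕ.m^n≢0 q L}} (begin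
    q ^ s * q ^ L
      ≡⟨ cong (q ^ s *_) (trans (sym (ℕ.*-identityʳ _)) (sym (∑-const-Fin (q ^ L) 1))) ⟩
    q ^ s * ∑ (allFin (q ^ L)) (λ _ → 1)
      ≤⟨ ℕ.*-monoʳ-≤ (q ^ s) (∑-mono (allFin (q ^ L)) covered) ⟩
    q ^ s * ∑ (allFin (q ^ L)) (λ o → ∑ (allFin K) λ i → ∑ (allFin q) λ ρ → ∑ (allFin q) λ ρ′ → close o i ρ ρ′)
      ≡⟨ cong (q ^ s *_) (trans (∑-comm (allFin (q ^ L)) (allFin K) _) (∑-cong (allFin K) λ i →
           trans (∑-comm (allFin (q ^ L)) (allFin q) _) (∑-cong (allFin q) λ ρ → ∑-comm (allFin (q ^ L)) (allFin q) _))) ⟩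
    q ^ s * ∑ (allFin K) (λ i → ∑ (allFin q) λ ρ → ∑ (allFin q) λ ρ′ → ball L s ρ ρ′ (𝒞 i))
      ≡⟨ trans (∑-*ˡ (q ^ s) (allFin K) _) (∑-cong (allFin K) λ i →
           trans (∑-*ˡ (q ^ s) (allFin q) _) (∑-cong (allFin q) λ ρ → ∑-*ˡ (q ^ s) (allFin q) _)) ⟩
    ∑ (allFin K) (λ i → ∑ (allFin q) λ ρ → ∑ (allFin q) λ ρ′ → q ^ s * ball L s ρ ρ′ (𝒞 i))
      ≤⟨ ∑-mono (allFin K) (λ i → ∑-mono (allFin q) λ ρ → ∑-mono (allFin q) λ ρ′ →
           ℕ.≤-trans (ℕ.≤-reflexive (ℕ.*-comm (q ^ s) _)) (ball-bound L s ρ ρ′ (𝒞 i))) ⟩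
    ∑ (allFin K) (λ i → ∑ (allFin q) λ ρ → ∑ (allFin q) λ ρ′ → 2 ^ L * q ^ L)
      ≡⟨ trans (∑-const-Fin K _) (cong (K *_) (trans (∑-const-Fin q _) (cong (q *_) (∑-const-Fin q _)))) ⟩
    K * (q * (q * (2 ^ L * q ^ L)))
      ≡⟨ assoc K q (2 ^ L) (q ^ L) ⟩
    K * (q * (q * 2 ^ L)) * q ^ L ∎)))
    where
    open ℕ.≤-Reasoning
    close : Fin (q ^ L) → Fin K → Fin q → Fin q → ℕ
    close o i ρ ρ′ = 𝟙 (s ≤? agreement ρ ρ′ (decode L o) (𝒞 i))
    assoc : ∀ a b c d → a * (b * (b * (c * d))) ≡ a * (b * (b * c)) * d
    assoc = solve-∀
    covered : ∀ o → 1 ≤ ∑ (allFin K) λ i → ∑ (allFin q) λ ρ → ∑ (allFin q) λ ρ′ → close o i ρ ρ′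
    covered o with Fin.any? (λ i → Fin.any? λ ρ → Fin.any? λ ρ′ → s ≤? agreement ρ ρ′ (decode L o) (𝒞 i))
    ... | yes (i , ρ , ρ′ , s≤) =
      ℕ.≤-trans (ℕ.≤-reflexive (sym (𝟙-yes (s ≤? agreement ρ ρ′ (decode L o) (𝒞 i)) s≤)))
        (ℕ.≤-trans (∑-∈ (λ ρ′ → close o i ρ ρ′) (∈-allFin ρ′))
          (ℕ.≤-trans (∑-∈ (λ ρ → ∑ (allFin q) λ ρ′ → close o i ρ ρ′) (∈-allFin ρ))
            (∑-∈ (λ i → ∑ (allFin q) λ ρ → ∑ (allFin q) λ ρ′ → close o i ρ ρ′) (∈-allFin i))))
    ... | no  ¬close = contradiction (o , λ i ρ ρ′ → ℕ.≰⇒> λ s≤ → ¬close (i , ρ , ρ′ , s≤)) ¬far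

  code : ∀ L s K {{_ : NonZero q}} → K * (q * (q * 2 ^ L)) < q ^ s →
         ∃ λ (𝒞 : Fin K → Vec (Fin q) L) → ∀ i j → i ≢ j → Far s (𝒞 i) (𝒞 j)
  code L s zero    small = (λ ()) , λ ()
  code L s (suc K) small = 𝒞′ , far′
    where
    small′ : K * (q * (q * 2 ^ L)) < q ^ s
    small′ = ℕ.≤-<-trans (ℕ.m≤n+m _ (q * (q * 2 ^ L))) small
    𝒞 : Fin K → Vec (Fin q) L
    𝒞 = proj₁ (code L s K small′)
    w : Vec (Fin q) L
    w = proj₁ (far-word 𝒞 small′)
    𝒞′ : Fin (suc K) → Vec (Fin q) L
    𝒞′ zero    = w
    𝒞′ (suc i) = 𝒞 i
    far′ : ∀ i j → i ≢ j → Far s (𝒞′ i) (𝒞′ j)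
    far′ zero    zero    i≢j = contradiction refl i≢j
    far′ zero    (suc j) i≢j = proj₂ (far-word 𝒞 small′) j
    far′ (suc i) zero    i≢j = far-sym w (𝒞 i) (proj₂ (far-word 𝒞 small′) i)
    far′ (suc i) (suc j) i≢j = proj₂ (code L s K small′) i j (i≢j ∘ cong suc)

^-distribʳ-* : ∀ a b n → (a * b) ^ n ≡ a ^ n * b ^ n
^-distribʳ-* a b zero    = refl
^-distribʳ-* a b (suc n) = trans (cong (a * b *_) (^-distribʳ-* a b n)) (interchange a b (a ^ n) (b ^ n))
  where
  interchange : ∀ a b c d → a * b * (c * d) ≡ a * c * (b * d)
  interchange = solve-∀

n<2^n : ∀ n → n < 2 ^ n
n<2^n zero    = s≤s z≤n
n<2^n (suc n) = ℕ.≤-trans (ℕ.+-mono-≤ (ℕ.m^n>0 2 n) (n<2^n n)) (ℕ.≤-reflexive (cong (2 ^ n +_) (sym (ℕ.+-identityʳ _))))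

2n≤2^n : ∀ n .{{_ : NonZero n}} → 2 * n ≤ 2 ^ n
2n≤2^n (suc n) = ℕ.*-monoʳ-≤ 2 (n<2^n n)

-- Words of length u * s over 4 ^ u letters: since (4 ^ u) ^ s = 2 ^ L * 2 ^ L, the bound
-- of far-word leaves room for 2 ^ L / (4 ^ u) ^ 2 words, which beats any c * L.
code-room : ∀ u c .{{_ : NonZero u}} → let q = 4 ^ u; s = 2 * suc (c * (q * q)) in
            c * (u * s) * (q * (q * 2 ^ (u * s))) < q ^ s
code-room u c = begin-strict
  c * (u * s) * (q * (q * 2 ^ L))     ≡⟨ regroup c L q (2 ^ L) ⟩
  d * L * 2 ^ L                       <⟨ ℕ.*-monoˡ-< (2 ^ L) {{ℕ.m^n≢0 2 L}} dL<2^L ⟩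
  2 ^ L * 2 ^ L                       ≡⟨ ^-distribʳ-* 2 2 L ⟨
  4 ^ (u * s)                         ≡⟨ ℕ.^-*-assoc 4 u s ⟨
  q ^ s                               ∎
  where
  open ℕ.≤-Reasoning
  q s L d j : ℕ
  q = 4 ^ u
  s = 2 * suc (c * (q * q))
  L = u * s
  d = c * (q * q)
  j = u * suc d
  instance
    j≢0 : NonZero j
    j≢0 = ℕ.m*n≢0 u (suc d)
  regroup : ∀ c l q t → c * l * (q * (q * t)) ≡ c * (q * q) * l * t
  regroup = solve-∀
  L≡2j : L ≡ 2 * j
  L≡2j = swap₂ u (suc d)
    where
    swap₂ : ∀ a b → a * (2 * b) ≡ 2 * (a * b)
    swap₂ = solve-∀
  -- The factor 2 in `s` makes L = 2 * j, so that 2 ^ L splits into two factors 2 ^ j; the `suc` in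
  -- `s` makes j exceed d. One factor then absorbs d and the other 2 * j.
  dL<2^L : d * L < 2 ^ L
  dL<2^L = begin-strict
    d * L          ≡⟨ cong (d *_) L≡2j ⟩
    d * (2 * j)    <⟨ ℕ.*-monoˡ-< (2 * j) {{ℕ.m*n≢0 2 j}} (ℕ.<-≤-trans (ℕ.n<1+n d) (ℕ.m≤n*m (suc d) u)) ⟩
    j * (2 * j)    ≤⟨ ℕ.*-mono-≤ (ℕ.<⇒≤ (n<2^n j)) (2n≤2^n j) ⟩
    2 ^ j * 2 ^ j  ≡⟨ ℕ.^-distribˡ-+-* 2 j j ⟨
    2 ^ (j + j)    ≡⟨ cong (2 ^_) (trans (cong (j +_) (sym (ℕ.+-identityʳ j))) (sym L≡2j)) ⟩
    2 ^ L          ∎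

-- Tuples, and what the colouring has to provide.

choices : ∀ {A : Set} → List (List A) → List (List A)
choices []         = [] ∷ []
choices (xs ∷ xss) = concatMap (λ x → map (x ∷_) (choices xss)) xs

∑-choices-∷ : ∀ {A : Set} (xs : List A) xss (F : List A → ℕ) →
              ∑ (choices (xs ∷ xss)) F ≡ ∑ xs (λ x → ∑ (choices xss) (λ ys → F (x ∷ ys)))
∑-choices-∷ xs xss F = trans (∑-concatMap _ xs F) (∑-cong xs λ x → ∑-map (x ∷_) (choices xss) F)

tuples : ∀ n → ℕ → List (List (Fin n))
tuples n j = choices (replicate j (allFin n))

-- y and x range over the keys and vertices.  The vertices form N consecutive
-- blocks of O; the last field bounds the failure of independence by k² / u.
record Colouring (N m u : ℕ) : Set where
  field
    M O  : ℕ
    M≢0  : NonZero M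
    O≢0  : NonZero O
    key  : Fin (N * O) → Fin M
    col  : Fin M → Fin (N * O) → Fin m
    key-uniform : ∀ b (F : Fin M → ℕ) →
      M * ∑ (allFin O) (λ o → F (key (combine {N} {O} b o))) ≡ O * ∑ (allFin M) F
    col-uniform : ∀ y b (F : Fin m → ℕ) →
      m * ∑ (allFin O) (λ o → F (col y (combine {N} {O} b o))) ≡ O * ∑ (allFin m) F
    col-independent : ∀ xs → Unique xs → (F : List (Fin m) → ℕ) → let k = length xs in
      (u ∸ k * k) * (M * ∑ (tuples m k) F) ≤
      u * (m ^ k * ∑ (allFin M) (λ y → F (map (col y) xs)))

-- The explicit colouring.

evals : ∀ {m q} → Vec (Fin m) q → List (Fin q × Fin m) → List (Fin m)
evals h = map λ (z , ρ) → lookup h z ⊕ ρ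

evals-≔ : ∀ {m q} (h : Vec (Fin m) q) z c zs → All (z ≢_) (map proj₁ zs) → evals (h [ z ]≔ c) zs ≡ evals h zs
evals-≔ h z c []              []         = refl
evals-≔ h z c ((z′ , ρ) ∷ zs) (z≢ ∷ z∉) =
  cong₂ _∷_ (cong (_⊕ ρ) (Vec.lookup∘updateAt′ z′ z (z≢ ∘ sym) h)) (evals-≔ h z c zs z∉)

-- Each pair consists of the letter and the colour shift of a vertex. Distinct letters read distinct
-- entries of the table, so the entry read by the head can be redrawn without affecting the rest,
-- and the shift only permutes the colours.
evals-uniform : ∀ {m} q zs → Unique (map proj₁ zs) → (F : List (Fin m) → ℕ) →
                m ^ length zs * ∑ (allFin (m ^ q)) (λ o → F (evals (decode q o) zs)) ≡
                m ^ q * ∑ (tuples m (length zs)) F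
evals-uniform {m} q [] _ F = begin
  1 * ∑ (allFin (m ^ q)) (λ _ → F [])  ≡⟨ ℕ.*-identityˡ _ ⟩
  ∑ (allFin (m ^ q)) (λ _ → F [])      ≡⟨ ∑-const-Fin (m ^ q) (F []) ⟩
  m ^ q * F []                         ≡⟨ cong (m ^ q *_) (ℕ.+-identityʳ (F [])) ⟨
  m ^ q * (F [] + 0)                   ∎
  where open ≡-Reasoning
evals-uniform {m} q ((z , ρ) ∷ zs) (z∉ ∷ zs!) F = begin
  m ^ suc k * ∑ hs (λ o → F (lookup (decode q o) z ⊕ ρ ∷ evals (decode q o) zs))
    ≡⟨ swap₂ m (m ^ k) _ ⟩
  m ^ k * (m * ∑ hs (λ o → F (lookup (decode q o) z ⊕ ρ ∷ evals (decode q o) zs)))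
    ≡⟨ cong (m ^ k *_) (∑-resample q z (λ h → F (lookup h z ⊕ ρ ∷ evals h zs))) ⟩
  m ^ k * ∑ hs (λ o → ∑ (allFin m) λ c →
    F (lookup (decode q o [ z ]≔ c) z ⊕ ρ ∷ evals (decode q o [ z ]≔ c) zs))
    ≡⟨ cong (m ^ k *_) (∑-cong hs λ o → ∑-cong (allFin m) λ c → cong₂ (λ c cs → F (c ⊕ ρ ∷ cs))
         (Vec.lookup∘update z (decode q o) c) (evals-≔ (decode q o) z c zs z∉)) ⟩
  m ^ k * ∑ hs (λ o → ∑ (allFin m) λ c → F (c ⊕ ρ ∷ evals (decode q o) zs))
    ≡⟨ cong (m ^ k *_) (∑-cong hs λ o → ∑-⊕ʳ ρ (λ c → F (c ∷ evals (decode q o) zs))) ⟩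
  m ^ k * ∑ hs (λ o → ∑ (allFin m) λ c → F (c ∷ evals (decode q o) zs))
    ≡⟨ cong (m ^ k *_) (∑-comm hs (allFin m) _) ⟩
  m ^ k * ∑ (allFin m) (λ c → ∑ hs λ o → F (c ∷ evals (decode q o) zs))
    ≡⟨ ∑-*ˡ (m ^ k) (allFin m) _ ⟩
  ∑ (allFin m) (λ c → m ^ k * ∑ hs (λ o → F (c ∷ evals (decode q o) zs)))
    ≡⟨ ∑-cong (allFin m) (λ c → evals-uniform q zs zs! (λ cs → F (c ∷ cs))) ⟩
  ∑ (allFin m) (λ c → m ^ q * ∑ (tuples m k) (λ cs → F (c ∷ cs)))
    ≡⟨ ∑-*ˡ (m ^ q) (allFin m) _ ⟨
  m ^ q * ∑ (allFin m) (λ c → ∑ (tuples m k) (λ cs → F (c ∷ cs)))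
    ≡⟨ cong (m ^ q *_) (∑-choices-∷ (allFin m) (replicate k (allFin m)) F) ⟨
  m ^ q * ∑ (tuples m (suc k)) F ∎
  where
  open ≡-Reasoning
  k : ℕ
  k = length zs
  hs : List (Fin (m ^ q))
  hs = allFin (m ^ q)
  swap₂ : ∀ a b c → a * b * c ≡ b * (a * c)
  swap₂ = solve-∀

-- A vertex is a tuple (b , y , ρ₁ , ρ₂) and has the codeword of (b , y , ρ₁) shifted by ρ₂.
-- The key y = (α , h) colours it by h (its letter at position α) ⊕ ρ₁.  Two codewords agree
-- at few α, so for most α the letters are distinct and a random h makes the colours
-- independent; inside a block the shifts ρ₁ and ρ₂ make every single key balanced.
module Construction (N m u q s L : ℕ) (L≡u*s : L ≡ u * s)
                    (𝒞 : Fin N → Fin (L * m ^ q * m) → Vec (Fin q) L)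
                    (𝒞-far : ∀ b w b′ w′ → ¬ (b ≡ b′ × w ≡ w′) → Far s (𝒞 b w) (𝒞 b′ w′)) where

  M O : ℕ
  M = L * m ^ q
  O = M * m * q

  letter′ : Fin L → Fin N → Fin O → Fin q
  letter′ α b o = lookup (𝒞 b (quotient {M * m} q o)) α ⊕ remainder {M * m} q o

  shift′ : Fin O → Fin m
  shift′ o = remainder {M} m (quotient {M * m} q o)

  key′ : Fin O → Fin M
  key′ o = quotient {M} m (quotient {M * m} q o)

  letter : Fin L → Fin (N * O) → Fin q
  letter α x = letter′ α (quotient {N} O x) (remainder {N} O x)

  shift : Fin (N * O) → Fin m
  shift x = shift′ (remainder {N} O x)

  key : Fin (N * O) → Fin M
  key x = key′ (remainder {N} O x)

  position : Fin M → Fin L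
  position y = quotient {L} (m ^ q) y

  table : Fin M → Vec (Fin m) q
  table y = decode q (remainder {L} (m ^ q) y)

  col : Fin M → Fin (N * O) → Fin m
  col y x = lookup (table y) (letter (position y) x) ⊕ shift x

  ∑-offset : ∀ b (F : Fin N → Fin (M * m) → Fin q → ℕ) →
             ∑ (allFin O) (λ o → let x = combine b o; o′ = remainder {N} O x in
                                 F (quotient {N} O x) (quotient {M * m} q o′) (remainder {M * m} q o′)) ≡
             ∑ (allFin (M * m)) (λ w → ∑ (allFin q) (F b w))
  ∑-offset b F = trans
    (∑-cong (allFin O) λ o → cong (λ (b , o) → F b (quotient {M * m} q o) (remainder {M * m} q o)) (Fin.remQuot-combine b o))
    (trans (∑-combine (M * m) q _)
      (∑-cong (allFin (M * m)) λ w → ∑-cong (allFin q) λ ρ → cong (λ (w , ρ) → F b w ρ) (Fin.remQuot-combine w ρ)))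

  key-uniform : ∀ b (F : Fin M → ℕ) →
                M * ∑ (allFin O) (λ o → F (key (combine b o))) ≡ O * ∑ (allFin M) F
  key-uniform b F = begin
    M * ∑ (allFin O) (λ o → F (key (combine b o)))
      ≡⟨ cong (M *_) (∑-offset b (λ _ w _ → F (quotient {M} m w))) ⟩
    M * ∑ (allFin (M * m)) (λ w → ∑ (allFin q) λ _ → F (quotient {M} m w))
      ≡⟨ cong (M *_) (∑-cong (allFin (M * m)) λ w → ∑-const-Fin q _) ⟩
    M * ∑ (allFin (M * m)) (λ w → q * F (quotient {M} m w))
      ≡⟨ cong (M *_) (∑-*ˡ q (allFin (M * m)) _) ⟨
    M * (q * ∑ (allFin (M * m)) (λ w → F (quotient {M} m w)))
      ≡⟨ cong (λ t → M * (q * t)) (trans (∑-combine M m _) (∑-cong (allFin M) λ y →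
           trans (∑-cong (allFin m) λ ρ → cong (F ∘ proj₁) (Fin.remQuot-combine y ρ)) (∑-const-Fin m (F y)))) ⟩
    M * (q * ∑ (allFin M) (λ y → m * F y))
      ≡⟨ cong (λ t → M * (q * t)) (∑-*ˡ m (allFin M) F) ⟨
    M * (q * (m * ∑ (allFin M) F))
      ≡⟨ regroup M q m (∑ (allFin M) F) ⟩
    O * ∑ (allFin M) F ∎
    where
    open ≡-Reasoning
    regroup : ∀ a b c d → a * (b * (c * d)) ≡ a * c * b * d
    regroup = solve-∀

  -- The codeword itself depends on ρ₁, so averaging over ρ₁ alone would not suffice. Averaging over
  -- ρ₂ first makes the letter uniform whatever the codeword is; then ρ₁ makes the colour uniform
  -- however unbalanced the table of `y` is.
  col-uniform : ∀ y b (F : Fin m → ℕ) →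
                m * ∑ (allFin O) (λ o → F (col y (combine b o))) ≡ O * ∑ (allFin m) F
  col-uniform y b F = begin
    m * ∑ (allFin O) (λ o → F (col y (combine b o)))
      ≡⟨ cong (m *_) (∑-offset b (λ b w ρ → F (lookup h (lookup (𝒞 b w) α ⊕ ρ) ⊕ remainder {M} m w))) ⟩
    m * ∑ (allFin (M * m)) (λ w → ∑ (allFin q) λ ρ → F (lookup h (lookup (𝒞 b w) α ⊕ ρ) ⊕ remainder {M} m w))
      ≡⟨ cong (m *_) (∑-cong (allFin (M * m)) λ w → ∑-⊕ˡ (lookup (𝒞 b w) α) (λ z → F (lookup h z ⊕ remainder {M} m w))) ⟩
    m * ∑ (allFin (M * m)) (λ w → ∑ (allFin q) λ z → F (lookup h z ⊕ remainder {M} m w))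
      ≡⟨ cong (m *_) (trans (∑-combine M m _) (∑-cong (allFin M) λ y → ∑-cong (allFin m) λ ρ →
           cong (λ (_ , ρ) → ∑ (allFin q) λ z → F (lookup h z ⊕ ρ)) (Fin.remQuot-combine y ρ))) ⟩
    m * ∑ (allFin M) (λ _ → ∑ (allFin m) λ ρ → ∑ (allFin q) λ z → F (lookup h z ⊕ ρ))
      ≡⟨ cong (m *_) (∑-const-Fin M _) ⟩
    m * (M * ∑ (allFin m) (λ ρ → ∑ (allFin q) λ z → F (lookup h z ⊕ ρ)))
      ≡⟨ cong (λ t → m * (M * t)) (trans (∑-comm (allFin m) (allFin q) _)
           (trans (∑-cong (allFin q) λ z → ∑-⊕ˡ (lookup h z) F) (∑-const-Fin q _))) ⟩
    m * (M * (q * ∑ (allFin m) F))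
      ≡⟨ regroup m M q (∑ (allFin m) F) ⟩
    O * ∑ (allFin m) F ∎
    where
    open ≡-Reasoning
    h : Vec (Fin m) q
    h = table y
    α : Fin L
    α = position y
    regroup : ∀ a b c d → a * (b * (c * d)) ≡ b * a * c * d
    regroup = solve-∀

  collision : Fin (N * O) → Fin (N * O) → Fin L → ℕ
  collision x x′ α = 𝟙 (letter α x Fin.≟ letter α x′)

  -- Vertices with different (b , w) have codewords that are far under all shifts. Vertices with the
  -- same (b , w) differ only in ρ₂, so their letters differ at every position.
  collisions≤s : ∀ {x x′} → x ≢ x′ → ∑ (allFin L) (collision x x′) ≤ s
  collisions≤s {x} {x′} x≢x′ with quotient {N} O x Fin.≟ quotient {N} O x′
    ×-dec quotient {M * m} q (remainder {N} O x) Fin.≟ quotient {M * m} q (remainder {N} O x′)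
  ... | no  ne = ℕ.≤-trans (ℕ.≤-reflexive (sym (agreement-∑ (remainder {M * m} q (remainder {N} O x))
                  (remainder {M * m} q (remainder {N} O x′)) 
                  (𝒞 (quotient {N} O x) (quotient {M * m} q (remainder {N} O x)))
                  (𝒞 (quotient {N} O x′) (quotient {M * m} q (remainder {N} O x′))))))
                  (ℕ.<⇒≤ (𝒞-far _ _ _ _ ne (remainder {M * m} q (remainder {N} O x)) (remainder {M * m} q (remainder {N} O x′))))
  ... | yes split = ℕ.≤-trans (ℕ.≤-reflexive (trans
                      (∑-cong (allFin L) λ α → 𝟙-no (letter α x Fin.≟ letter α x′) λ eq → x≢x′ (same eq))
                      (trans (∑-const-Fin L 0) (ℕ.*-zeroʳ L)))) z≤n
    where
    rq : Fin (N * O) → Fin N × Fin O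
    rq = remQuot {N} O
    same : ∀ {α} → letter α x ≡ letter α x′ → x ≡ x′
    same {α} eq = begin
      x                                        ≡⟨ Fin.combine-remQuot {N} O x ⟨
      combine (proj₁ (rq x)) (proj₂ (rq x))    ≡⟨ cong₂ combine (proj₁ split) (begin
        proj₂ (rq x)                             ≡⟨ Fin.combine-remQuot {M * m} q (proj₂ (rq x)) ⟨
        combine (quotient {M * m} q (proj₂ (rq x))) (remainder {M * m} q (proj₂ (rq x)))
                                                 ≡⟨ cong₂ combine (proj₂ split) (⊕-cancelˡ _ (trans
                                                      (cong₂ (λ b w → lookup (𝒞 b w) α ⊕ remainder {M * m} q (proj₂ (rq x)))
                                                             (sym (proj₁ split)) (sym (proj₂ split))) eq)) ⟩
        combine (quotient {M * m} q (proj₂ (rq x′))) (remainder {M * m} q (proj₂ (rq x′)))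
                                                 ≡⟨ Fin.combine-remQuot {M * m} q (proj₂ (rq x′)) ⟩
        proj₂ (rq x′)                            ∎) ⟩
      combine (proj₁ (rq x′)) (proj₂ (rq x′))  ≡⟨ Fin.combine-remQuot {N} O x′ ⟩
      x′                                       ∎
      where open ≡-Reasoning

  distinct? : ∀ xs α → Dec (Unique (map (letter α) xs))
  distinct? xs α = DecUnique.unique? Fin._≟_ (map (letter α) xs)

  distinct-∷ : ∀ x xs α → 𝟙 (distinct? xs α) ≤ 𝟙 (distinct? (x ∷ xs) α) + ∑ xs (λ x′ → collision x x′ α)
  distinct-∷ x xs α with distinct? xs α | distinct? (x ∷ xs) α
  ... | no  _  | _      = z≤n
  ... | yes _  | yes _  = s≤s z≤n
  ... | yes d! | no ¬d! with All.all? (λ x′ → ¬? (letter α x Fin.≟ letter α x′)) xs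
  ...   | yes x∉ = contradiction (All.map⁺ x∉ ∷ d!) ¬d!
  ...   | no  x∈ with find (All.¬All⇒Any¬ (λ x′ → ¬? (letter α x Fin.≟ letter α x′)) xs x∈)
  ...     | x′ , x′∈ , ¬≢ = ℕ.≤-trans
    (ℕ.≤-reflexive (sym (𝟙-yes (letter α x Fin.≟ letter α x′) (decidable-stable (letter α x Fin.≟ letter α x′) ¬≢))))
    (∑-∈ (λ x′ → collision x x′ α) x′∈)

  -- A union bound over pairs: a further vertex spoils at most k * s positions. Bounding the number
  -- of pairs by k * k keeps the induction simple, since k * k + k ≤ (k + 1) * (k + 1).
  distinct-many : ∀ xs → Unique xs → L ≤ ∑ (allFin L) (λ α → 𝟙 (distinct? xs α)) + length xs * length xs * s
  distinct-many []       _           = ℕ.≤-trans (ℕ.≤-reflexive (sym (trans (∑-const-Fin L 1) (ℕ.*-identityʳ L)))) (ℕ.m≤m+n _ 0)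
  distinct-many (x ∷ xs) (x∉ ∷ xs!) = begin
    L
      ≤⟨ distinct-many xs xs! ⟩
    ∑ (allFin L) (λ α → 𝟙 (distinct? xs α)) + k * k * s
      ≤⟨ ℕ.+-monoˡ-≤ (k * k * s) (∑-mono (allFin L) (distinct-∷ x xs)) ⟩
    ∑ (allFin L) (λ α → 𝟙 (distinct? (x ∷ xs) α) + ∑ xs (λ x′ → collision x x′ α)) + k * k * s
      ≡⟨ cong (_+ k * k * s) (∑-+ (allFin L) _ _) ⟩
    G + ∑ (allFin L) (λ α → ∑ xs (λ x′ → collision x x′ α)) + k * k * s
      ≡⟨ cong (λ t → G + t + k * k * s) (∑-comm (allFin L) xs _) ⟩
    G + ∑ xs (λ x′ → ∑ (allFin L) (collision x x′)) + k * k * s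
      ≤⟨ ℕ.+-monoˡ-≤ (k * k * s) (ℕ.+-monoʳ-≤ G (ℕ.≤-trans
           (∑-mono-∈ xs λ x′∈ → collisions≤s (All.lookup x∉ x′∈)) (ℕ.≤-reflexive (∑-const xs s)))) ⟩
    G + k * s + k * k * s
      ≤⟨ ℕ.m≤m+n _ ((1 + k) * s) ⟩
    G + k * s + k * k * s + (1 + k) * s
      ≡⟨ square G k s ⟩
    G + suc k * suc k * s ∎
    where
    open ℕ.≤-Reasoning
    k G : ℕ
    k = length xs
    G = ∑ (allFin L) (λ α → 𝟙 (distinct? (x ∷ xs) α))
    square : ∀ g k s → g + k * s + k * k * s + (1 + k) * s ≡ g + (1 + k) * (1 + k) * s
    square = solve-∀

  -- At the positions where the letters of `xs` are distinct, `evals-uniform` is exact. The other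
  -- positions, at most k * k * s of the u * s, are dropped; as `F` is nonnegative this only weakens
  -- the bound.
  col-independent : ∀ xs → Unique xs → (F : List (Fin m) → ℕ) → let k = length xs in
    (u ∸ k * k) * (M * ∑ (tuples m k) F) ≤ u * (m ^ k * ∑ (allFin M) (λ y → F (map (col y) xs)))
  col-independent xs xs! F = begin
    (u ∸ k * k) * (M * W)
      ≡⟨ cong (λ l → (u ∸ k * k) * (l * m ^ q * W)) L≡u*s ⟩
    (u ∸ k * k) * (u * s * m ^ q * W)
      ≡⟨ regroup (u ∸ k * k) u s (m ^ q) W ⟩
    u * ((u ∸ k * k) * s * (m ^ q * W))
      ≤⟨ ℕ.*-monoʳ-≤ u (ℕ.*-monoˡ-≤ (m ^ q * W) good) ⟩
    u * (∑ (allFin L) (λ α → 𝟙 (distinct? xs α)) * (m ^ q * W))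
      ≡⟨ cong (u *_) (trans (ℕ.*-comm _ (m ^ q * W)) (∑-*ˡ (m ^ q * W) (allFin L) _)) ⟩
    u * ∑ (allFin L) (λ α → m ^ q * W * 𝟙 (distinct? xs α))
      ≤⟨ ℕ.*-monoʳ-≤ u (∑-mono (allFin L) each) ⟩
    u * ∑ (allFin L) (λ α → m ^ k * ∑ (allFin (m ^ q)) (λ o → F (colours α (decode q o))))
      ≡⟨ cong (u *_) (∑-*ˡ (m ^ k) (allFin L) _) ⟨
    u * (m ^ k * ∑ (allFin L) (λ α → ∑ (allFin (m ^ q)) (λ o → F (colours α (decode q o)))))
      ≡⟨ cong (λ t → u * (m ^ k * t)) (trans (∑-combine L (m ^ q) _) (∑-cong (allFin L) λ α →
           ∑-cong (allFin (m ^ q)) λ o → cong (λ (α , o) → F (colours α (decode q o))) (Fin.remQuot-combine α o))) ⟨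
    u * (m ^ k * ∑ (allFin M) (λ y → F (map (col y) xs))) ∎
    where
    open ℕ.≤-Reasoning
    k W : ℕ
    k = length xs
    W = ∑ (tuples m k) F
    colours : Fin L → Vec (Fin m) q → List (Fin m)
    colours α h = map (λ x → lookup h (letter α x) ⊕ shift x) xs
    regroup : ∀ v u s h w → v * (u * s * h * w) ≡ u * (v * s * (h * w))
    regroup = solve-∀
    good : (u ∸ k * k) * s ≤ ∑ (allFin L) (λ α → 𝟙 (distinct? xs α))
    good = ℕ.≤-trans (ℕ.≤-reflexive (trans (ℕ.*-distribʳ-∸ s u (k * k)) (cong (_∸ k * k * s) (sym L≡u*s))))
      (ℕ.≤-trans (ℕ.∸-monoˡ-≤ (k * k * s) (distinct-many xs xs!)) (ℕ.≤-reflexive (ℕ.m+n∸n≡m _ (k * k * s))))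
    each : ∀ α → m ^ q * W * 𝟙 (distinct? xs α) ≤ m ^ k * ∑ (allFin (m ^ q)) (λ o → F (colours α (decode q o)))
    each α with distinct? xs α
    ... | no  _  = ℕ.≤-trans (ℕ.≤-reflexive (ℕ.*-zeroʳ (m ^ q * W))) z≤n
    ... | yes d! = ℕ.≤-reflexive (sym (begin-equality
      m ^ k * ∑ (allFin (m ^ q)) (λ o → F (colours α (decode q o)))
        ≡⟨ cong₂ (λ j G → m ^ j * G) (List.length-map _ xs) (∑-cong (allFin (m ^ q)) λ o → cong F (sym (List.map-∘ xs))) ⟨
      m ^ length zs * ∑ (allFin (m ^ q)) (λ o → F (evals (decode q o) zs))
        ≡⟨ evals-uniform q zs (subst Unique (List.map-∘ xs) d!) F ⟩
      m ^ q * ∑ (tuples m (length zs)) F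
        ≡⟨ cong (λ j → m ^ q * ∑ (tuples m j) F) (List.length-map _ xs) ⟩
      m ^ q * W
        ≡⟨ ℕ.*-identityʳ _ ⟨
      m ^ q * W * 1 ∎))
      where
      zs : List (Fin q × Fin m)
      zs = map (λ x → letter α x , shift x) xs


colouring : ∀ N m u .{{_ : NonZero m}} .{{_ : NonZero u}} → Colouring N m u
colouring N m u = record
  { M = M ; O = O ; M≢0 = M≢0 ; O≢0 = O≢0 ; key = key ; col = col
  ; key-uniform = key-uniform ; col-uniform = col-uniform ; col-independent = col-independent }
  where
  q s L : ℕ
  q = 4 ^ u
  -- One codeword is needed for every (b , y , ρ₁), and the number of keys y grows with L. Since `q`
  -- depends on `u` only, this number is c * L with c = N * m ^ q * m fixed before L, as `code-room`
  -- requires.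
  s = 2 * suc (N * m ^ q * m * (q * q))
  L = u * s
  instance
    q≢0 : NonZero q
    q≢0 = ℕ.m^n≢0 4 u
  regroup : ∀ n h m l → n * h * m * l ≡ n * (l * h * m)
  regroup = solve-∀
  words : ∃ λ (𝒞 : Fin (N * (L * m ^ q * m)) → Vec (Fin q) L) → ∀ i j → i ≢ j → Far s (𝒞 i) (𝒞 j)
  words = code L s (N * (L * m ^ q * m))
    (subst (λ K → K * (q * (q * 2 ^ L)) < q ^ s) (regroup N (m ^ q) m L) (code-room u (N * m ^ q * m)))
  open Construction N m u q s L refl (λ b w → proj₁ words (combine b w))
    (λ b w b′ w′ ne → proj₂ words _ _ (ne ∘ Fin.combine-injective b w b′ w′))
  M≢0 : NonZero M
  M≢0 = ℕ.m*n≢0 L (m ^ q) {{ℕ.m*n≢0 u s}} {{ℕ.m^n≢0 m q}}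
  O≢0 : NonZero O
  O≢0 = ℕ.m*n≢0 (M * m) q {{ℕ.m*n≢0 M m {{M≢0}}}}

-- Insertion into sorted lists of vertices, and sums over choices.

Increasing : ∀ {n} → List (Fin n) → Set
Increasing = AllPairs Fin._<_

module _ {n : ℕ} where

  insert : Fin n → List (Fin n) → List (Fin n)
  insert x []       = x ∷ []
  insert x (z ∷ zs) with x Fin.<? z
  ... | yes _ = x ∷ z ∷ zs
  ... | no  _ = z ∷ insert x zs

  -- The head of the tuple is inserted first, so that the induction in `tuples-expect` can turn it
  -- into a slot before the rest of the tuple is treated.
  insertAll : List (Fin n) → List (Fin n) → List (Fin n)
  insertAll []       zs = zs
  insertAll (x ∷ xs) zs = insertAll xs (insert x zs)

  insert-< : ∀ {x z} zs → x Fin.< z → insert x (z ∷ zs) ≡ x ∷ z ∷ zs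
  insert-< {x} {z} zs x<z with x Fin.<? z
  ... | yes _   = refl
  ... | no  x≮z = contradiction x<z x≮z

  insert-≮ : ∀ {x z} zs → ¬ x Fin.< z → insert x (z ∷ zs) ≡ z ∷ insert x zs
  insert-≮ {x} {z} zs x≮z with x Fin.<? z
  ... | yes x<z = contradiction x<z x≮z
  ... | no  _   = refl

  insert-↭ : ∀ x zs → insert x zs ↭ x ∷ zs
  insert-↭ x []       = Perm.refl
  insert-↭ x (z ∷ zs) with x Fin.<? z
  ... | yes _ = Perm.refl
  ... | no  _ = Perm.trans (Perm.prep z (insert-↭ x zs)) (Perm.swap z x Perm.refl)

  insertAll-↭ : ∀ xs zs → insertAll xs zs ↭ xs ++ zs
  insertAll-↭ []       zs = Perm.refl
  insertAll-↭ (x ∷ xs) zs = Perm.trans (insertAll-↭ xs (insert x zs))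
    (Perm.trans (Perm.++⁺ˡ xs (insert-↭ x zs)) (Perm.shift x xs zs))

  insert-increasing : ∀ {x zs} → All (x ≢_) zs → Increasing zs → Increasing (insert x zs)
  insert-increasing {x} {[]}     _         _           = [] ∷ []
  insert-increasing {x} {z ∷ zs} (x≢z ∷ x∉) (z< ∷ zs↗) with x Fin.<? z
  ... | yes x<z = (x<z ∷ All.map (Fin.<-trans x<z) z<) ∷ z< ∷ zs↗
  ... | no  x≮z = All.tabulate (λ y∈ → All.lookup {P = z Fin.<_} (z<x ∷ z<) (Perm.∈-resp-↭ (insert-↭ x zs) y∈))
                  ∷ insert-increasing x∉ zs↗
    where
    z<x : z Fin.< x
    z<x = ℕ.≤∧≢⇒< (ℕ.≮⇒≥ x≮z) (x≢z ∘ Fin.toℕ-injective ∘ sym)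

∈-choices⁻ : ∀ {A : Set} (xs : List A) xss {zs} → zs ∈ˡ choices (xs ∷ xss) →
             ∃ λ x → ∃ λ ys → x ∈ˡ xs × ys ∈ˡ choices xss × zs ≡ x ∷ ys
∈-choices⁻ xs xss zs∈ with find (∈-concatMap⁻ (λ x → map (x ∷_) (choices xss)) {xs = xs} zs∈)
... | x , x∈ , zs∈′ with ∈-map⁻ (x ∷_) zs∈′
...   | ys , ys∈ , eq = x , ys , x∈ , ys∈ , eq

∈-choices⁺ : ∀ {A : Set} {xs : List A} {xss x ys} → x ∈ˡ xs → ys ∈ˡ choices xss → x ∷ ys ∈ˡ choices (xs ∷ xss)
∈-choices⁺ {xss = xss} {x} x∈ ys∈ = ∈-concatMap⁺ (λ x → map (x ∷_) (choices xss)) (lose x∈ (∈-map⁺ (x ∷_) ys∈))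

∑-choices-++ : ∀ {A : Set} (xss yss : List (List A)) (F : List A → ℕ) →
               ∑ (choices (xss ++ yss)) F ≡ ∑ (choices xss) (λ xs → ∑ (choices yss) (λ ys → F (xs ++ ys)))
∑-choices-++ []         yss F = sym (ℕ.+-identityʳ _)
∑-choices-++ (xs ∷ xss) yss F = begin
  ∑ (choices (xs ∷ xss ++ yss)) F
    ≡⟨ ∑-choices-∷ xs (xss ++ yss) F ⟩
  ∑ xs (λ x → ∑ (choices (xss ++ yss)) (λ zs → F (x ∷ zs)))
    ≡⟨ ∑-cong xs (λ x → ∑-choices-++ xss yss (λ zs → F (x ∷ zs))) ⟩
  ∑ xs (λ x → ∑ (choices xss) (λ xs → ∑ (choices yss) (λ ys → F (x ∷ xs ++ ys))))
    ≡⟨ ∑-choices-∷ xs xss _ ⟨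
  ∑ (choices (xs ∷ xss)) (λ xs → ∑ (choices yss) (λ ys → F (xs ++ ys))) ∎
  where open ≡-Reasoning

replicate-+ : ∀ {A : Set} {x : A} j {k} → replicate (j + k) x ≡ replicate j x ++ replicate k x
replicate-+ zero    = refl
replicate-+ (suc j) = cong (_ ∷_) (replicate-+ j)

∑-tuples-+ : ∀ n j k (F : List (Fin n) → ℕ) →
             ∑ (tuples n (j + k)) F ≡ ∑ (tuples n j) (λ xs → ∑ (tuples n k) (λ ys → F (xs ++ ys)))
∑-tuples-+ n j k F = trans (cong (λ xss → ∑ (choices xss) F) (replicate-+ j))
                           (∑-choices-++ (replicate j (allFin n)) (replicate k (allFin n)) F)

-- Averaging over vertices known only up to their block.

module _ {N m u : ℕ} {{_ : NonZero m}} (χ : Colouring N m u) where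
  open Colouring χ

  private
    V : Set
    V = Fin (N * O)

  block : V → Fin N
  block = quotient {N} O

  -- A vertex of which either everything or only the block is known.
  data Slot : Set where
    fix  : V → Slot
    free : Fin N → Slot

  slotBlock : Slot → Fin N
  slotBlock (fix x)  = block x
  slotBlock (free b) = b

  options : Slot → List V
  options (fix x)  = x ∷ []
  options (free b) = map (combine b) (allFin O)

  fixed : List Slot → List V
  fixed []           = []
  fixed (fix x  ∷ σ) = x ∷ fixed σ
  fixed (free _ ∷ σ) = fixed σ

  #free : List Slot → ℕ
  #free []           = 0
  #free (fix _  ∷ σ) = #free σ
  #free (free _ ∷ σ) = suc (#free σ)

  length-slots : ∀ σ → length σ ≡ length (fixed σ) + #free σ
  length-slots []           = refl
  length-slots (fix _  ∷ σ) = cong suc (length-slots σ)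
  length-slots (free _ ∷ σ) = trans (cong suc (length-slots σ)) (sym (ℕ.+-suc _ _))

  completions : List Slot → List (List V)
  completions σ = choices (map options σ)

  -- An unnormalised expectation: the mean would be this divided by `O ^ #free σ`.
  expect : List Slot → (List V → ℕ) → ℕ
  expect σ = ∑ (completions σ)

  expect-∷ : ∀ t σ F → expect (t ∷ σ) F ≡ ∑ (options t) (λ x → expect σ (λ zs → F (x ∷ zs)))
  expect-∷ t σ F = ∑-choices-∷ (options t) (map options σ) F

  expect-fix : ∀ x σ F → expect (fix x ∷ σ) F ≡ expect σ (λ zs → F (x ∷ zs))
  expect-fix x σ F = trans (expect-∷ (fix x) σ F) (ℕ.+-identityʳ _)

  expect-free : ∀ b σ F → expect (free b ∷ σ) F ≡ ∑ (allFin O) (λ o → expect σ (λ zs → F (combine b o ∷ zs)))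
  expect-free b σ F = trans (expect-∷ (free b) σ F) (∑-map (combine b) (allFin O) _)

  block-combine : ∀ b o → block (combine b o) ≡ b
  block-combine b o = cong proj₁ (Fin.remQuot-combine b o)

  options-block : ∀ t {x} → x ∈ˡ options t → block x ≡ slotBlock t
  options-block (fix x)  (here refl) = refl
  options-block (free b) x∈ with ∈-map⁻ (combine b) x∈
  ... | o , _ , refl = block-combine b o

  block-< : ∀ {x y} → block x Fin.< block y → x Fin.< y
  block-< {x} {y} b<b′ = subst₂′ (Fin.combine-remQuot {N} O x) (Fin.combine-remQuot {N} O y)
    (Fin.combine-monoˡ-< (remainder {N} O x) (remainder {N} O y) b<b′)
    where
    subst₂′ : ∀ {x x′ y y′ : V} → x ≡ x′ → y ≡ y′ → x Fin.< y → x′ Fin.< y′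
    subst₂′ refl refl x<y = x<y

  combine-< : ∀ {b c o x} → block x ≡ c → b Fin.< c → combine b o Fin.< x
  combine-< {b} {o = o} {x} refl b<c = block-< (subst (Fin._< block x) (sym (block-combine b o)) b<c)

  combine-≮ : ∀ {b c o x} → block x ≡ c → c ≢ b → ¬ b Fin.< c → ¬ combine b o Fin.< x
  combine-≮ {b} {o = o} {x} refl c≢b b≮c v<x = ℕ.<-asym v<x
    (block-< (subst (block x Fin.<_) (sym (block-combine b o)) (ℕ.≤∧≢⇒< (ℕ.≮⇒≥ b≮c) (c≢b ∘ Fin.toℕ-injective))))

  insertSlot : Fin N → List Slot → List Slot
  insertSlot b []      = free b ∷ []
  insertSlot b (t ∷ σ) with b Fin.<? slotBlock t
  ... | yes _ = free b ∷ t ∷ σ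
  ... | no  _ = t ∷ insertSlot b σ

  fixed-insertSlot : ∀ b σ → fixed (insertSlot b σ) ≡ fixed σ
  fixed-insertSlot b []      = refl
  fixed-insertSlot b (t ∷ σ) with b Fin.<? slotBlock t
  fixed-insertSlot b (t ∷ σ)      | yes _ = refl
  fixed-insertSlot b (fix x ∷ σ)  | no  _ = cong (x ∷_) (fixed-insertSlot b σ)
  fixed-insertSlot b (free _ ∷ σ) | no  _ = fixed-insertSlot b σ

  #free-insertSlot : ∀ b σ → #free (insertSlot b σ) ≡ suc (#free σ)
  #free-insertSlot b []      = refl
  #free-insertSlot b (t ∷ σ) with b Fin.<? slotBlock t
  #free-insertSlot b (t ∷ σ)      | yes _ = refl
  #free-insertSlot b (fix x ∷ σ)  | no  _ = #free-insertSlot b σ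
  #free-insertSlot b (free _ ∷ σ) | no  _ = cong suc (#free-insertSlot b σ)

  Avoids : Fin N → List Slot → Set
  Avoids b = All λ t → slotBlock t ≢ b

  -- Since no slot of `σ` lies in block `b`, comparing blocks already decides where `combine b o` is
  -- inserted. The place depends neither on `o` nor on the completion, so sorting commutes with the
  -- choice of offsets.
  expect-insertSlot : ∀ b σ F → Avoids b σ →
    expect (insertSlot b σ) F ≡ ∑ (allFin O) (λ o → expect σ (λ zs → F (insert (combine b o) zs)))
  expect-insertSlot b []      F []           = expect-free b [] F
  expect-insertSlot b (t ∷ σ) F (t≢b ∷ σ∌b) with b Fin.<? slotBlock t
  ... | yes b<t = trans (expect-free b (t ∷ σ) F) (∑-cong (allFin O) λ o → trans (expect-∷ t σ _)
    (trans (∑-cong-∈ (options t) λ x∈ → ∑-cong (completions σ) λ zs →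
             cong F (sym (insert-< zs (combine-< (options-block t x∈) b<t))))
           (sym (expect-∷ t σ _))))
  ... | no  b≮t = trans (expect-∷ t (insertSlot b σ) F)
    (trans (∑-cong (options t) λ x → expect-insertSlot b σ (λ zs → F (x ∷ zs)) σ∌b)
    (trans (∑-comm (options t) (allFin O) _) (∑-cong (allFin O) λ o →
    (trans (∑-cong-∈ (options t) λ x∈ → ∑-cong (completions σ) λ zs →
             cong F (sym (insert-≮ zs (combine-≮ (options-block t x∈) t≢b b≮t))))
           (sym (expect-∷ t σ _))))))

  ∈-insertSlot : ∀ b σ {zs} → Avoids b σ → zs ∈ˡ completions (insertSlot b σ) →
    ∃ λ o → ∃ λ ys → ys ∈ˡ completions σ × zs ≡ insert (combine b o) ys
  ∈-insertSlot b [] [] zs∈ with ∈-choices⁻ (options (free b)) [] zs∈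
  ... | x , ys , x∈ , here refl , refl with ∈-map⁻ (combine b) x∈
  ...   | o , _ , refl = o , [] , here refl , refl
  ∈-insertSlot b (t ∷ σ) (t≢b ∷ σ∌b) zs∈ with b Fin.<? slotBlock t
  ∈-insertSlot b (t ∷ σ) (t≢b ∷ σ∌b) zs∈ | yes b<t with ∈-choices⁻ (options (free b)) (map options (t ∷ σ)) zs∈
  ... | v , ys , v∈ , ys∈ , refl with ∈-map⁻ (combine b) v∈ | ∈-choices⁻ (options t) (map options σ) ys∈
  ...   | o , _ , refl | x , ws , x∈ , ws∈ , refl =
    o , x ∷ ws , ys∈ , sym (insert-< ws (combine-< (options-block t x∈) b<t))
  ∈-insertSlot b (t ∷ σ) (t≢b ∷ σ∌b) zs∈ | no b≮t with ∈-choices⁻ (options t) (map options (insertSlot b σ)) zs∈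
  ... | x , ys , x∈ , ys∈ , refl with ∈-insertSlot b σ σ∌b ys∈
  ...   | o , ws , ws∈ , refl =
    o , x ∷ ws , ∈-choices⁺ {xss = map options σ} x∈ ws∈ , sym (insert-≮ ws (combine-≮ (options-block t x∈) t≢b b≮t))

  completions-block : ∀ σ {zs b} → Avoids b σ → zs ∈ˡ completions σ → All (λ z → block z ≢ b) zs
  completions-block []      []           (here refl) = []
  completions-block (t ∷ σ) (t≢b ∷ σ∌b) zs∈ with ∈-choices⁻ (options t) (map options σ) zs∈
  ... | x , ys , x∈ , ys∈ , refl = (λ eq → t≢b (trans (sym (options-block t x∈)) eq)) ∷ completions-block σ σ∌b ys∈

  insertSlot-increasing : ∀ b σ → Avoids b σ → (∀ {zs} → zs ∈ˡ completions σ → Increasing zs) →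
                          ∀ {zs} → zs ∈ˡ completions (insertSlot b σ) → Increasing zs
  insertSlot-increasing b σ σ∌b σ↗ zs∈ with ∈-insertSlot b σ σ∌b zs∈
  ... | o , ys , ys∈ , refl = insert-increasing
    (All.map (λ {z} z≢b v≡z → z≢b (trans (cong block (sym v≡z)) (block-combine b o))) (completions-block σ σ∌b ys∈))
    (σ↗ ys∈)

  avoids? : ∀ b σ → Dec (Avoids b σ)
  avoids? b = All.all? λ t → ¬? (slotBlock t Fin.≟ b)

  avoids-∷ : ∀ t σ b → 𝟙 (avoids? b σ) ≤ 𝟙 (slotBlock t Fin.≟ b) + 𝟙 (avoids? b (t ∷ σ))
  avoids-∷ t σ b with slotBlock t Fin.≟ b
  ... | yes _   = ℕ.≤-trans (𝟙≤1 (avoids? b σ)) (ℕ.m≤m+n 1 _)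
  ... | no  t≢b = 𝟙-mono (avoids? b σ) _ (t≢b ∷_)

  avoids-many : ∀ σ → N ≤ length σ + ∑ (allFin N) (λ b → 𝟙 (avoids? b σ))
  avoids-many []      = ℕ.≤-reflexive (sym (trans (∑-const-Fin N 1) (ℕ.*-identityʳ N)))
  avoids-many (t ∷ σ) = begin
    N
      ≤⟨ avoids-many σ ⟩
    length σ + ∑ (allFin N) (λ b → 𝟙 (avoids? b σ))
      ≤⟨ ℕ.+-monoʳ-≤ (length σ) (∑-mono (allFin N) (avoids-∷ t σ)) ⟩
    length σ + ∑ (allFin N) (λ b → 𝟙 (slotBlock t Fin.≟ b) + 𝟙 (avoids? b (t ∷ σ)))
      ≡⟨ cong (length σ +_) (∑-+ (allFin N) _ _) ⟩
    length σ + (∑ (allFin N) (λ b → 𝟙 (slotBlock t Fin.≟ b)) + A)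
      ≤⟨ ℕ.+-monoʳ-≤ (length σ) (ℕ.+-monoˡ-≤ A (∑-𝟙≤1 (slotBlock t Fin.≟_) (Unique.allFin⁺ N) λ p p′ → trans (sym p) p′)) ⟩
    length σ + (1 + A)
      ≡⟨ ℕ.+-suc (length σ) A ⟩
    suc (length σ) + A ∎
    where
    open ℕ.≤-Reasoning
    A : ℕ
    A = ∑ (allFin N) (λ b → 𝟙 (avoids? b (t ∷ σ)))

  -- Only the tuples whose blocks are distinct and avoid those of σ are counted: for
  -- these the offsets do not affect the order.
  tuples-expect : ∀ {c κ} (xs : List V) e j (F : List V → ℕ) σ → length (fixed σ) + (j + e) ≤ c →
    fixed σ ≡ xs → #free σ ≡ j → (∀ {zs} → zs ∈ˡ completions σ → Increasing zs) →
    (∀ τ → fixed τ ≡ xs → #free τ ≡ j + e → (∀ {zs} → zs ∈ˡ completions τ → Increasing zs) → κ ≤ expect τ F) →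
    (N ∸ c) ^ e * κ ≤ ∑ (tuples (N * O) e) (λ s → expect σ (λ zs → F (insertAll s zs)))
  tuples-expect {c} {κ} xs zero j F σ c≥ fix≡ free≡ σ↗ κ≤ = begin
    1 * κ          ≡⟨ ℕ.*-identityˡ κ ⟩
    κ              ≤⟨ κ≤ σ fix≡ (trans free≡ (sym (ℕ.+-identityʳ j))) σ↗ ⟩
    expect σ F     ≡⟨ ℕ.+-identityʳ _ ⟨
    expect σ F + 0 ∎
    where open ℕ.≤-Reasoning
  tuples-expect {c} {κ} xs (suc e) j F σ c≥ fix≡ free≡ σ↗ κ≤ = begin
    (N ∸ c) * (N ∸ c) ^ e * κ
      ≡⟨ ℕ.*-assoc (N ∸ c) _ κ ⟩
    (N ∸ c) * R
      ≤⟨ ℕ.*-monoˡ-≤ R (ℕ.≤-trans (ℕ.∸-monoʳ-≤ N len≤c) (ℕ.m≤n+o⇒m∸n≤o N (length σ) (avoids-many σ))) ⟩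
    ∑ (allFin N) (λ b → 𝟙 (avoids? b σ)) * R
      ≡⟨ trans (ℕ.*-comm _ R) (∑-*ˡ R (allFin N) _) ⟩
    ∑ (allFin N) (λ b → R * 𝟙 (avoids? b σ))
      ≤⟨ ∑-mono (allFin N) each ⟩
    ∑ (allFin N) (λ b → ∑ (allFin O) λ o → ∑ (tuples (N * O) e) λ s → expect σ (λ zs → F (insertAll s (insert (combine b o) zs))))
      ≡⟨ ∑-combine N O _ ⟨
    ∑ (allFin (N * O)) (λ x → ∑ (tuples (N * O) e) λ s → expect σ (λ zs → F (insertAll s (insert x zs))))
      ≡⟨ ∑-choices-∷ (allFin (N * O)) (replicate e (allFin (N * O))) _ ⟨
    ∑ (tuples (N * O) (suc e)) (λ s → expect σ (λ zs → F (insertAll s zs))) ∎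
    where
    open ℕ.≤-Reasoning
    R : ℕ
    R = (N ∸ c) ^ e * κ
    len≤c : length σ ≤ c
    len≤c = ℕ.≤-trans (ℕ.≤-reflexive (trans (length-slots σ) (cong (length (fixed σ) +_) free≡)))
      (ℕ.≤-trans (ℕ.+-monoʳ-≤ (length (fixed σ)) (ℕ.m≤m+n j (suc e))) c≥)
    each : ∀ b → R * 𝟙 (avoids? b σ) ≤
           ∑ (allFin O) λ o → ∑ (tuples (N * O) e) λ s → expect σ (λ zs → F (insertAll s (insert (combine b o) zs)))
    each b with avoids? b σ
    ... | no  _   = ℕ.≤-trans (ℕ.≤-reflexive (ℕ.*-zeroʳ R)) z≤n
    ... | yes σ∌b = begin
      R * 1
        ≡⟨ ℕ.*-identityʳ R ⟩
      R
        ≤⟨ tuples-expect xs e (suc j) F (insertSlot b σ)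
             (subst (_≤ c) (cong₂ _+_ (cong length (sym (fixed-insertSlot b σ))) (ℕ.+-suc j e)) c≥)
             (trans (fixed-insertSlot b σ) fix≡) (trans (#free-insertSlot b σ) (cong suc free≡))
             (insertSlot-increasing b σ σ∌b σ↗) (λ τ f≡ #≡ → κ≤ τ f≡ (trans #≡ (sym (ℕ.+-suc j e)))) ⟩
      ∑ (tuples (N * O) e) (λ s → expect (insertSlot b σ) (λ zs → F (insertAll s zs)))
        ≡⟨ ∑-cong (tuples (N * O) e) (λ s → expect-insertSlot b σ _ σ∌b) ⟩
      ∑ (tuples (N * O) e) (λ s → ∑ (allFin O) λ o → expect σ (λ zs → F (insertAll s (insert (combine b o) zs))))
        ≡⟨ ∑-comm (tuples (N * O) e) (allFin O) _ ⟩
      ∑ (allFin O) (λ o → ∑ (tuples (N * O) e) λ s → expect σ (λ zs → F (insertAll s (insert (combine b o) zs)))) ∎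

  -- The expected number of edges through given vertices.

  module _ {Edge : List (Fin m) → Set} (edge? : ∀ cs → Dec (Edge cs))
           (edge-↭ : ∀ {cs ds} → cs ↭ ds → Edge cs → Edge ds) where

    -- The first a entries of a list determine the key y that colours the others.
    Good : ℕ → Fin M → List V → Set
    Good zero    y zs       = Edge (map (col y) zs)
    Good (suc a) y []       = ⊥
    Good (suc a) y (z ∷ zs) = Good a (key z ⊕ y) zs

    good? : ∀ a y zs → Dec (Good a y zs)
    good? zero    y zs       = edge? (map (col y) zs)
    good? (suc a) y []       = no λ ()
    good? (suc a) y (z ∷ zs) = good? a (key z ⊕ y) zs

    𝟙E : List (Fin m) → ℕ
    𝟙E cs = 𝟙 (edge? cs)

    𝟙E-↭ : ∀ {cs ds} → cs ↭ ds → 𝟙E cs ≡ 𝟙E ds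
    𝟙E-↭ p = 𝟙-cong (edge? _) (edge? _) (edge-↭ p) (edge-↭ (Perm.↭-sym p))

    expectGood : ℕ → List Slot → Fin M → ℕ
    expectGood a τ y = expect τ λ zs → 𝟙 (good? a y zs)

    -- For one fixed key the free slots have exactly independent uniform colours: their offsets are
    -- chosen independently, and `col-uniform` applies to each. Symmetry of `Φ` allows the free
    -- colours to be moved behind the fixed ones.
    expect-colours : ∀ y τ (Φ : List (Fin m) → ℕ) → (∀ {cs ds} → cs ↭ ds → Φ cs ≡ Φ ds) →
      m ^ #free τ * expect τ (λ zs → Φ (map (col y) zs)) ≡
      O ^ #free τ * ∑ (tuples m (#free τ)) (λ cs → Φ (map (col y) (fixed τ) ++ cs))
    expect-colours y []           Φ Φ-↭ = refl
    expect-colours y (fix x ∷ τ)  Φ Φ-↭ = trans (cong (m ^ #free τ *_) (expect-fix x τ _))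
      (expect-colours y τ (λ cs → Φ (col y x ∷ cs)) (Φ-↭ ∘ Perm.prep _))
    expect-colours y (free b ∷ τ) Φ Φ-↭ = begin
      m ^ suc f * expect (free b ∷ τ) (λ zs → Φ (map (col y) zs))
        ≡⟨ cong (m ^ suc f *_) (expect-free b τ _) ⟩
      m * m ^ f * ∑ (allFin O) (λ o → expect τ (λ zs → Φ (c o ∷ map (col y) zs)))
        ≡⟨ trans (ℕ.*-assoc m _ _) (cong (m *_) (∑-*ˡ (m ^ f) (allFin O) _)) ⟩
      m * ∑ (allFin O) (λ o → m ^ f * expect τ (λ zs → Φ (c o ∷ map (col y) zs)))
        ≡⟨ cong (m *_) (∑-cong (allFin O) λ o → expect-colours y τ (λ cs → Φ (c o ∷ cs)) (Φ-↭ ∘ Perm.prep _)) ⟩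
      m * ∑ (allFin O) (λ o → O ^ f * ∑ (tuples m f) (λ cs → Φ (c o ∷ fs ++ cs)))
        ≡⟨ cong (m *_) (trans (sym (∑-*ˡ (O ^ f) (allFin O) _)) (cong (O ^ f *_) (∑-comm (allFin O) (tuples m f) _))) ⟩
      m * (O ^ f * ∑ (tuples m f) (λ cs → ∑ (allFin O) λ o → Φ (c o ∷ fs ++ cs)))
        ≡⟨ trans (left-comm m (O ^ f) _) (cong (O ^ f *_) (∑-*ˡ m (tuples m f) _)) ⟩
      O ^ f * ∑ (tuples m f) (λ cs → m * ∑ (allFin O) λ o → Φ (c o ∷ fs ++ cs))
        ≡⟨ cong (O ^ f *_) (∑-cong (tuples m f) λ cs → col-uniform y b (λ c → Φ (c ∷ fs ++ cs))) ⟩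
      O ^ f * ∑ (tuples m f) (λ cs → O * ∑ (allFin m) λ c → Φ (c ∷ fs ++ cs))
        ≡⟨ trans (cong (O ^ f *_) (sym (∑-*ˡ O (tuples m f) _))) (trans (left-comm (O ^ f) O _) (sym (ℕ.*-assoc O _ _))) ⟩
      O * O ^ f * ∑ (tuples m f) (λ cs → ∑ (allFin m) λ c → Φ (c ∷ fs ++ cs))
        ≡⟨ cong (O * O ^ f *_) (trans (∑-comm (tuples m f) (allFin m) _)
             (∑-cong (allFin m) λ c → ∑-cong (tuples m f) λ cs → Φ-↭ (Perm.↭-sym (Perm.shift c fs cs)))) ⟩
      O * O ^ f * ∑ (allFin m) (λ c → ∑ (tuples m f) λ cs → Φ (fs ++ c ∷ cs))
        ≡⟨ cong (O * O ^ f *_) (∑-choices-∷ (allFin m) (replicate f (allFin m)) _) ⟨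
      O ^ suc f * ∑ (tuples m (suc f)) (λ cs → Φ (fs ++ cs)) ∎
      where
      open ≡-Reasoning
      f : ℕ
      f = #free τ
      fs : List (Fin m)
      fs = map (col y) (fixed τ)
      c : Fin O → Fin m
      c o = col y (combine b o)
      left-comm : ∀ a b c → a * (b * c) ≡ b * (a * c)
      left-comm = solve-∀

    ∑-expectGood-fix : ∀ a x τ → ∑ (allFin M) (expectGood (suc a) (fix x ∷ τ)) ≡ ∑ (allFin M) (expectGood a τ)
    ∑-expectGood-fix a x τ = trans (∑-cong (allFin M) λ y → expect-fix x τ _) (∑-⊕ˡ (key x) (expectGood a τ))

    ∑-expectGood-free : ∀ a b τ → ∑ (allFin M) (expectGood (suc a) (free b ∷ τ)) ≡ O * ∑ (allFin M) (expectGood a τ)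
    ∑-expectGood-free a b τ = begin
      ∑ (allFin M) (expectGood (suc a) (free b ∷ τ))
        ≡⟨ ∑-cong (allFin M) (λ y → expect-free b τ _) ⟩
      ∑ (allFin M) (λ y → ∑ (allFin O) λ o → expectGood a τ (key (combine b o) ⊕ y))
        ≡⟨ ∑-comm (allFin M) (allFin O) _ ⟩
      ∑ (allFin O) (λ o → ∑ (allFin M) λ y → expectGood a τ (key (combine b o) ⊕ y))
        ≡⟨ ∑-cong (allFin O) (λ o → ∑-⊕ˡ (key (combine b o)) (expectGood a τ)) ⟩
      ∑ (allFin O) (λ _ → ∑ (allFin M) (expectGood a τ))
        ≡⟨ ∑-const-Fin O _ ⟩
      O * ∑ (allFin M) (expectGood a τ) ∎
      where open ≡-Reasoning

    -- The key of a free vertex is uniform, hence so is its sum with `y`. One free keyed slot thus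
    -- replaces a particular key by the average over all keys, which is the setting of
    -- `col-independent`.
    expectGood-free : ∀ a b τ y → M * expectGood (suc a) (free b ∷ τ) y ≡ O * ∑ (allFin M) (expectGood a τ)
    expectGood-free a b τ y = begin
      M * expectGood (suc a) (free b ∷ τ) y
        ≡⟨ cong (M *_) (expect-free b τ _) ⟩
      M * ∑ (allFin O) (λ o → expectGood a τ (key (combine b o) ⊕ y))
        ≡⟨ key-uniform b (λ y′ → expectGood a τ (y′ ⊕ y)) ⟩
      O * ∑ (allFin M) (λ y′ → expectGood a τ (y′ ⊕ y))
        ≡⟨ cong (O *_) (∑-⊕ʳ y (expectGood a τ)) ⟩
      O * ∑ (allFin M) (expectGood a τ) ∎
      where open ≡-Reasoning

    module _ {e ℓ Γ : ℕ} (Γ≤ : ∀ c → Γ ≤ ∑ (tuples m e) λ cs → 𝟙E (c ∷ cs)) where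

      private
        U : ℕ
        U = u ∸ ℓ * ℓ

      -- Averaging over keys survives the addition of further keys, so the keyed slots can be
      -- stripped off. For the e + 1 coloured slots, `col-independent` handles the fixed ones and
      -- `expect-colours` the free ones, as if all colours were independent and uniform. At least m
      -- * Γ of the m ^ (e + 1) colour tuples are edges, whence the factor `m` that the base case
      -- cancels.
      average-bound : ∀ a τ → length τ ≡ a + suc e → Unique (fixed τ) → length (fixed τ) ≤ ℓ →
        U * Γ * (M * O ^ #free τ) ≤ u * m ^ e * ∑ (allFin M) (expectGood a τ)
      average-bound (suc a) (fix x ∷ τ) len (_ ∷ τ!) j≤ℓ = ℕ.≤-trans
        (average-bound a τ (ℕ.suc-injective len) τ! (ℕ.<⇒≤ j≤ℓ))
        (ℕ.≤-reflexive (cong (u * m ^ e *_) (sym (∑-expectGood-fix a x τ))))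
      average-bound (suc a) (free b ∷ τ) len τ! j≤ℓ = begin
        U * Γ * (M * (O * O ^ #free τ))                       ≡⟨ regroup (U * Γ) M O (O ^ #free τ) ⟩
        O * (U * Γ * (M * O ^ #free τ))                       ≤⟨ ℕ.*-monoʳ-≤ O (average-bound a τ (ℕ.suc-injective len) τ! j≤ℓ) ⟩
        O * (u * m ^ e * ∑ (allFin M) (expectGood a τ))       ≡⟨ left-comm O (u * m ^ e) _ ⟩
        u * m ^ e * (O * ∑ (allFin M) (expectGood a τ))       ≡⟨ cong (u * m ^ e *_) (∑-expectGood-free a b τ) ⟨
        u * m ^ e * ∑ (allFin M) (expectGood (suc a) (free b ∷ τ)) ∎
        where
        open ℕ.≤-Reasoning
        regroup : ∀ w a b c → w * (a * (b * c)) ≡ b * (w * (a * c))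
        regroup = solve-∀
        left-comm : ∀ a b c → a * (b * c) ≡ b * (a * c)
        left-comm = solve-∀
      average-bound zero τ len τ! j≤ℓ = ℕ.*-cancelˡ-≤ m (begin
        m * (U * Γ * (M * O ^ f))
          ≡⟨ regroup₁ m U Γ M (O ^ f) ⟩
        O ^ f * (U * (M * (m * Γ)))
          ≤⟨ ℕ.*-monoʳ-≤ (O ^ f) (ℕ.*-mono-≤ (ℕ.∸-monoʳ-≤ u (ℕ.*-mono-≤ j≤ℓ j≤ℓ)) (ℕ.*-monoʳ-≤ M W≥)) ⟩
        O ^ f * ((u ∸ j * j) * (M * ∑ (tuples m j) F))
          ≤⟨ ℕ.*-monoʳ-≤ (O ^ f) (col-independent (fixed τ) τ! F) ⟩
        O ^ f * (u * (m ^ j * ∑ (allFin M) (λ y → F (map (col y) (fixed τ)))))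
          ≡⟨ regroup₂ (O ^ f) u (m ^ j) _ ⟩
        u * m ^ j * (O ^ f * ∑ (allFin M) (λ y → F (map (col y) (fixed τ))))
          ≡⟨ cong (u * m ^ j *_) (∑-*ˡ (O ^ f) (allFin M) _) ⟩
        u * m ^ j * ∑ (allFin M) (λ y → O ^ f * F (map (col y) (fixed τ)))
          ≡⟨ cong (u * m ^ j *_) (∑-cong (allFin M) λ y → expect-colours y τ 𝟙E 𝟙E-↭) ⟨
        u * m ^ j * ∑ (allFin M) (λ y → m ^ f * expectGood 0 τ y)
          ≡⟨ cong (u * m ^ j *_) (∑-*ˡ (m ^ f) (allFin M) _) ⟨
        u * m ^ j * (m ^ f * ∑ (allFin M) (expectGood 0 τ))
          ≡⟨ regroup₃ u (m ^ j) (m ^ f) _ ⟩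
        u * (m ^ j * m ^ f) * ∑ (allFin M) (expectGood 0 τ)
          ≡⟨ cong (λ p → u * p * ∑ (allFin M) (expectGood 0 τ))
               (trans (sym (ℕ.^-distribˡ-+-* m j f)) (cong (m ^_) j+f≡)) ⟩
        u * (m * m ^ e) * ∑ (allFin M) (expectGood 0 τ)
          ≡⟨ regroup₄ u m (m ^ e) _ ⟩
        m * (u * m ^ e * ∑ (allFin M) (expectGood 0 τ)) ∎)
        where
        open ℕ.≤-Reasoning
        j f : ℕ
        j = length (fixed τ)
        f = #free τ
        j+f≡ : j + f ≡ suc e
        j+f≡ = trans (sym (length-slots τ)) len
        F : List (Fin m) → ℕ
        F ds = ∑ (tuples m f) λ cs → 𝟙E (ds ++ cs)
        W≥ : m * Γ ≤ ∑ (tuples m j) F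
        W≥ = begin
          m * Γ                                                   ≡⟨ ∑-const-Fin m Γ ⟨
          ∑ (allFin m) (λ _ → Γ)                                  ≤⟨ ∑-mono (allFin m) Γ≤ ⟩
          ∑ (allFin m) (λ c → ∑ (tuples m e) λ cs → 𝟙E (c ∷ cs))  ≡⟨ ∑-choices-∷ (allFin m) (replicate e (allFin m)) 𝟙E ⟨
          ∑ (tuples m (suc e)) 𝟙E                                 ≡⟨ cong (λ r → ∑ (tuples m r) 𝟙E) j+f≡ ⟨
          ∑ (tuples m (j + f)) 𝟙E                                 ≡⟨ ∑-tuples-+ m j f 𝟙E ⟩
          ∑ (tuples m j) F                                        ∎
        regroup₁ : ∀ m w g k p → m * (w * g * (k * p)) ≡ p * (w * (k * (m * g)))
        regroup₁ = solve-∀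
        regroup₂ : ∀ p u k x → p * (u * (k * x)) ≡ u * k * (p * x)
        regroup₂ = solve-∀
        regroup₃ : ∀ u k p x → u * k * (p * x) ≡ u * (k * p) * x
        regroup₃ = solve-∀
        regroup₄ : ∀ u k p x → u * (k * p) * x ≡ k * (u * p * x)
        regroup₄ = solve-∀

      -- If all keyed slots are fixed, then exactly one coloured slot is, and Γ applies to
      -- its colour; otherwise a free keyed slot makes the key uniform.
      expect-bound : ∀ a τ y → length (fixed τ) ≡ suc a → #free τ ≡ e → Unique (fixed τ) → suc a ≤ ℓ →
        U * Γ * O ^ e ≤ u * m ^ e * expectGood a τ y
      expect-bound (suc a) (fix x ∷ τ) y len free≡ (_ ∷ τ!) j≤ℓ = ℕ.≤-trans
        (expect-bound a τ (key x ⊕ y) (ℕ.suc-injective len) free≡ τ! (ℕ.<⇒≤ j≤ℓ))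
        (ℕ.≤-reflexive (cong (u * m ^ e *_) (sym (expect-fix x τ _))))
      expect-bound (suc a) (free b ∷ τ) y len refl τ! j≤ℓ = ℕ.*-cancelˡ-≤ M {{M≢0}} (begin
        M * (U * Γ * (O * O ^ #free τ))                          ≡⟨ regroup M (U * Γ) O (O ^ #free τ) ⟩
        O * (U * Γ * (M * O ^ #free τ))                          ≤⟨ ℕ.*-monoʳ-≤ O (average-bound a τ length≡ τ! (subst (_≤ ℓ) (sym len) j≤ℓ)) ⟩
        O * (u * m ^ e * ∑ (allFin M) (expectGood a τ))          ≡⟨ left-comm O (u * m ^ e) _ ⟩
        u * m ^ e * (O * ∑ (allFin M) (expectGood a τ))          ≡⟨ cong (u * m ^ e *_) (expectGood-free a b τ y) ⟨
        u * m ^ e * (M * expectGood (suc a) (free b ∷ τ) y)      ≡⟨ left-comm (u * m ^ e) M _ ⟩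
        M * (u * m ^ e * expectGood (suc a) (free b ∷ τ) y)      ∎)
        where
        open ℕ.≤-Reasoning
        length≡ : length τ ≡ a + suc (suc (#free τ))
        length≡ = trans (length-slots τ) (trans (cong (_+ #free τ) len)
          (sym (trans (ℕ.+-suc a _) (cong suc (ℕ.+-suc a _)))))
        regroup : ∀ a w b c → a * (w * (b * c)) ≡ b * (w * (a * c))
        regroup = solve-∀
        left-comm : ∀ a b c → a * (b * c) ≡ b * (a * c)
        left-comm = solve-∀
      expect-bound zero τ y len refl τ! j≤ℓ with fixed τ in eq
      -- No independence between fixed colours is involved here. The loss from u to U is conceded
      -- only to obtain the same bound as in the averaged case.
      ... | x ∷ [] = begin
        U * Γ * O ^ e
          ≡⟨ regroup U Γ (O ^ e) ⟩
        U * (O ^ e * Γ)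
          ≤⟨ ℕ.*-mono-≤ (ℕ.m∸n≤m u (ℓ * ℓ)) (ℕ.*-monoʳ-≤ (O ^ e) (Γ≤ (col y x))) ⟩
        u * (O ^ e * ∑ (tuples m e) (λ cs → 𝟙E (col y x ∷ cs)))
          ≡⟨ cong (λ xs → u * (O ^ e * ∑ (tuples m e) (λ cs → 𝟙E (map (col y) xs ++ cs)))) eq ⟨
        u * (O ^ e * ∑ (tuples m e) (λ cs → 𝟙E (map (col y) (fixed τ) ++ cs)))
          ≡⟨ cong (u *_) (expect-colours y τ 𝟙E 𝟙E-↭) ⟨
        u * (m ^ e * expectGood 0 τ y)
          ≡⟨ ℕ.*-assoc u (m ^ e) _ ⟨
        u * m ^ e * expectGood 0 τ y ∎
        where
        open ℕ.≤-Reasoning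
        regroup : ∀ w g p → w * g * p ≡ w * (p * g)
        regroup = solve-∀

-- Subsets as lists, and degrees counted by tuples.

∣p∪q∣≤∣p∣+∣q∣ : ∀ {n} (p q : Subset n) → ∣ p ∪ q ∣ ≤ ∣ p ∣ + ∣ q ∣
∣p∪q∣≤∣p∣+∣q∣ []            []            = z≤n
∣p∪q∣≤∣p∣+∣q∣ (inside  ∷ p) (inside  ∷ q) = s≤s (ℕ.≤-trans (∣p∪q∣≤∣p∣+∣q∣ p q) (ℕ.+-monoʳ-≤ ∣ p ∣ (ℕ.n≤1+n ∣ q ∣)))
∣p∪q∣≤∣p∣+∣q∣ (inside  ∷ p) (outside ∷ q) = s≤s (∣p∪q∣≤∣p∣+∣q∣ p q)
∣p∪q∣≤∣p∣+∣q∣ (outside ∷ p) (inside  ∷ q) = ℕ.≤-trans (s≤s (∣p∪q∣≤∣p∣+∣q∣ p q)) (ℕ.≤-reflexive (sym (ℕ.+-suc ∣ p ∣ ∣ q ∣)))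
∣p∪q∣≤∣p∣+∣q∣ (outside ∷ p) (outside ∷ q) = ∣p∪q∣≤∣p∣+∣q∣ p q

∣⁅x⁆∪p∣ : ∀ {n} {x : Fin n} {p} → x Subset.∉ p → ∣ ⁅ x ⁆ ∪ p ∣ ≡ suc ∣ p ∣
∣⁅x⁆∪p∣ {x = zero}  {inside  ∷ p} x∉p = contradiction here x∉p
∣⁅x⁆∪p∣ {x = zero}  {outside ∷ p} x∉p = cong (suc ∘ ∣_∣) (Subset.∪-identityˡ p)
∣⁅x⁆∪p∣ {x = suc x} {inside  ∷ p} x∉p = cong suc (∣⁅x⁆∪p∣ (x∉p ∘ there))
∣⁅x⁆∪p∣ {x = suc x} {outside ∷ p} x∉p = ∣⁅x⁆∪p∣ (x∉p ∘ there)

x∉p-x : ∀ {n} (x : Fin n) p → x Subset.∉ p Subset.- x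
x∉p-x zero    (inside  ∷ p) ()
x∉p-x zero    (outside ∷ p) ()
x∉p-x (suc x) (s ∷ p) (there x∈) = x∉p-x x p x∈

infix 4 _≟ˢ_

_≟ˢ_ : ∀ {n} (p q : Subset n) → Dec (p ≡ q)
_≟ˢ_ = Vec.≡-dec Bool._≟_

module _ {n : ℕ} where

  set : List (Fin n) → Subset n
  set xs = ⋃ (map ⁅_⁆ xs)

  ∈-set⁺ : ∀ {x xs} → x ∈ˡ xs → x Subset.∈ set xs
  ∈-set⁺ (here refl) = Subset.x∈p∪q⁺ (inj₁ (Subset.x∈⁅x⁆ _))
  ∈-set⁺ (there x∈)  = Subset.x∈p∪q⁺ (inj₂ (∈-set⁺ x∈))

  ∈-set⁻ : ∀ {x} xs → x Subset.∈ set xs → x ∈ˡ xs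
  ∈-set⁻ []       x∈ = contradiction x∈ Subset.∉⊥
  ∈-set⁻ (y ∷ xs) x∈ with Subset.x∈p∪q⁻ ⁅ y ⁆ (set xs) x∈
  ... | inj₁ x∈y  = here (Subset.x∈⁅y⁆⇒x≡y y x∈y)
  ... | inj₂ x∈xs = there (∈-set⁻ xs x∈xs)

  set-cong : ∀ {xs ys} → (∀ {x} → x ∈ˡ xs → x ∈ˡ ys) → (∀ {x} → x ∈ˡ ys → x ∈ˡ xs) → set xs ≡ set ys
  set-cong {xs} {ys} f g = Subset.⊆-antisym (∈-set⁺ ∘ f ∘ ∈-set⁻ xs) (∈-set⁺ ∘ g ∘ ∈-set⁻ ys)

  set-↭ : ∀ {xs ys} → xs ↭ ys → set xs ≡ set ys
  set-↭ p = set-cong (Perm.∈-resp-↭ p) (Perm.∈-resp-↭ (Perm.↭-sym p))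

  set-++ : ∀ xs ys → set (xs ++ ys) ≡ set xs ∪ set ys
  set-++ []       ys = sym (Subset.∪-identityˡ (set ys))
  set-++ (x ∷ xs) ys = trans (cong (⁅ x ⁆ ∪_) (set-++ xs ys)) (sym (Subset.∪-assoc ⁅ x ⁆ (set xs) (set ys)))

  ∣set∣≤length : ∀ xs → ∣ set xs ∣ ≤ length xs
  ∣set∣≤length []       = ℕ.≤-reflexive (Subset.∣⊥∣≡0 n)
  ∣set∣≤length (x ∷ xs) = ℕ.≤-trans (∣p∪q∣≤∣p∣+∣q∣ ⁅ x ⁆ (set xs))
    (ℕ.+-mono-≤ (ℕ.≤-reflexive (Subset.∣⁅x⁆∣≡1 x)) (∣set∣≤length xs))

  ∣set∣≡length : ∀ {xs} → Unique xs → ∣ set xs ∣ ≡ length xs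
  ∣set∣≡length []           = Subset.∣⊥∣≡0 n
  ∣set∣≡length (x∉ ∷ xs!) = trans (∣⁅x⁆∪p∣ λ x∈ → All.lookup x∉ (∈-set⁻ _ x∈) refl) (cong suc (∣set∣≡length xs!))

  ∈⇒⁅x⁆∪p≡p : ∀ {x : Fin n} {p} → x Subset.∈ p → ⁅ x ⁆ ∪ p ≡ p
  ∈⇒⁅x⁆∪p≡p {x} {p} x∈p = Subset.⊆-antisym to (λ y∈ → Subset.x∈p∪q⁺ (inj₂ y∈))
    where
    to : ⁅ x ⁆ ∪ p Subset.⊆ p
    to y∈ with Subset.x∈p∪q⁻ ⁅ x ⁆ p y∈
    ... | inj₁ y∈x = subst (Subset._∈ p) (sym (Subset.x∈⁅y⁆⇒x≡y x y∈x)) x∈p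
    ... | inj₂ y∈p = y∈p

  ∣set∣≡length⇒Unique : ∀ xs → ∣ set xs ∣ ≡ length xs → Unique xs
  ∣set∣≡length⇒Unique []       _  = []
  ∣set∣≡length⇒Unique (x ∷ xs) eq with x Subset.∈? set xs
  ... | yes x∈ = contradiction (ℕ.≤-trans (ℕ.≤-reflexive (trans (sym eq) (cong ∣_∣ (∈⇒⁅x⁆∪p≡p x∈)))) (∣set∣≤length xs)) ℕ.1+n≰n
  ... | no  x∉ = All.tabulate (λ y∈ → λ { refl → x∉ (∈-set⁺ y∈) })
                 ∷ ∣set∣≡length⇒Unique xs (ℕ.suc-injective (trans (sym (∣⁅x⁆∪p∣ x∉)) eq))

  elements : Subset n → List (Fin n)
  elements S = filter (Subset._∈? S) (allFin n)

  ∈-elements⁺ : ∀ {x S} → x Subset.∈ S → x ∈ˡ elements S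
  ∈-elements⁺ {x} {S} x∈ = ∈-filter⁺ (Subset._∈? S) (∈-allFin x) x∈

  ∈-elements⁻ : ∀ {x S} → x ∈ˡ elements S → x Subset.∈ S
  ∈-elements⁻ {x} {S} x∈ = proj₂ (∈-filter⁻ (Subset._∈? S) {xs = allFin n} x∈)

  elements-increasing : ∀ S → Increasing (elements S)
  elements-increasing S = AllPairs.filter⁺ (Subset._∈? S) (AllPairs.tabulate⁺-< id)

  Increasing⇒Unique : ∀ {xs : List (Fin n)} → Increasing xs → Unique xs
  Increasing⇒Unique []          = []
  Increasing⇒Unique (x< ∷ xs↗) = All.map (λ x<y x≡y → Fin.<-irrefl x≡y x<y) x< ∷ Increasing⇒Unique xs↗

  Increasing-extensional : ∀ {xs ys} → Increasing xs → Increasing ys →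
    (∀ {z : Fin n} → z ∈ˡ xs → z ∈ˡ ys) → (∀ {z} → z ∈ˡ ys → z ∈ˡ xs) → xs ≡ ys
  Increasing-extensional {[]}     {[]}     _ _ f g = refl
  Increasing-extensional {[]}     {y ∷ ys} _ _ f g with () ← g (here refl)
  Increasing-extensional {x ∷ xs} {[]}     _ _ f g with () ← f (here refl)
  Increasing-extensional {x ∷ xs} {y ∷ ys} (x< ∷ xs↗) (y< ∷ ys↗) f g with f (here refl) | g (here refl)
  ... | there x∈ | there y∈ = contradiction (All.lookup x< y∈) (ℕ.<-asym (All.lookup y< x∈))
  ... | there x∈ | here refl = contradiction (All.lookup y< x∈) (Fin.<-irrefl refl)
  ... | here refl | _ = cong (x ∷_) (Increasing-extensional xs↗ ys↗
    (λ z∈ → tail (f (there z∈)) (All.lookup x< z∈)) (λ z∈ → tail (g (there z∈)) (All.lookup y< z∈)))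
    where
    tail : ∀ {z zs} → z ∈ˡ x ∷ zs → x Fin.< z → z ∈ˡ zs
    tail (here refl) x<x = contradiction x<x (Fin.<-irrefl refl)
    tail (there z∈)  _   = z∈

  elements-set : ∀ {xs} → Increasing xs → elements (set xs) ≡ xs
  elements-set {xs} xs↗ = Increasing-extensional (elements-increasing (set xs)) xs↗ (∈-set⁻ xs ∘ ∈-elements⁻) (∈-elements⁺ ∘ ∈-set⁺)

  set-elements : ∀ S → set (elements S) ≡ S
  set-elements S = Subset.⊆-antisym (∈-elements⁻ ∘ ∈-set⁻ (elements S)) (∈-set⁺ ∘ ∈-elements⁺)

  length-elements : ∀ S → length (elements S) ≡ ∣ S ∣
  length-elements S = trans (sym (∣set∣≡length (Increasing⇒Unique (elements-increasing S)))) (cong ∣_∣ (set-elements S))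

  length-tuples : ∀ {e s} → s ∈ˡ tuples n e → length s ≡ e
  length-tuples {zero}  (here refl) = refl
  length-tuples {suc e} s∈ with ∈-choices⁻ (allFin n) (replicate e (allFin n)) s∈
  ... | x , ys , _ , ys∈ , refl = cong suc (length-tuples ys∈)

  ⁅x⁆∪-‿- : ∀ {x : Fin n} {S} → x Subset.∈ S → ⁅ x ⁆ ∪ (S Subset.- x) ≡ S
  ⁅x⁆∪-‿- {x} {S} x∈ = Subset.⊆-antisym to from
    where
    to : ⁅ x ⁆ ∪ (S Subset.- x) Subset.⊆ S
    to y∈ with Subset.x∈p∪q⁻ ⁅ x ⁆ (S Subset.- x) y∈
    ... | inj₁ y∈x = subst (Subset._∈ S) (sym (Subset.x∈⁅y⁆⇒x≡y x y∈x)) x∈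
    ... | inj₂ y∈S = Subset.p─q⊆p S ⁅ x ⁆ y∈S
    from : S Subset.⊆ ⁅ x ⁆ ∪ (S Subset.- x)
    from {y} y∈ with y Subset.∈? ⁅ x ⁆
    ... | yes y∈x = Subset.x∈p∪q⁺ (inj₁ y∈x)
    ... | no  y∉x = Subset.x∈p∪q⁺ (inj₂ (Subset.x∈p∧x∉q⇒x∈p─q y∈ y∉x))

  ∣p-x∣ : ∀ {x : Fin n} {S} → x Subset.∈ S → suc ∣ S Subset.- x ∣ ≡ ∣ S ∣
  ∣p-x∣ {x} {S} x∈ = trans (sym (∣⁅x⁆∪p∣ (x∉p-x x S))) (cong ∣_∣ (⁅x⁆∪-‿- x∈))

  tuples-of-set : ∀ e S → ∣ S ∣ ≡ e → ∑ (tuples n e) (λ s → 𝟙 (set s ≟ˢ S)) ≡ e !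
  tuples-of-set zero S ∣S∣≡0 = trans (ℕ.+-identityʳ _) (𝟙-yes (set [] ≟ˢ S) (sym (Subset.Empty-unique
    λ (x , x∈) → contradiction (trans (∣p-x∣ x∈) ∣S∣≡0) λ ())))
  tuples-of-set (suc e) S ∣S∣≡ = begin
    ∑ (tuples n (suc e)) (λ s → 𝟙 (set s ≟ˢ S))
      ≡⟨ ∑-choices-∷ (allFin n) (replicate e (allFin n)) _ ⟩
    ∑ (allFin n) (λ x → ∑ (tuples n e) λ s → 𝟙 (⁅ x ⁆ ∪ set s ≟ˢ S))
      ≡⟨ ∑-cong (allFin n) each ⟩
    ∑ (allFin n) (λ x → e ! * 𝟙 (x Subset.∈? S))
      ≡⟨ ∑-*ˡ (e !) (allFin n) _ ⟨
    e ! * ∑ (allFin n) (λ x → 𝟙 (x Subset.∈? S))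
      ≡⟨ cong (e ! *_) (trans (sym (length-filter (Subset._∈? S) (allFin n))) (trans (length-elements S) ∣S∣≡)) ⟩
    e ! * suc e
      ≡⟨ ℕ.*-comm (e !) (suc e) ⟩
    suc e ! ∎
    where
    open ≡-Reasoning
    zeros : ∀ (xs : List (List (Fin n))) → ∑ xs (λ _ → 0) ≡ 0
    zeros xs = trans (∑-const xs 0) (ℕ.*-zeroʳ (length xs))
    each : ∀ x → ∑ (tuples n e) (λ s → 𝟙 (⁅ x ⁆ ∪ set s ≟ˢ S)) ≡ e ! * 𝟙 (x Subset.∈? S)
    each x with x Subset.∈? S
    ... | no x∉ = trans (trans (∑-cong (tuples n e) λ s → 𝟙-no (⁅ x ⁆ ∪ set s ≟ˢ S)
                    λ eq → x∉ (subst (x Subset.∈_) eq (Subset.x∈p∪q⁺ (inj₁ (Subset.x∈⁅x⁆ x)))))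
                    (zeros (tuples n e))) (sym (ℕ.*-zeroʳ (e !)))
    ... | yes x∈ = trans (∑-cong-∈ (tuples n e) λ {s} s∈ → 𝟙-cong (⁅ x ⁆ ∪ set s ≟ˢ S) (set s ≟ˢ S Subset.- x)
                      (remove s∈) λ eq → trans (cong (⁅ x ⁆ ∪_) eq) (⁅x⁆∪-‿- x∈))
                    (trans (tuples-of-set e (S Subset.- x) (ℕ.suc-injective (trans (∣p-x∣ x∈) ∣S∣≡))) (sym (ℕ.*-identityʳ (e !))))
      where
      remove : ∀ {s} → s ∈ˡ tuples n e → ⁅ x ⁆ ∪ set s ≡ S → set s ≡ S Subset.- x
      remove {s} s∈ refl = Subset.⊆-antisym
        (λ {y} y∈ → Subset.x∈p∧x∉q⇒x∈p─q (Subset.x∈p∪q⁺ (inj₂ y∈)) λ y∈x → x∉s (subst (Subset._∈ set s) (Subset.x∈⁅y⁆⇒x≡y x y∈x) y∈))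
        back
        where
        x∉s : x Subset.∉ set s
        x∉s x∈s = ℕ.1+n≰n (ℕ.≤-trans (ℕ.≤-reflexive (trans (sym ∣S∣≡) (cong ∣_∣ (∈⇒⁅x⁆∪p≡p x∈s))))
          (ℕ.≤-trans (∣set∣≤length s) (ℕ.≤-reflexive (length-tuples s∈))))
        back : (⁅ x ⁆ ∪ set s) Subset.- x Subset.⊆ set s
        back {y} y∈ with Subset.x∈p∪q⁻ ⁅ x ⁆ (set s) (Subset.p─q⊆p _ ⁅ x ⁆ y∈)
        ... | inj₂ y∈s = y∈s
        ... | inj₁ y∈x = contradiction (subst (Subset._∈ (⁅ x ⁆ ∪ set s) Subset.- x) (Subset.x∈⁅y⁆⇒x≡y x y∈x) y∈) (x∉p-x x _)

∈-allSubsets : ∀ {n} (S : Subset n) → S ∈ˡ allSubsets n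
∈-allSubsets []            = here refl
∈-allSubsets (inside  ∷ S) = ∈-++⁺ˡ (∈-map⁺ (inside ∷_) (∈-allSubsets S))
∈-allSubsets (outside ∷ S) = ∈-++⁺ʳ _ (∈-map⁺ (outside ∷_) (∈-allSubsets S))

allSubsets-unique : ∀ n → Unique (allSubsets n)
allSubsets-unique zero    = [] ∷ []
allSubsets-unique (suc n) = Unique.++⁺
  (Unique.map⁺ Vec.∷-injectiveʳ (allSubsets-unique n)) (Unique.map⁺ Vec.∷-injectiveʳ (allSubsets-unique n))
  λ { (S∈ , S∈′) → disjoint (∈-map⁻ (inside ∷_) S∈) (∈-map⁻ (outside ∷_) S∈′) }
  where
  disjoint : ∀ {S : Subset (suc n)} → ∃ (λ p → p ∈ˡ allSubsets n × S ≡ inside ∷ p) →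
             ¬ ∃ (λ p → p ∈ˡ allSubsets n × S ≡ outside ∷ p)
  disjoint (_ , _ , refl) (_ , _ , ())

∈-subsetsOfSize⁺ : ∀ {n r} {S : Subset n} → ∣ S ∣ ≡ r → S ∈ˡ subsetsOfSize n r
∈-subsetsOfSize⁺ {n} {r} ∣S∣≡r = ∈-filter⁺ (λ S → ∣ S ∣ ℕ.≟ r) (∈-allSubsets _) ∣S∣≡r

∈-subsetsOfSize⁻ : ∀ {n r} {S : Subset n} → S ∈ˡ subsetsOfSize n r → ∣ S ∣ ≡ r
∈-subsetsOfSize⁻ {n} {r} S∈ = proj₂ (∈-filter⁻ (λ S → ∣ S ∣ ℕ.≟ r) {xs = allSubsets n} S∈)

∈-fromList⁺ : ∀ {r n} {es : List (Subset n)} {S} → S ∈ˡ es → ∣ S ∣ ≡ r → S ∈ˡ edges (fromList {r} es)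
∈-fromList⁺ {r} S∈ ∣S∣≡r = ∈-filter⁺ (λ S → ∣ S ∣ ℕ.≟ r) S∈ ∣S∣≡r

∈-fromList⁻ : ∀ {r n} {es : List (Subset n)} {S} → S ∈ˡ edges (fromList {r} es) → S ∈ˡ es × ∣ S ∣ ≡ r
∈-fromList⁻ {r} {es = es} S∈ = ∈-filter⁻ (λ S → ∣ S ∣ ℕ.≟ r) {xs = es} S∈

filter∈powerset : ∀ {A : Set} {P : A → Set} (P? : ∀ x → Dec (P x)) xs → filter P? xs ∈ˡ powerset xs
filter∈powerset P? []       = here refl
filter∈powerset P? (x ∷ xs) with P? x
... | yes _ = ∈-++⁺ʳ (powerset xs) (∈-map⁺ (x ∷_) (filter∈powerset P? xs))
... | no  _ = ∈-++⁺ˡ (filter∈powerset P? xs)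

-- Each e-set is listed by e ! tuples. A tuple with a repetition or with an entry in `T` contributes
-- nothing, as its union with `T` has fewer than r elements and `H` is uniform.
tuples-deg : ∀ {r n} (H : Graph r n) T e → ∣ T ∣ + e ≡ r →
             ∑ (tuples n e) (λ s → 𝟙 (set s ∪ T ∈? edges H)) ≡ e ! * deg H T
tuples-deg {r} {n} H T e ∣T∣+e≡r = sym (begin
  e ! * deg H T
    ≡⟨ cong (λ d → e ! * length (filter (λ S → S ∪ T ∈? edges H) (subsetsOfSize n d))) r∸∣T∣≡e ⟩
  e ! * length (filter (λ S → S ∪ T ∈? edges H) Ss)
    ≡⟨ trans (cong (e ! *_) (length-filter (λ S → S ∪ T ∈? edges H) Ss)) (∑-*ˡ (e !) Ss _) ⟩
  ∑ Ss (λ S → e ! * 𝟙 (S ∪ T ∈? edges H))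
    ≡⟨ ∑-cong-∈ Ss (λ {S} S∈ → trans (ℕ.*-comm (e !) _)
         (trans (cong (𝟙 (S ∪ T ∈? edges H) *_) (sym (tuples-of-set e S (∈-subsetsOfSize⁻ S∈)))) (∑-*ˡ (𝟙 (S ∪ T ∈? edges H)) (tuples n e) _))) ⟩
  ∑ Ss (λ S → ∑ (tuples n e) λ s → 𝟙 (S ∪ T ∈? edges H) * 𝟙 (set s ≟ˢ S))
    ≡⟨ ∑-comm Ss (tuples n e) _ ⟩
  ∑ (tuples n e) (λ s → ∑ Ss λ S → 𝟙 (S ∪ T ∈? edges H) * 𝟙 (set s ≟ˢ S))
    ≡⟨ ∑-cong-∈ (tuples n e) each ⟩
  ∑ (tuples n e) (λ s → 𝟙 (set s ∪ T ∈? edges H)) ∎)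
  where
  open ≡-Reasoning
  Ss : List (Subset n)
  Ss = subsetsOfSize n e
  r∸∣T∣≡e : r ∸ ∣ T ∣ ≡ e
  r∸∣T∣≡e = trans (cong (_∸ ∣ T ∣) (sym ∣T∣+e≡r)) (ℕ.m+n∸m≡n ∣ T ∣ e)
  each : ∀ {s} → s ∈ˡ tuples n e →
         ∑ Ss (λ S → 𝟙 (S ∪ T ∈? edges H) * 𝟙 (set s ≟ˢ S)) ≡ 𝟙 (set s ∪ T ∈? edges H)
  each {s} s∈ = trans (∑-cong Ss transport) (trans (sym (∑-*ˡ (𝟙 (set s ∪ T ∈? edges H)) Ss _)) count)
    where
    transport : ∀ S → 𝟙 (S ∪ T ∈? edges H) * 𝟙 (set s ≟ˢ S) ≡ 𝟙 (set s ∪ T ∈? edges H) * 𝟙 (set s ≟ˢ S)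
    transport S with set s ≟ˢ S
    ... | yes refl = refl
    ... | no  _    = trans (ℕ.*-zeroʳ (𝟙 (S ∪ T ∈? edges H))) (sym (ℕ.*-zeroʳ (𝟙 (set s ∪ T ∈? edges H))))
    count : 𝟙 (set s ∪ T ∈? edges H) * ∑ Ss (λ S → 𝟙 (set s ≟ˢ S)) ≡ 𝟙 (set s ∪ T ∈? edges H)
    count with set s ∪ T ∈? edges H
    ... | no  _  = refl
    ... | yes ∈E = trans (ℕ.*-identityˡ _) (ℕ.≤-antisym
      (∑-𝟙≤1 (set s ≟ˢ_) (Unique.filter⁺ (λ S → ∣ S ∣ ℕ.≟ e) (allSubsets-unique n)) λ p p′ → trans (sym p) p′)
      (ℕ.≤-trans (ℕ.≤-reflexive (sym (𝟙-yes (set s ≟ˢ set s) refl))) (∑-∈ (λ S → 𝟙 (set s ≟ˢ S)) (∈-subsetsOfSize⁺ ∣s∣≡e))))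
      where
      ∣s∣≡e : ∣ set s ∣ ≡ e
      ∣s∣≡e = ℕ.≤-antisym (ℕ.≤-trans (∣set∣≤length s) (ℕ.≤-reflexive (length-tuples s∈)))
        (ℕ.+-cancelʳ-≤ ∣ T ∣ e (∣ set s ∣) (ℕ.≤-trans (ℕ.≤-reflexive (trans (ℕ.+-comm e ∣ T ∣)
          (trans ∣T∣+e≡r (sym (All.lookup (uniform H) ∈E))))) (∣p∪q∣≤∣p∣+∣q∣ (set s) T)))

-- Extrema of lists, binomial coefficients and Bernoulli's inequality.

minimum-≤ : ∀ {x} xs → x ∈ˡ xs → minimum xs ≤ x
minimum-≤ (y ∷ xs) x∈ = foldr-≤ xs x∈
  where
  foldr-≤ : ∀ {x} xs → x ∈ˡ y ∷ xs → foldr _⊓_ y xs ≤ x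
  foldr-≤ []       (here refl)         = ℕ.≤-refl
  foldr-≤ (z ∷ xs) (here refl)         = ℕ.≤-trans (ℕ.m⊓n≤n z _) (foldr-≤ xs (here refl))
  foldr-≤ (z ∷ xs) (there (here refl)) = ℕ.m⊓n≤m z _
  foldr-≤ (z ∷ xs) (there (there x∈))  = ℕ.≤-trans (ℕ.m⊓n≤n z _) (foldr-≤ xs (there x∈))

minimum-∈ : ∀ {x} xs → x ∈ˡ xs → minimum xs ∈ˡ xs
minimum-∈ (y ∷ xs) _ = foldr-∈ xs
  where
  foldr-∈ : ∀ xs → foldr _⊓_ y xs ∈ˡ y ∷ xs
  foldr-∈ []       = here refl
  foldr-∈ (z ∷ xs) with ℕ.⊓-sel z (foldr _⊓_ y xs) | foldr-∈ xs
  ... | inj₁ eq | _        = there (here eq)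
  ... | inj₂ eq | here eq′ = here (trans eq eq′)
  ... | inj₂ eq | there ∈  = there (there (subst (_∈ˡ xs) (sym eq) ∈))

≤-maximum : ∀ {x} xs → x ∈ˡ xs → x ≤ maximum xs
≤-maximum (y ∷ xs) (here refl) = ℕ.m≤m⊔n y _
≤-maximum (y ∷ xs) (there x∈)  = ℕ.≤-trans (≤-maximum xs x∈) (ℕ.m≤n⊔m y _)

maximum-∈ : ∀ xs → 0 < maximum xs → maximum xs ∈ˡ xs
maximum-∈ (y ∷ xs) 0< with ℕ.⊔-sel y (maximum xs)
... | inj₁ eq = here eq
... | inj₂ eq = there (subst (_∈ˡ xs) (sym eq) (maximum-∈ xs (subst (0 <_) eq 0<)))

absorption : ∀ n k → suc k * (suc n C suc k) ≡ suc n * (n C k)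
absorption zero zero = refl
absorption zero (suc k) = trans (cong (suc (suc k) *_) (k>n⇒nCk≡0 {1} {suc (suc k)} (s≤s (s≤s z≤n))))
  (trans (ℕ.*-zeroʳ (suc (suc k))) (sym (trans (ℕ.*-identityˡ _) (k>n⇒nCk≡0 {0} {suc k} (s≤s z≤n)))))
absorption (suc n) zero = trans (ℕ.*-identityˡ _) (trans (nC1≡n (suc (suc n))) (sym (ℕ.*-identityʳ (suc (suc n)))))
absorption (suc n) (suc k) = begin
  suc (suc k) * (suc (suc n) C suc (suc k))
    ≡⟨ cong (suc (suc k) *_) (nCk+nC[k+1]≡[n+1]C[k+1] (suc n) (suc k)) ⟨
  suc (suc k) * (suc n C suc k + suc n C suc (suc k))
    ≡⟨ ℕ.*-distribˡ-+ (suc (suc k)) (suc n C suc k) _ ⟩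
  suc (suc k) * (suc n C suc k) + suc (suc k) * (suc n C suc (suc k))
    ≡⟨ cong₂ (λ a b → suc n C suc k + a + b) (absorption n k) (absorption n (suc k)) ⟩
  suc n C suc k + suc n * (n C k) + suc n * (n C suc k)
    ≡⟨ trans (ℕ.+-assoc (suc n C suc k) _ _) (cong (suc n C suc k +_)
         (trans (sym (ℕ.*-distribˡ-+ (suc n) (n C k) _)) (cong (suc n *_) (nCk+nC[k+1]≡[n+1]C[k+1] n k)))) ⟩
  suc (suc n) * (suc n C suc k) ∎
  where open ≡-Reasoning

k!*nCk≤n^k : ∀ n k → k ! * (n C k) ≤ n ^ k
k!*nCk≤n^k n zero = ℕ.≤-reflexive (trans (ℕ.*-identityˡ (n C 0)) refl)
k!*nCk≤n^k zero (suc k) = ℕ.≤-trans (ℕ.≤-reflexive (trans (cong (suc k ! *_) (k>n⇒nCk≡0 {0} {suc k} (s≤s z≤n))) (ℕ.*-zeroʳ (suc k !)))) z≤n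
k!*nCk≤n^k (suc n) (suc k) = begin
  suc k * k ! * (suc n C suc k)    ≡⟨ left-comm (suc k) (k !) _ ⟩
  k ! * (suc k * (suc n C suc k))  ≡⟨ cong (k ! *_) (absorption n k) ⟩
  k ! * (suc n * (n C k))          ≡⟨ left-comm′ (k !) (suc n) _ ⟩
  suc n * (k ! * (n C k))          ≤⟨ ℕ.*-monoʳ-≤ (suc n) (ℕ.≤-trans (k!*nCk≤n^k n k) (ℕ.^-monoˡ-≤ k (ℕ.n≤1+n n))) ⟩
  suc n ^ suc k                    ∎
  where
  open ℕ.≤-Reasoning
  left-comm : ∀ a b c → a * b * c ≡ b * (a * c)
  left-comm = solve-∀
  left-comm′ : ∀ a b c → a * (b * c) ≡ b * (a * c)
  left-comm′ = solve-∀

[n∸k]^k≤k!*nCk : ∀ n k → (n ∸ k) ^ k ≤ k ! * (n C k)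
[n∸k]^k≤k!*nCk n zero = ℕ.≤-refl
[n∸k]^k≤k!*nCk zero (suc k) = z≤n
[n∸k]^k≤k!*nCk (suc n) (suc k) = begin
  (n ∸ k) * (n ∸ k) ^ k            ≤⟨ ℕ.*-mono-≤ (ℕ.≤-trans (ℕ.m∸n≤m n k) (ℕ.n≤1+n n)) ([n∸k]^k≤k!*nCk n k) ⟩
  suc n * (k ! * (n C k))          ≡⟨ left-comm′ (k !) (suc n) _ ⟨
  k ! * (suc n * (n C k))          ≡⟨ cong (k ! *_) (absorption n k) ⟨
  k ! * (suc k * (suc n C suc k))  ≡⟨ left-comm (suc k) (k !) _ ⟨
  suc k * k ! * (suc n C suc k)    ∎
  where
  open ℕ.≤-Reasoning
  left-comm : ∀ a b c → a * b * c ≡ b * (a * c)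
  left-comm = solve-∀
  left-comm′ : ∀ a b c → a * (b * c) ≡ b * (a * c)
  left-comm′ = solve-∀

-- (1 - c/n) + (1 - d/n) - 1 ≤ (1 - c/n)(1 - d/n) without denominators.
∸-superadditive : ∀ n c d → n * (n ∸ (c + d)) ≤ (n ∸ c) * (n ∸ d)
∸-superadditive n c d with c + d ≤? n
... | no  c+d≰n = ℕ.≤-trans (ℕ.≤-reflexive (trans (cong (n *_) (ℕ.m≤n⇒m∸n≡0 (ℕ.<⇒≤ (ℕ.≰⇒> c+d≰n)))) (ℕ.*-zeroʳ n))) z≤n
... | yes c+d≤n = begin
  n * y                          ≡⟨ cong (_* y) (sym n≡) ⟩
  (c + d + y) * y                ≤⟨ ℕ.m≤m+n _ (d * c) ⟩
  (c + d + y) * y + d * c        ≡⟨ factor c d y ⟩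
  (d + y) * (c + y)              ≡⟨ cong₂ _*_ (ℕ.m+n∸m≡n c (d + y)) (ℕ.m+n∸m≡n d (c + y)) ⟨
  (c + (d + y) ∸ c) * (d + (c + y) ∸ d) ≡⟨ cong₂ (λ a b → (a ∸ c) * (b ∸ d)) (trans (sym (ℕ.+-assoc c d y)) n≡) (trans (reassoc c d y) n≡) ⟩
  (n ∸ c) * (n ∸ d)              ∎
  where
  open ℕ.≤-Reasoning
  y : ℕ
  y = n ∸ (c + d)
  n≡ : c + d + y ≡ n
  n≡ = ℕ.m+[n∸m]≡n c+d≤n
  factor : ∀ c d y → (c + d + y) * y + d * c ≡ (d + y) * (c + y)
  factor = solve-∀
  reassoc : ∀ c d y → d + (c + y) ≡ c + d + y
  reassoc = solve-∀

-- This is 1 - kc/n ≤ (1 - c/n)^k multiplied by n ^ (k + 1); where the left side would be negative,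
-- truncated subtraction makes it 0.
bernoulli : ∀ n c k → n ^ k * (n ∸ k * c) ≤ (n ∸ c) ^ k * n
bernoulli n c zero    = ℕ.≤-refl
bernoulli n c (suc k) = begin
  n * n ^ k * (n ∸ (c + k * c))      ≡⟨ left-comm n (n ^ k) _ ⟩
  n ^ k * (n * (n ∸ (c + k * c)))    ≤⟨ ℕ.*-monoʳ-≤ (n ^ k) (∸-superadditive n c (k * c)) ⟩
  n ^ k * ((n ∸ c) * (n ∸ k * c))    ≡⟨ left-comm′ (n ^ k) (n ∸ c) _ ⟩
  (n ∸ c) * (n ^ k * (n ∸ k * c))    ≤⟨ ℕ.*-monoʳ-≤ (n ∸ c) (bernoulli n c k) ⟩
  (n ∸ c) * ((n ∸ c) ^ k * n)        ≡⟨ ℕ.*-assoc (n ∸ c) _ n ⟨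
  (n ∸ c) ^ suc k * n                ∎
  where
  open ℕ.≤-Reasoning
  left-comm : ∀ a b c → a * b * c ≡ b * (a * c)
  left-comm = solve-∀
  left-comm′ : ∀ a b c → a * (b * c) ≡ b * (a * c)
  left-comm′ = solve-∀

-- Vertex vectors and the edges of a clique.

extend : ∀ {n} (S : Subset n) r → ∣ S ∣ ≤ r → r ≤ n → ∃ λ S′ → S Subset.⊆ S′ × ∣ S′ ∣ ≡ r
extend []            zero    _  _  = [] , id , refl
extend (inside ∷ S)  (suc r) S≤ r≤ with extend S r (ℕ.s≤s⁻¹ S≤) (ℕ.s≤s⁻¹ r≤)
... | S′ , S⊆ , eq = inside ∷ S′ , Subset.s⊆s S⊆ , cong suc eq
extend {suc n} (outside ∷ S) r S≤ r≤ with r ≤? n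
... | no  r≰n = Subset.⊤ , (λ _ → Subset.∈⊤) , trans (Subset.∣⊤∣≡n (suc n)) (ℕ.≤-antisym (ℕ.≰⇒> r≰n) r≤)
... | yes r≤n with extend S r S≤ r≤n
...   | S′ , S⊆ , eq = outside ∷ S′ , Subset.s⊆s S⊆ , eq

AllPairs-cross : ∀ {A : Set} {R : A → A → Set} xs {ys} → AllPairs R (xs ++ ys) → All (λ x → All (R x) ys) xs
AllPairs-cross []       _              = []
AllPairs-cross (x ∷ xs) (x~ ∷ xs~) = All.++⁻ʳ xs x~ ∷ AllPairs-cross xs xs~

toVec : ∀ {A : Set} {n} (xs : List A) → length xs ≡ n → ∃ λ (v : Vec A n) → toList v ≡ xs
toVec xs refl = Vec.fromList xs , Vec.toList∘fromList xs

lookup-∈ : ∀ {A : Set} {n} (v : Vec A n) i → lookup v i ∈ˡ toList v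
lookup-∈ (x ∷ v) zero    = here refl
lookup-∈ (x ∷ v) (suc i) = there (lookup-∈ v i)

∈-lookup : ∀ {A : Set} {n} (v : Vec A n) {x} → x ∈ˡ toList v → ∃ λ i → lookup v i ≡ x
∈-lookup (x ∷ v) (here refl) = zero , refl
∈-lookup (x ∷ v) (there x∈) with ∈-lookup v x∈
... | i , eq = suc i , eq

lookup-increasing : ∀ {k n} (v : Vec (Fin n) k) → Increasing (toList v) → ∀ {i j} → i Fin.< j → lookup v i Fin.< lookup v j
lookup-increasing (x ∷ v) (x< ∷ v↗) {zero}  {suc j} _   = All.lookup x< (lookup-∈ v j)
lookup-increasing (x ∷ v) (x< ∷ v↗) {suc i} {suc j} i<j = lookup-increasing v v↗ (ℕ.s≤s⁻¹ i<j)

lookup-unique : ∀ {A : Set} {n} (v : Vec A n) → (∀ i j → lookup v i ≡ lookup v j → i ≡ j) → Unique (toList v)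
lookup-unique []      _   = []
lookup-unique (x ∷ v) inj = All.tabulate (λ y∈ x≡y → let i , eq = ∈-lookup v y∈ in
  contradiction (inj zero (suc i) (trans x≡y (sym eq))) λ ()) ∷ lookup-unique v λ i j → Fin.suc-injective ∘ inj (suc i) (suc j)

Unique-map-injective : ∀ {A B : Set} (f : A → B) {xs x y} → Unique (map f xs) → x ∈ˡ xs → y ∈ˡ xs → f x ≡ f y → x ≡ y
Unique-map-injective f {xs} f! x∈ y∈ eq with ∈-AllPairs₂ (AllPairs.map⁻ {f = f} {xs = xs} f!) x∈ y∈
... | inj₁ x≡y         = x≡y
... | inj₂ (inj₁ fx≢fy) = contradiction eq fx≢fy
... | inj₂ (inj₂ fy≢fx) = contradiction (sym eq) fy≢fx

image-set : ∀ {k n} (φ : Vec (Fin n) k) S → image φ S ≡ set (map (lookup φ) (elements S))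
image-set φ S = cong ⋃ (List.map-∘ (elements S))

preimages : ∀ {k n} (φ : Vec (Fin n) k) xs → All (_∈ˡ toList φ) xs → ∃ λ js → map (lookup φ) js ≡ xs
preimages φ []       []         = [] , refl
preimages φ (x ∷ xs) (x∈ ∷ xs∈) with ∈-lookup φ x∈ | preimages φ xs xs∈
... | i , refl | js , refl = i ∷ js , refl

∈-K : ∀ {t r} {S : Subset t} → ∣ S ∣ ≡ r → S ∈ˡ edges (K t r)
∈-K = ∈-fromList⁺ (∈-allSubsets _)

clique-edge : ∀ {k t n} {H : Graph k n} (φ : Vec (Fin n) t) → IsCopy H (K t k) φ →
              ∀ xs → Unique xs → length xs ≡ k → All (_∈ˡ toList φ) xs → set xs ∈ˡ edges H
clique-edge {H = H} φ (_ , copy) xs xs! len xs∈ with preimages φ xs xs∈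
... | js , refl = subst (_∈ˡ edges H) image≡ (All.lookup copy (∈-K
    (trans (∣set∣≡length js!) (trans (sym (List.length-map (lookup φ) js)) len))))
  where
  js! : Unique js
  js! = AllPairs.map (λ φi≢φj i≡j → φi≢φj (cong (lookup φ) i≡j)) (AllPairs.map⁻ {f = lookup φ} {xs = js} xs!)
  image≡ : image φ (set js) ≡ set (map (lookup φ) js)
  image≡ = trans (image-set φ (set js)) (set-cong to from)
    where
    to : ∀ {x} → x ∈ˡ map (lookup φ) (elements (set js)) → x ∈ˡ map (lookup φ) js
    to x∈ with ∈-map⁻ (lookup φ) x∈
    ... | i , i∈ , refl = ∈-map⁺ (lookup φ) (∈-set⁻ js (∈-elements⁻ i∈))
    from : ∀ {x} → x ∈ˡ map (lookup φ) js → x ∈ˡ map (lookup φ) (elements (set js))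
    from x∈ with ∈-map⁻ (lookup φ) x∈
    ... | i , i∈ , refl = ∈-map⁺ (lookup φ) (∈-elements⁺ (∈-set⁺ i∈))

-- Lifting a graph on the colours to one on the vertices.

Unique-↭ : ∀ {n} {xs ys : List (Fin n)} → xs ↭ ys → Unique xs → Unique ys
Unique-↭ {ys = ys} p xs! = ∣set∣≡length⇒Unique ys
  (trans (cong ∣_∣ (sym (set-↭ p))) (trans (∣set∣≡length xs!) (Perm.↭-length p)))

insertAll-increasing : ∀ {n} (xs zs : List (Fin n)) → Unique (xs ++ zs) → Increasing zs → Increasing (insertAll xs zs)
insertAll-increasing []       zs _          zs↗ = zs↗
insertAll-increasing (x ∷ xs) zs (x∉ ∷ xs!) zs↗ = insertAll-increasing xs (insert x zs)
  (Unique-↭ (Perm.trans (Perm.↭-sym (Perm.shift x xs zs)) (Perm.++⁺ˡ xs (Perm.↭-sym (insert-↭ x zs)))) (x∉ ∷ xs!))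
  (insert-increasing (All.++⁻ʳ xs x∉) zs↗)

-- ℓ = suc a
module Lift {N m u : ℕ} {{_ : NonZero m}} (χ : Colouring N m u) (a e : ℕ) (G : Graph (e + 1) m) where
  open Colouring χ

  n k : ℕ
  n = N * O
  k = suc a + e

  -- The initial value for adding up keys. Any key would do, since `expect-bound` holds for every
  -- `y`.
  y₀ : Fin M
  y₀ = fromℕ< (ℕ.>-nonZero⁻¹ M {{M≢0}})

  E : List (Fin m) → Set
  E cs = set cs ∈ˡ edges G

  E? : ∀ cs → Dec (E cs)
  E? cs = set cs ∈? edges G

  E-↭ : ∀ {cs ds} → cs ↭ ds → E cs → E ds
  E-↭ p = subst (_∈ˡ edges G) (set-↭ p)

  isEdge : Subset n → Set
  isEdge S = Good χ E? E-↭ a y₀ (elements S)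

  isEdge? : ∀ S → Dec (isEdge S)
  isEdge? S = good? χ E? E-↭ a y₀ (elements S)

  H : Graph k n
  H = fromList {k} (filter isEdge? (subsetsOfSize n k))

  ∈-H⁺ : ∀ {zs} → Increasing zs → length zs ≡ k → Good χ E? E-↭ a y₀ zs → set zs ∈ˡ edges H
  ∈-H⁺ {zs} zs↗ len good = ∈-fromList⁺ (∈-filter⁺ isEdge? (∈-subsetsOfSize⁺ ∣zs∣≡k)
    (subst (Good χ E? E-↭ a y₀) (sym (elements-set zs↗)) good)) ∣zs∣≡k
    where
    ∣zs∣≡k : ∣ set zs ∣ ≡ k
    ∣zs∣≡k = trans (∣set∣≡length (Increasing⇒Unique zs↗)) len

  ∈-H⁻ : ∀ {zs} → Increasing zs → set zs ∈ˡ edges H → Good χ E? E-↭ a y₀ zs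
  ∈-H⁻ {zs} zs↗ zs∈ = subst (Good χ E? E-↭ a y₀) (elements-set zs↗)
    (proj₂ (∈-filter⁻ isEdge? {xs = subsetsOfSize n k} (proj₁ (∈-fromList⁻ zs∈))))

  combinedKey : Fin M → List (Fin n) → Fin M
  combinedKey y []       = y
  combinedKey y (z ∷ zs) = combinedKey (key z ⊕ y) zs

  Good-++ : ∀ y xs zs → Good χ E? E-↭ (length xs) y (xs ++ zs) → E (map (col (combinedKey y xs)) zs)
  Good-++ y []       zs good = good
  Good-++ y (x ∷ xs) zs good = Good-++ (key x ⊕ y) xs zs good

  module _ {w : ℕ} (1≤e : 1 ≤ e) (e≤w : e ≤ w) where

    lift-free : Contains H (K (suc a + w) k) → Contains G (K (w + 1) (e + 1))
    lift-free (φ , copy) = ψ , ψ-injective , All.tabulate λ {S} S∈ →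
      subst (_∈ˡ edges G) (sym (image-set ψ S)) (ψ-edge S (All.lookup (uniform (K (w + 1) (e + 1))) S∈))
      where
      us xs zs : List (Fin n)
      us = insertAll (toList φ) []
      xs = take a us
      zs = drop a us
      us↭ : us ↭ toList φ
      us↭ = subst (us ↭_) (List.++-identityʳ (toList φ)) (insertAll-↭ (toList φ) [])
      us↗ : Increasing us
      us↗ = insertAll-increasing (toList φ) [] (subst Unique (sym (List.++-identityʳ (toList φ))) (lookup-unique φ (proj₁ copy))) []
      us-length : length us ≡ suc a + w
      us-length = trans (Perm.↭-length us↭) (Vec.length-toList φ)
      xs-length : length xs ≡ a
      xs-length = trans (List.length-take a us) (ℕ.m≤n⇒m⊓n≡m (subst (a ≤_) (sym us-length) (ℕ.≤-trans (ℕ.n≤1+n a) (ℕ.m≤m+n (suc a) w))))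
      zs-length : length zs ≡ w + 1
      zs-length = trans (List.length-drop a us) (trans (cong (_∸ a) (trans us-length (sym (ℕ.+-suc a w))))
        (trans (ℕ.m+n∸m≡n a (suc w)) (ℕ.+-comm 1 w)))
      us≡ : xs ++ zs ≡ us
      us≡ = List.take++drop≡id a us
      v : Vec (Fin n) (w + 1)
      v = proj₁ (toVec zs zs-length)
      v≡ : toList v ≡ zs
      v≡ = proj₂ (toVec zs zs-length)
      y : Fin M
      y = combinedKey y₀ xs
      ψ : Vec (Fin m) (w + 1)
      ψ = Vec.map (col y) v
      ψ-edge : ∀ S → ∣ S ∣ ≡ e + 1 → E (map (lookup ψ) (elements S))
      ψ-edge S ∣S∣≡ = subst E (trans (sym (List.map-∘ (elements S))) (List.map-cong (λ i → sym (Vec.lookup-map i (col y) v)) (elements S)))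
        (Good-++ y₀ xs vs (subst (λ a → Good χ E? E-↭ a y₀ (xs ++ vs)) (sym xs-length)
          (∈-H⁻ xsvs↗ (clique-edge {H = H} φ copy (xs ++ vs) (Increasing⇒Unique xsvs↗) len xsvs∈))))
        where
        vs : List (Fin n)
        vs = map (lookup v) (elements S)
        vs∈zs : ∀ {z} → z ∈ˡ vs → z ∈ˡ zs
        vs∈zs z∈ with ∈-map⁻ (lookup v) z∈
        ... | i , _ , refl = subst (lookup v i ∈ˡ_) v≡ (lookup-∈ v i)
        vs↗ : Increasing vs
        vs↗ = AllPairs.map⁺ (AllPairs.map (lookup-increasing v (subst Increasing (sym v≡) (AllPairs.drop⁺ a us↗))) (elements-increasing S))
        xsvs↗ : Increasing (xs ++ vs)
        xsvs↗ = AllPairs.++⁺ (AllPairs.take⁺ a us↗) vs↗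
          (All.map (λ x< → All.tabulate (All.lookup x< ∘ vs∈zs)) (AllPairs-cross xs (subst Increasing (sym us≡) us↗)))
        len : length (xs ++ vs) ≡ k
        len = trans (List.length-++ xs) (trans (cong₂ _+_ xs-length (trans (List.length-map (lookup v) (elements S))
          (trans (length-elements S) (trans ∣S∣≡ (ℕ.+-comm e 1))))) (ℕ.+-suc a e))
        xsvs∈ : All (_∈ˡ toList φ) (xs ++ vs)
        xsvs∈ = All.tabulate λ z∈ → Perm.∈-resp-↭ us↭ (subst (_ ∈ˡ_) us≡ (xs++vs⊆ z∈))
          where
          xs++vs⊆ : ∀ {z} → z ∈ˡ xs ++ vs → z ∈ˡ xs ++ zs
          xs++vs⊆ z∈ with ∈-++⁻ xs z∈
          ... | inj₁ z∈xs = ∈-++⁺ˡ z∈xs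
          ... | inj₂ z∈vs = ∈-++⁺ʳ xs (vs∈zs z∈vs)
      -- Distinct vertices get distinct colours because any two of them lie in a common (e + 1)-set,
      -- whose colours form an edge of `G` and so are e + 1 different ones. This uses 2 ≤ e + 1 ≤ w
      -- + 1.
      ψ-injective : ∀ i j → lookup ψ i ≡ lookup ψ j → i ≡ j
      ψ-injective i j eq with extend (set (i ∷ j ∷ [])) (e + 1)
        (ℕ.≤-trans (∣set∣≤length (i ∷ j ∷ [])) (ℕ.+-monoˡ-≤ 1 1≤e)) (ℕ.+-monoˡ-≤ 1 e≤w)
      ... | S , ij⊆S , ∣S∣≡ = Unique-map-injective (lookup ψ)
        (∣set∣≡length⇒Unique _ (trans (All.lookup (uniform G) (ψ-edge S ∣S∣≡))
          (sym (trans (List.length-map (lookup ψ) (elements S)) (trans (length-elements S) ∣S∣≡)))))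
        (∈-elements⁺ (ij⊆S (∈-set⁺ {xs = i ∷ j ∷ []} (here refl))))
        (∈-elements⁺ (ij⊆S (∈-set⁺ {xs = i ∷ j ∷ []} (there (here refl))))) eq

  -- Starting from `T` as a list of fixed slots, `tuples-expect` inserts the e other vertices as
  -- free slots, and `expect-bound` estimates every resulting slot list. The weight `u * m ^ e` is
  -- put into `F` because that estimate is one of unnormalised counts.
  deg-bound : ∀ {Γ} → (∀ c → Γ ≤ ∑ (tuples m e) λ cs → 𝟙 (E? (c ∷ cs))) →
              ∀ T → ∣ T ∣ ≡ suc a →
              (N ∸ (suc a + e)) ^ e * ((u ∸ suc a * suc a) * Γ * O ^ e) ≤ u * m ^ e * (e ! * deg H T)
  deg-bound {Γ} Γ≤ T ∣T∣≡ = begin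
    (N ∸ (suc a + e)) ^ e * κ
      ≤⟨ tuples-expect χ xs e 0 F (map fix xs) (ℕ.≤-reflexive (cong (_+ e) (trans (cong length (fixed-fix xs)) xs-length)))
           (fixed-fix xs) (free-fix xs) (λ zs∈ → subst Increasing (sym (completions-fix xs zs∈)) (elements-increasing T)) κ≤ ⟩
    ∑ (tuples n e) (λ s → expect χ (map fix xs) (λ zs → F (insertAll s zs)))
      ≡⟨ ∑-cong (tuples n e) (λ s → trans (expect-all-fix xs (λ zs → F (insertAll s zs)))
           (cong (λ S → u * m ^ e * 𝟙 (S ∈? edges H)) (trans (set-↭ (insertAll-↭ s xs))
             (trans (set-++ s xs) (cong (set s ∪_) (set-elements T)))))) ⟩
    ∑ (tuples n e) (λ s → u * m ^ e * 𝟙 (set s ∪ T ∈? edges H))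
      ≡⟨ ∑-*ˡ (u * m ^ e) (tuples n e) _ ⟨
    u * m ^ e * ∑ (tuples n e) (λ s → 𝟙 (set s ∪ T ∈? edges H))
      ≡⟨ cong (u * m ^ e *_) (tuples-deg H T e (cong (_+ e) ∣T∣≡)) ⟩
    u * m ^ e * (e ! * deg H T) ∎
    where
    open ℕ.≤-Reasoning
    κ : ℕ
    κ = (u ∸ suc a * suc a) * Γ * O ^ e
    xs : List (Fin n)
    xs = elements T
    xs-length : length xs ≡ suc a
    xs-length = trans (length-elements T) ∣T∣≡
    F : List (Fin n) → ℕ
    F zs = u * m ^ e * 𝟙 (set zs ∈? edges H)
    fixed-fix : ∀ xs → fixed χ (map fix xs) ≡ xs
    fixed-fix []       = refl
    fixed-fix (x ∷ xs) = cong (x ∷_) (fixed-fix xs)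
    free-fix : ∀ xs → #free χ (map fix xs) ≡ 0
    free-fix []       = refl
    free-fix (x ∷ xs) = free-fix xs
    completions-fix : ∀ xs {zs} → zs ∈ˡ completions χ (map fix xs) → zs ≡ xs
    completions-fix []       (here refl) = refl
    completions-fix (x ∷ xs) zs∈ with ∈-choices⁻ (x ∷ []) (map (options χ) (map fix xs)) zs∈
    ... | _ , ys , here refl , ys∈ , refl = cong (x ∷_) (completions-fix xs ys∈)
    expect-all-fix : ∀ xs F → expect χ (map fix xs) F ≡ F xs
    expect-all-fix []       F = ℕ.+-identityʳ _
    expect-all-fix (x ∷ xs) F = trans (expect-fix χ x (map fix xs) F) (expect-all-fix xs (F ∘ (x ∷_)))
    length-completions : ∀ τ {zs} → zs ∈ˡ completions χ τ → length zs ≡ length τ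
    length-completions []      (here refl) = refl
    length-completions (t ∷ τ) zs∈ with ∈-choices⁻ (options χ t) (map (options χ) τ) zs∈
    ... | _ , ys , _ , ys∈ , refl = cong suc (length-completions τ ys∈)
    κ≤ : ∀ τ → fixed χ τ ≡ xs → #free χ τ ≡ e → (∀ {zs} → zs ∈ˡ completions χ τ → Increasing zs) → κ ≤ expect χ τ F
    κ≤ τ fix≡ free≡ τ↗ = begin
      κ
        ≤⟨ expect-bound χ E? E-↭ {ℓ = suc a} Γ≤ a τ y₀ fix-length free≡
             (subst Unique (sym fix≡) (Increasing⇒Unique (elements-increasing T))) ℕ.≤-refl ⟩
      u * m ^ e * expectGood χ E? E-↭ a τ y₀
        ≤⟨ ℕ.*-monoʳ-≤ (u * m ^ e) (∑-mono-∈ (completions χ τ) λ {zs} zs∈ → 𝟙-mono (good? χ E? E-↭ a y₀ zs) (set zs ∈? edges H)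
             (∈-H⁺ (τ↗ zs∈) (trans (length-completions τ zs∈) (trans (length-slots χ τ) (cong₂ _+_ fix-length free≡))))) ⟩
      u * m ^ e * expect χ τ (λ zs → 𝟙 (set zs ∈? edges H))
        ≡⟨ ∑-*ˡ (u * m ^ e) (completions χ τ) _ ⟩
      expect χ τ F ∎
      where
      fix-length : length (fixed χ τ) ≡ suc a
      fix-length = trans (cong length fix≡) xs-length

-- Comparing rationals with ratios of natural numbers.

open import Data.Integer using (+_; -[1+_])

<-/⁺ : ∀ p d a c .{cop : Coprime p (suc d)} → p * suc c < a * suc d → mkℚ (+ p) d cop ℚ.< + a / suc c
<-/⁺ p d a c pc<ad = ℚ.toℚᵘ-cancel-< (ℚᵘ.<-respʳ-≃ (ℚᵘ.≃-sym (ℚ.toℚᵘ-fromℚᵘ (ℚᵘ.mkℚᵘ (+ a) c)))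
  (ℚᵘ.*<* (subst₂ ℤ._<_ (ℤ.pos-* p (suc c)) (ℤ.pos-* a (suc d)) (ℤ.+<+ pc<ad))))

<-/⁻ : ∀ p d a c .{cop : Coprime p (suc d)} → mkℚ (+ p) d cop ℚ.< + a / suc c → p * suc c < a * suc d
<-/⁻ p d a c q< with ℚᵘ.<-respʳ-≃ (ℚ.toℚᵘ-fromℚᵘ (ℚᵘ.mkℚᵘ (+ a) c)) (ℚ.toℚᵘ-mono-< q<)
... | ℚᵘ.*<* lt = ℤ.drop‿+<+ (subst₂ ℤ._<_ (sym (ℤ.pos-* p (suc c))) (sym (ℤ.pos-* a (suc d))) lt)

negative<ratio : ∀ {p d} .{cop : Coprime (suc p) (suc d)} a c → mkℚ -[1+ p ] d cop ℚ.< ratio a c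
negative<ratio a zero    = ℚ.*<* ℤ.-<+
negative<ratio {p} {d} {cop} a (suc c) = ℚ.toℚᵘ-cancel-< (ℚᵘ.<-respʳ-≃ (ℚᵘ.≃-sym (ℚ.toℚᵘ-fromℚᵘ (ℚᵘ.mkℚᵘ (+ a) c)))
  (ℚᵘ.*<* (subst (_ ℤ.<_) (ℤ.pos-* a (suc d)) ℤ.-<+)))

<-ratio⁺ : ∀ p d a c .{cop : Coprime p (suc d)} → 0 < c → p * c < a * suc d → mkℚ (+ p) d cop ℚ.< ratio a c
<-ratio⁺ p d a (suc c) {cop} _ = <-/⁺ p d a c {cop}

<-ratio⁻ : ∀ p d a c .{cop : Coprime p (suc d)} → mkℚ (+ p) d cop ℚ.< ratio a c → 0 < c × p * c < a * suc d
<-ratio⁻ p d a zero    q<0 with ℚ.drop-*<* q<0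
... | lt = contradiction (subst (ℤ._< + 0) (ℤ.*-identityʳ (+ p)) lt) λ { (ℤ.+<+ ()) }
<-ratio⁻ p d a (suc c) {cop} q< = s≤s z≤n , <-/⁻ p d a c {cop} q<

-- (1 - c/X)(P + 1) ≤ P is only possible for small X.
slack : ∀ P c X → (X ∸ c) * suc P ≤ P * X → X ≤ c * suc P
slack P c X le with c ≤? X
... | no  c≰X = ℕ.≤-trans (ℕ.<⇒≤ (ℕ.≰⇒> c≰X)) (ℕ.m≤m*n c (suc P))
... | yes c≤X = begin
  X                  ≡⟨ ℕ.m∸n+n≡m c≤X ⟨
  X ∸ c + c          ≤⟨ ℕ.+-monoˡ-≤ c (ℕ.+-cancelʳ-≤ ((X ∸ c) * P) (X ∸ c) (c * P) (begin
    X ∸ c + (X ∸ c) * P    ≡⟨ ℕ.*-suc (X ∸ c) P ⟨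
    (X ∸ c) * suc P        ≤⟨ le ⟩
    P * X                  ≡⟨ cong (P *_) (ℕ.m∸n+n≡m c≤X) ⟨
    P * (X ∸ c + c)        ≡⟨ expand P (X ∸ c) c ⟩
    c * P + (X ∸ c) * P    ∎)) ⟩
  c * P + c          ≡⟨ trans (ℕ.+-comm (c * P) c) (sym (ℕ.*-suc c P)) ⟩
  c * suc P          ∎
  where
  open ℕ.≤-Reasoning
  expand : ∀ p x c → p * (x + c) ≡ c * p + x * p
  expand = solve-∀

-- Lower bounds on extremal numbers and densities.

subset-exists : ∀ {n} r → r ≤ n → ∃ λ (S : Subset n) → ∣ S ∣ ≡ r
subset-exists {n} r r≤n with extend Subset.⊥ r (subst (_≤ r) (sym (Subset.∣⊥∣≡0 n)) z≤n) r≤n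
... | S , _ , eq = S , eq

δ-attained : ∀ {r n} ℓ (H : Graph r n) → ℓ ≤ n → ∃ λ T → ∣ T ∣ ≡ ℓ × δ ℓ H ≡ deg H T
δ-attained {n = n} ℓ H ℓ≤n with ∈-map⁻ (deg H) (minimum-∈ _ (∈-map⁺ (deg H) (∈-subsetsOfSize⁺ {S = proj₁ (subset-exists ℓ ℓ≤n)} (proj₂ (subset-exists ℓ ℓ≤n)))))
... | T , T∈ , eq = T , ∈-subsetsOfSize⁻ T∈ , eq

-- Minimum degree counted by ordered tuples with repetition allowed, since independent colours may
-- coincide. Thus Γ / m ^ e is the density that the lifted graphs approach.
TupleDegree≥ : ∀ {e m} → Graph (e + 1) m → ℕ → Set
TupleDegree≥ {e} {m} G Γ = ∀ c → Γ ≤ ∑ (tuples m e) λ cs → 𝟙 (set (c ∷ cs) ∈? edges G)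

-- The same X is the number of blocks and the parameter `u`. Demanding distinct blocks loses at most
-- the proportion e * (ℓ + e) / X of the tuples, and imperfect independence ℓ * ℓ / X;
-- `∸-superadditive` merges both into B / X.
lift-ratio : ∀ a e w {m Γ X} (G : Graph (e + 1) m) {{_ : NonZero m}} {{_ : NonZero X}} (χ : Colouring X m X) →
  1 ≤ e → e ≤ w → ¬ Contains G (K (w + 1) (e + 1)) → TupleDegree≥ G Γ → ∀ p d → p * m ^ e < Γ * d →
  (e * (suc a + e) + suc a * suc a) * suc (p * m ^ e) < X →
  ∃ λ n → X ≤ n × 0 < n C e × p * (n C e) < ex (suc a) n (K (suc a + w) (suc a + e)) * d
lift-ratio a e w {m} {Γ} {X} G {{_}} {{X≢0}} χ 1≤e e≤w G-free Γ≤ p d dense X> = n , X≤n , nCe>0 , (begin-strict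
  p * (n C e)                              <⟨ deg> (proj₁ T) (proj₁ (proj₂ T)) ⟩
  deg H (proj₁ T) * d                      ≡⟨ cong (_* d) (proj₂ (proj₂ T)) ⟨
  δ ℓ H * d                                ≤⟨ ℕ.*-monoˡ-≤ d (≤-maximum _ (∈-map⁺ (δ ℓ) H∈)) ⟩
  ex ℓ n (K (ℓ + w) (ℓ + e)) * d           ∎)
  where
  open ℕ.≤-Reasoning
  ℓ c B P : ℕ
  ℓ = suc a
  c = ℓ + e
  B = e * c + ℓ * ℓ
  P = p * m ^ e
  open Colouring χ using (O; O≢0)
  open Lift χ a e G using (n; H; isEdge?; lift-free; deg-bound)
  instance
    n≢0 : NonZero n
    n≢0 = ℕ.m*n≢0 X O {{X≢0}} {{O≢0}}
  X≤n : X ≤ n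
  X≤n = ℕ.m≤m*n X O {{O≢0}}
  B<X : B < X
  B<X = ℕ.≤-<-trans (ℕ.m≤m*n B (suc P)) X>
  ℓ≤n : ℓ ≤ n
  ℓ≤n = ℕ.≤-trans (ℕ.≤-trans (ℕ.m≤m*n ℓ ℓ) (ℕ.≤-trans (ℕ.m≤n+m (ℓ * ℓ) (e * c)) (ℕ.<⇒≤ B<X))) X≤n
  e<n : e < n
  e<n = ℕ.<-≤-trans (ℕ.≤-<-trans (ℕ.≤-trans (ℕ.m≤m*n e c) (ℕ.m≤m+n (e * c) (ℓ * ℓ))) B<X) X≤n
  nCe>0 : 0 < n C e
  nCe>0 = ℕ.n≢0⇒n>0 λ nCe≡0 → ℕ.<⇒≱ (ℕ.m^n>0 (n ∸ e) {{ℕ.>-nonZero (ℕ.m<n⇒0<n∸m e<n)}} e)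
    (ℕ.≤-trans ([n∸k]^k≤k!*nCk n e) (ℕ.≤-reflexive (trans (cong (e ! *_) nCe≡0) (ℕ.*-zeroʳ (e !)))))
  T : ∃ λ T → ∣ T ∣ ≡ ℓ × δ ℓ H ≡ deg H T
  T = δ-attained ℓ H ℓ≤n
  H∈ : H ∈ˡ filter (λ H → ¬? (contains? H (K (ℓ + w) (ℓ + e)))) (allGraphs (ℓ + e) n)
  H∈ = ∈-filter⁺ (λ H → ¬? (contains? H (K (ℓ + w) (ℓ + e))))
    (∈-map⁺ (fromList {ℓ + e}) (filter∈powerset isEdge? (subsetsOfSize n (ℓ + e)))) (G-free ∘ lift-free 1≤e e≤w)
  count : ∀ T → ∣ T ∣ ≡ ℓ → n ^ e * (X ∸ B) * Γ ≤ X * (m ^ e * (e ! * deg H T))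
  count T ∣T∣≡ = ℕ.*-cancelˡ-≤ X (begin
    X * (n ^ e * (X ∸ B) * Γ)
      ≡⟨ cong (λ z → X * (z * (X ∸ B) * Γ)) (^-distribʳ-* X O e) ⟩
    X * (X ^ e * O ^ e * (X ∸ B) * Γ)
      ≡⟨ regroup₁ X (X ^ e) (O ^ e) (X ∸ B) Γ ⟩
    X ^ e * (X * (X ∸ B)) * (Γ * O ^ e)
      ≤⟨ ℕ.*-monoˡ-≤ (Γ * O ^ e) (ℕ.*-monoʳ-≤ (X ^ e) (∸-superadditive X (e * c) (ℓ * ℓ))) ⟩
    X ^ e * ((X ∸ e * c) * (X ∸ ℓ * ℓ)) * (Γ * O ^ e)
      ≡⟨ regroup₂ (X ^ e) (X ∸ e * c) (X ∸ ℓ * ℓ) Γ (O ^ e) ⟩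
    X ^ e * (X ∸ e * c) * ((X ∸ ℓ * ℓ) * Γ * O ^ e)
      ≤⟨ ℕ.*-monoˡ-≤ ((X ∸ ℓ * ℓ) * Γ * O ^ e) (bernoulli X c e) ⟩
    (X ∸ c) ^ e * X * ((X ∸ ℓ * ℓ) * Γ * O ^ e)
      ≡⟨ regroup₃ ((X ∸ c) ^ e) X ((X ∸ ℓ * ℓ) * Γ * O ^ e) ⟩
    X * ((X ∸ c) ^ e * ((X ∸ ℓ * ℓ) * Γ * O ^ e))
      ≤⟨ ℕ.*-monoʳ-≤ X (deg-bound Γ≤ T ∣T∣≡) ⟩
    X * (X * m ^ e * (e ! * deg H T))
      ≡⟨ cong (X *_) (ℕ.*-assoc X (m ^ e) _) ⟩
    X * (X * (m ^ e * (e ! * deg H T))) ∎)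
    where
    regroup₁ : ∀ x y o b g → x * (y * o * b * g) ≡ y * (x * b) * (g * o)
    regroup₁ = solve-∀
    regroup₂ : ∀ y v w g o → y * (v * w) * (g * o) ≡ y * v * (w * g * o)
    regroup₂ = solve-∀
    regroup₃ : ∀ y x z → y * x * z ≡ x * (y * z)
    regroup₃ = solve-∀
  deg> : ∀ T → ∣ T ∣ ≡ ℓ → p * (n C e) < deg H T * d
  -- As a strict inequality of integers, `dense` gives suc P ≤ Γ * d. This relative gain outweighs
  -- the loss B / X once X exceeds B * suc P, which is how the bound on X arises.
  deg> T ∣T∣≡ = ℕ.≰⇒> λ deg≤ → ℕ.<⇒≱ X> (slack P B X (ℕ.*-cancelˡ-≤ (n ^ e) {{ℕ.m^n≢0 n e}} (begin
    n ^ e * ((X ∸ B) * suc P)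
      ≤⟨ ℕ.*-monoʳ-≤ (n ^ e) (ℕ.*-monoʳ-≤ (X ∸ B) dense) ⟩
    n ^ e * ((X ∸ B) * (Γ * d))
      ≡⟨ regroup₁ (n ^ e) (X ∸ B) Γ d ⟩
    n ^ e * (X ∸ B) * Γ * d
      ≤⟨ ℕ.*-monoˡ-≤ d (count T ∣T∣≡) ⟩
    X * (m ^ e * (e ! * deg H T)) * d
      ≡⟨ regroup₂ X (m ^ e) (e !) (deg H T) d ⟩
    X * (m ^ e * (e ! * (deg H T * d)))
      ≤⟨ ℕ.*-monoʳ-≤ X (ℕ.*-monoʳ-≤ (m ^ e) (ℕ.*-monoʳ-≤ (e !) deg≤)) ⟩
    X * (m ^ e * (e ! * (p * (n C e))))
      ≡⟨ regroup₃ X (m ^ e) (e !) p (n C e) ⟩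
    X * (m ^ e * p) * (e ! * (n C e))
      ≤⟨ ℕ.*-monoʳ-≤ (X * (m ^ e * p)) (k!*nCk≤n^k n e) ⟩
    X * (m ^ e * p) * n ^ e
      ≡⟨ regroup₄ X (m ^ e) p (n ^ e) ⟩
    n ^ e * (P * X) ∎)))
    where
    regroup₁ : ∀ n x g d → n * (x * (g * d)) ≡ n * x * g * d
    regroup₁ = solve-∀
    regroup₂ : ∀ x m f g d → x * (m * (f * g)) * d ≡ x * (m * (f * (g * d)))
    regroup₂ = solve-∀
    regroup₃ : ∀ x m f p c → x * (m * (f * (p * c))) ≡ x * (m * p) * (f * c)
    regroup₃ = solve-∀
    regroup₄ : ∀ x m p n → x * (m * p) * n ≡ n * (p * m * x)
    regroup₄ = solve-∀

ex-lower-bound : ∀ a e w {m Γ} (G : Graph (e + 1) m) {{_ : NonZero m}} → 1 ≤ e → e ≤ w →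
  ¬ Contains G (K (w + 1) (e + 1)) → TupleDegree≥ G Γ → ∀ p d → p * m ^ e < Γ * d →
  ∀ N₀ → ∃ λ n → N₀ ≤ n × 0 < n C e × p * (n C e) < ex (suc a) n (K (suc a + w) (suc a + e)) * d
ex-lower-bound a e w {m} G 1≤e e≤w G-free Γ≤ p d dense N₀ =
  let n , X≤n , C>0 , lt = lift-ratio a e w G (colouring (suc (B + N₀)) m (suc (B + N₀))) 1≤e e≤w G-free Γ≤ p d dense (s≤s (ℕ.m≤m+n B N₀))
  in n , ℕ.≤-trans (ℕ.≤-trans (ℕ.m≤n+m N₀ B) (ℕ.n≤1+n _)) X≤n , C>0 , lt
  where
  B : ℕ
  B = (e * (suc a + e) + suc a * suc a) * suc (p * m ^ e)

δ₁-tupleDegree : ∀ {e m} (G : Graph (e + 1) m) → TupleDegree≥ G (e ! * δ 1 G)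
δ₁-tupleDegree {e} {m} G c = begin
  e ! * δ 1 G
    ≤⟨ ℕ.*-monoʳ-≤ (e !) (minimum-≤ _ (∈-map⁺ (deg G) (∈-subsetsOfSize⁺ (Subset.∣⁅x⁆∣≡1 c)))) ⟩
  e ! * deg G ⁅ c ⁆
    ≡⟨ tuples-deg G ⁅ c ⁆ e (trans (cong (_+ e) (Subset.∣⁅x⁆∣≡1 c)) (ℕ.+-comm 1 e)) ⟨
  ∑ (tuples m e) (λ cs → 𝟙 (set cs ∪ ⁅ c ⁆ ∈? edges G))
    ≡⟨ ∑-cong (tuples m e) (λ cs → cong (λ S → 𝟙 (S ∈? edges G)) (Subset.∪-comm (set cs) ⁅ c ⁆)) ⟩
  ∑ (tuples m e) (λ cs → 𝟙 (set (c ∷ cs) ∈? edges G)) ∎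
  where open ℕ.≤-Reasoning

-- The maximum of an empty list is 0 by convention, so only a positive value certifies that some
-- graph attains it.
ex-attained : ∀ {r s n} j (F : Graph s r) → 0 < ex {s} j n F → ∃ λ (G : Graph s n) → ¬ Contains G F × ex j n F ≡ δ j G
ex-attained {r} {s} {n} j F 0<ex with ∈-map⁻ (δ j) (maximum-∈ _ 0<ex)
... | G , G∈ , eq = G , proj₂ (∈-filter⁻ (λ H → ¬? (contains? H F)) {xs = allGraphs s n} G∈) , eq

-- A lower bound p′ / d′ > p / d for the ratio of δ 1 G to m C e gives density above p / d among
-- all m ^ e tuples, as e ! * (m C e) ≥ (1 - e² / m) * m ^ e.
δ₁-dense : ∀ {e m Δ p d p′ d′} → p * d′ < p′ * d → e * e * suc (p * d′) < m →
           p′ * (m C e) < Δ * d′ → p * m ^ e < e ! * Δ * d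
δ₁-dense {e} {m} {Δ} {p} {d} {p′} {d′} pd′<p′d m> p′C<Δd′ = ℕ.≰⇒> λ le →
  ℕ.<⇒≱ m> (slack (p * d′) (e * e) m (ℕ.*-cancelˡ-≤ (m ^ e) {{ℕ.m^n≢0 m e {{m≢0}}}} (begin
    m ^ e * ((m ∸ e * e) * suc (p * d′))
      ≤⟨ ℕ.*-monoʳ-≤ (m ^ e) (ℕ.*-monoʳ-≤ (m ∸ e * e) pd′<p′d) ⟩
    m ^ e * ((m ∸ e * e) * (p′ * d))
      ≡⟨ ℕ.*-assoc (m ^ e) _ _ ⟨
    m ^ e * (m ∸ e * e) * (p′ * d)
      ≤⟨ ℕ.*-monoˡ-≤ (p′ * d) (bernoulli m e e) ⟩
    (m ∸ e) ^ e * m * (p′ * d)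
      ≤⟨ ℕ.*-monoˡ-≤ (p′ * d) (ℕ.*-monoˡ-≤ m ([n∸k]^k≤k!*nCk m e)) ⟩
    e ! * (m C e) * m * (p′ * d)
      ≡⟨ regroup₁ (e !) (m C e) m p′ d ⟩
    e ! * m * d * (p′ * (m C e))
      ≤⟨ ℕ.*-monoʳ-≤ (e ! * m * d) (ℕ.<⇒≤ p′C<Δd′) ⟩
    e ! * m * d * (Δ * d′)
      ≡⟨ regroup₂ (e !) m d Δ d′ ⟩
    e ! * Δ * d * (m * d′)
      ≤⟨ ℕ.*-monoˡ-≤ (m * d′) le ⟩
    p * m ^ e * (m * d′)
      ≡⟨ regroup₃ p (m ^ e) m d′ ⟩
    m ^ e * (p * d′ * m) ∎)))
  where
  open ℕ.≤-Reasoning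
  m≢0 : NonZero m
  m≢0 = ℕ.>-nonZero (ℕ.≤-<-trans z≤n m>)
  regroup₁ : ∀ f c m p d → f * c * m * (p * d) ≡ f * m * d * (p * c)
  regroup₁ = solve-∀
  regroup₂ : ∀ f m d g d′ → f * m * d * (g * d′) ≡ f * g * d * (m * d′)
  regroup₂ = solve-∀
  regroup₃ : ∀ p x m d → p * x * (m * d) ≡ x * (p * d * m)
  regroup₃ = solve-∀

Dense : ℕ → ℕ → ℕ → ℕ → Set
Dense e w p d = ∃ λ m → ∃ λ Γ → ∃ λ (G : Graph (e + 1) m) →
  NonZero m × ¬ Contains G (K (w + 1) (e + 1)) × TupleDegree≥ G Γ × p * m ^ e < Γ * d

limsup-lower-bound : ∀ a e w → 1 ≤ e → e ≤ w → ∀ q →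
  (∀ {p d} .{cop : Coprime p (suc d)} → q ≡ mkℚ (+ p) d cop → Dense e w p (suc d)) →
  ∀ N₀ → ∃ λ (n≥ : ∃ λ n → N₀ ≤ n) →
  q ℚ.< ratio (ex (suc a) (proj₁ n≥) (K (suc a + w) (suc a + e))) (proj₁ n≥ C e)
-- Every ratio is nonnegative, so below 0 any n works. Density is therefore demanded only for
-- nonnegative rationals.
limsup-lower-bound a e w 1≤e e≤w (mkℚ -[1+ p ] d _) dense N₀ =
  (N₀ , ℕ.≤-refl) , negative<ratio (ex (suc a) N₀ (K (suc a + w) (suc a + e))) (N₀ C e)
limsup-lower-bound a e w 1≤e e≤w (mkℚ (+ p) d _) dense N₀ =
  let m , Γ , G , m≢0 , G-free , Γ≤ , p<Γ = dense refl
      n , N₀≤n , C>0 , lt = ex-lower-bound a e w {m} {Γ} G {{m≢0}} 1≤e e≤w G-free Γ≤ p (suc d) p<Γ N₀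
  in (n , N₀≤n) , <-ratio⁺ p d (ex (suc a) n (K (suc a + w) (suc a + e))) (n C e) C>0 lt

π-lower-bound : ∀ {ℓ k t} e w → 1 ≤ ℓ → 1 ≤ e → e ≤ w → k ≡ ℓ + e → t ≡ ℓ + w →
  ∀ {q q′} → q ℚ.< q′ → (∀ {p d} .{cop : Coprime p (suc d)} → q′ ≡ mkℚ (+ p) d cop → Dense e w p (suc d)) → π ℓ (K t k) ∋ q
-- Membership in an infimum requires a rational strictly above `q` that lies below every tail
-- supremum; `q′` is that witness.
π-lower-bound {suc a} e w 1≤ℓ 1≤e e≤w refl refl {q} {q′} q<q′ dense = q′ , q<q′ , λ N₀ →
  let (n , N₀≤n) , lt = limsup-lower-bound a e w 1≤e e≤w q′ dense N₀
  in (n , N₀≤n) , subst (λ d → q′ ℚ.< ratio (ex (suc a) n (K (suc a + w) (suc a + e))) (n C d)) (sym (ℕ.m+n∸m≡n a e)) lt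

<-cross : ∀ {p d p′ d′} .{cop : Coprime p (suc d)} .{cop′ : Coprime p′ (suc d′)} →
          mkℚ (+ p) d cop ℚ.< mkℚ (+ p′) d′ cop′ → p * suc d′ < p′ * suc d
<-cross {p} {d} {p′} {d′} (ℚ.*<* lt) = ℤ.drop‿+<+ (subst₂ ℤ._<_ (sym (ℤ.pos-* p (suc d′))) (sym (ℤ.pos-* p′ (suc d))) lt)

-- The gap between `q` and `q′` pays for measuring density among m ^ e tuples instead of m C e sets,
-- once m passes the threshold of `δ₁-dense`. The ratio exceeds q′ > q ≥ 0, so `ex` is positive and
-- attained.
dense-of-π₁ : ∀ e w {q q′} → q ℚ.< q′ →
  (∀ N → ∃ λ (m≥ : ∃ λ m → N ≤ m) → q′ ℚ.< ratio (ex 1 (proj₁ m≥) (K (w + 1) (e + 1))) (proj₁ m≥ C (e + 1 ∸ 1))) →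
  ∀ {p d} .{cop : Coprime p (suc d)} → q ≡ mkℚ (+ p) d cop → Dense e w p (suc d)
dense-of-π₁ e w {q′ = mkℚ -[1+ _ ] _ _} (ℚ.*<* lt) large {p} {d} refl =
  contradiction (subst (ℤ._< _) (sym (ℤ.pos-* p _)) lt) λ ()
dense-of-π₁ e w {q′ = q′@(mkℚ (+ p′) d′ _)} q<q′ large {p} {d} refl =
  let (m , m>) , lt = large (suc (e * e * suc (p * suc d′)))
      Δ = ex 1 m (K (w + 1) (e + 1))
      _ , p′C<Δd′ = <-ratio⁻ p′ d′ Δ (m C e)
        (subst (λ j → q′ ℚ.< ratio Δ (m C j)) (ℕ.m+n∸n≡m e 1) lt)
      G , G-free , Δ≡ = ex-attained 1 (K (w + 1) (e + 1)) (positive Δ (suc d′) (ℕ.≤-<-trans z≤n p′C<Δd′))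
  in m , e ! * δ 1 G , G , ℕ.>-nonZero (ℕ.≤-<-trans z≤n m>) , G-free , δ₁-tupleDegree G ,
     δ₁-dense {e} {m} {δ 1 G} {p} {suc d} {p′} {suc d′} (<-cross q<q′) m> (subst (λ Δ → p′ * (m C e) < Δ * suc d′) Δ≡ p′C<Δd′)
  where
  positive : ∀ a b → 0 < a * b → 0 < a
  positive (suc a) b _ = s≤s z≤n

-- Complete graphs and the codegree case.

K₂-tupleDegree : ∀ b → TupleDegree≥ {1} (K (suc b) 2) b
K₂-tupleDegree b c = ℕ.+-cancelˡ-≤ 1 b _ (begin
  suc b
    ≡⟨ trans (∑-const-Fin (suc b) 1) (ℕ.*-identityʳ (suc b)) ⟨
  ∑ (allFin (suc b)) (λ _ → 1)
    ≤⟨ ∑-mono (allFin (suc b)) each ⟩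
  ∑ (allFin (suc b)) (λ x → 𝟙 (c Fin.≟ x) + edge x)
    ≡⟨ ∑-+ (allFin (suc b)) (λ x → 𝟙 (c Fin.≟ x)) edge ⟩
  ∑ (allFin (suc b)) (λ x → 𝟙 (c Fin.≟ x)) + ∑ (allFin (suc b)) edge
    ≤⟨ ℕ.+-monoˡ-≤ _ (∑-𝟙≤1 (c Fin.≟_) (Unique.allFin⁺ (suc b)) λ p p′ → trans (sym p) p′) ⟩
  1 + ∑ (allFin (suc b)) edge
    ≡⟨ cong suc (∑-cong (allFin (suc b)) λ x → sym (ℕ.+-identityʳ (edge x))) ⟩
  1 + ∑ (allFin (suc b)) (λ x → edge x + 0)
    ≡⟨ cong suc (∑-choices-∷ (allFin (suc b)) [] (λ cs → 𝟙 (set (c ∷ cs) ∈? edges (K (suc b) 2)))) ⟨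
  1 + ∑ (tuples (suc b) 1) (λ cs → 𝟙 (set (c ∷ cs) ∈? edges (K (suc b) 2))) ∎)
  where
  open ℕ.≤-Reasoning
  edge : Fin (suc b) → ℕ
  edge x = 𝟙 (set (c ∷ x ∷ []) ∈? edges (K (suc b) 2))
  each : ∀ x → 1 ≤ 𝟙 (c Fin.≟ x) + edge x
  each x with c Fin.≟ x
  ... | yes _   = ℕ.m≤m+n 1 _
  ... | no  c≢x = ℕ.≤-reflexive (sym (𝟙-yes (set (c ∷ x ∷ []) ∈? edges (K (suc b) 2))
    (∈-K (∣set∣≡length ((c≢x ∷ []) ∷ [] ∷ [])))))

K₂-free : ∀ b → ¬ Contains (K (suc b) 2) (K (suc b + 1) 2)
K₂-free b (φ , φ-injective , _) =
  ℕ.1+n≰n (subst (_≤ suc b) (ℕ.+-comm (suc b) 1) (Fin.injective⇒≤ {f = lookup φ} λ {i} {j} → φ-injective i j))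

-- One fixed graph suffices here, without letting m grow: a random colour differs from a given one
-- with probability b / (b + 1), which is the exact tuple density.
dense-of-K₂ : ∀ b {q} → q ℚ.< + b / suc b → ∀ {p d} .{cop : Coprime p (suc d)} → q ≡ mkℚ (+ p) d cop → Dense 1 (suc b) p (suc d)
dense-of-K₂ b q< {p} {d} refl = suc b , b , K (suc b) 2 , _ , K₂-free b , K₂-tupleDegree b ,
  subst (λ m → p * m < b * suc d) (sym (ℕ.^-identityʳ (suc b))) (<-/⁻ p d b b q<)

codegree-bound : ∀ k t → 3 ≤ k → k ≤ t → π (k ∸ 1) (K t k) ≥ᴿ fromℚ (+ (t ∸ k) / suc (t ∸ k))
codegree-bound (suc ℓ) t 3≤k k≤t q q< =
  let q′ , q<q′ , q′< = ℚ.<-dense q<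
  in π-lower-bound 1 (suc (t ∸ suc ℓ)) (ℕ.≤-trans (s≤s z≤n) (ℕ.s≤s⁻¹ 3≤k)) ℕ.≤-refl (s≤s z≤n)
       (ℕ.+-comm 1 ℓ) (trans (sym (ℕ.m+[n∸m]≡n k≤t)) (sym (ℕ.+-suc ℓ (t ∸ suc ℓ)))) q<q′ (dense-of-K₂ (t ∸ suc ℓ) q′<)

corollary1p2 : (∀ (ℓ k t : ℕ) → 2 ≤ ℓ → ℓ < k → k ≤ t →
    π ℓ (K t k) ≥ᴿ π 1 (K (t ∸ ℓ + 1) (k ∸ ℓ + 1)))
    × (∀ (k t : ℕ) → 3 ≤ k → k ≤ t →
    π (k ∸ 1) (K t k) ≥ᴿ fromℚ (+ (t ∸ k) / suc (t ∸ k)))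
    × (∀ (k : ℕ) → 3 ≤ k →
    π (k ∸ 1) (K (k + 1) k) ≥ᴿ fromℚ ½)
corollary1p2 =
    (λ ℓ k t 2≤ℓ ℓ<k k≤t q (q₂ , q<q₂ , large) →
      -- Two gaps are needed: the one from `q` to `q₁` for the infimum in π_ℓ, and the one from `q₁`
      -- to `q₂` for passing from sets of colours to tuples.
      let q₁ , q<q₁ , q₁<q₂ = ℚ.<-dense q<q₂
      in π-lower-bound (k ∸ ℓ) (t ∸ ℓ) (ℕ.<⇒≤ 2≤ℓ) (ℕ.m<n⇒0<n∸m ℓ<k) (ℕ.∸-monoˡ-≤ ℓ k≤t)
           (sym (ℕ.m+[n∸m]≡n (ℕ.<⇒≤ ℓ<k))) (sym (ℕ.m+[n∸m]≡n (ℕ.≤-trans (ℕ.<⇒≤ ℓ<k) k≤t)))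
           q<q₁ (dense-of-π₁ (k ∸ ℓ) (t ∸ ℓ) q₁<q₂ large))
  , codegree-bound
  , λ k 3≤k q q<½ → codegree-bound k (k + 1) 3≤k (ℕ.m≤m+n k 1) q
      (subst (λ b → q ℚ.< + b / suc b) (sym (ℕ.m+n∸m≡n k 1)) q<½)
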